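{- Let $n\equiv 1\pmod{4}$ be a positive integer and let $a,b,c$ be indeterminates. Then \[ \sum_{k=0}^{(n+1)/2} \frac{(1+aq^{4k-1})\, (a^2/q^2, b/q^2, c/q^2;q^4)_k } {(1+aq^{ -1})\, (a^2q^4/b, a^2q^4/c, q^4;q^4)_k } \left(\frac{aq^7}{bc}\right)^k \equiv 0\pmod{(1-a^2q^{2n})}; \] in particular, if moreover $n>1$, \[ \sum_{k=0}^{(n+1)/2} \frac{(1+q^{4k-1})\, (q^{ -2};q^4)_k^3}{(1+q)\,(q^4;q^4)_k^3}\, q^{7k} \equiv 0\pmod{\Phi_n(q)\Phi_n(-q)}. \]
   Context: Here $q,a,b,c$ are indeterminates. For $x$ and a base $p$ (a power of $q$), $(x;p)_k=\prod_{j=0}^{k-1}(1-xp^j)$ and $(x_1,\dots,x_m;p)_k=(x_1;p)_k\cdots(x_m;p)_k$. $\Phi_n(q)$ is the $n$-th cyclotomic polynomial. For rational functions $A,B$ in these variables and a polynomial $P$, $A\equiv B\pmod{P}$ means that the numerator of the reduced form of $A-B$ is divisible by $P$ in the polynomial ring over $\mathbb{Z}$ in these variables. -}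

module Defs where

open import Data.Nat as ℕ using (ℕ; zero; suc; _<ᵇ_)
open import Data.Nat.Divisibility using (_∣?_)
open import Data.Integer as ℤ using (ℤ; +_; -[1+_]; 0ℤ; 1ℤ)
open import Data.Bool using (if_then_else_)
open import Data.List using (List; []; _∷_; map; foldr; length; reverse; replicate; _++_; upTo)
open import Data.Product using (_×_; _,_; proj₁; proj₂; ∃; Σ)
open import Data.Product.Properties using (≡-dec)
import Data.Nat.Properties as ℕP
open import Relation.Binary.PropositionalEquality using (_≡_)
open import Relation.Nullary using (¬_; yes; no; does)

-- exponent vector (e_q , e_a , e_b , e_c)
Mon : Set
Mon = ℕ × ℕ × ℕ × ℕ

_≟M_ : (x y : Mon) → Relation.Nullary.Dec (x ≡ y)
_≟M_ = ≡-dec ℕP._≟_ (≡-dec ℕP._≟_ (≡-dec ℕP._≟_ ℕP._≟_))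

Poly : Set
Poly = List (ℤ × Mon)

monAdd : Mon → Mon → Mon
monAdd (i , j , k , l) (i' , j' , k' , l') = (i ℕ.+ i' , j ℕ.+ j' , k ℕ.+ k' , l ℕ.+ l')

coeff : Poly → Mon → ℤ
coeff [] e = 0ℤ
coeff ((c , e') ∷ p) e = if does (e' ≟M e) then c ℤ.+ coeff p e else coeff p e

_≈P_ : Poly → Poly → Set
p ≈P r = ∀ e → coeff p e ≡ coeff r e

infix 4 _≈P_ _∣P_

0P : Poly
0P = []

1P : Poly
1P = (1ℤ , 0 , 0 , 0 , 0) ∷ []

_+P_ : Poly → Poly → Poly
p +P r = p ++ r

-P_ : Poly → Poly
-P p = map (λ t → ℤ.- proj₁ t , proj₂ t) p

_-P_ : Poly → Poly → Poly
p -P r = p +P (-P r)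

_*P_ : Poly → Poly → Poly
[] *P r = []
((c , e) ∷ p) *P r = map (λ t → c ℤ.* proj₁ t , monAdd e (proj₂ t)) r ++ (p *P r)

infixl 6 _+P_ _-P_
infixl 7 _*P_

monomial : ℤ → ℕ → ℕ → ℕ → ℕ → Poly
monomial z i j k l = (z , i , j , k , l) ∷ []

_∣P_ : Poly → Poly → Set
p ∣P r = ∃ λ s → p *P s ≈P r

CoprimeP : Poly → Poly → Set
CoprimeP p r = ∀ g → g ∣P p → g ∣P r → g ∣P 1P

Frac : Set
Frac = Poly × Poly

fromPoly : Poly → Frac
fromPoly p = p , 1P

_+F_ : Frac → Frac → Frac
(n , d) +F (n' , d') = (n *P d' +P n' *P d , d *P d')

_*F_ : Frac → Frac → Frac
(n , d) *F (n' , d') = (n *P n' , d *P d')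

_/F_ : Frac → Frac → Frac
(n , d) /F (n' , d') = (n *P d' , d *P n')

1F : Frac
1F = fromPoly 1P

infixl 6 _+F_
infixl 7 _*F_ _/F_

_-F_ : Frac → Frac → Frac
(n , d) -F (n' , d') = (n *P d' -P n' *P d , d *P d')
infixl 6 _-F_

_^F_ : Frac → ℕ → Frac
x ^F zero = 1F
x ^F suc k = x *F (x ^F k)

posPart negPart : ℤ → ℕ
posPart (+ n) = n
posPart -[1+ n ] = 0
negPart (+ n) = 0
negPart -[1+ n ] = suc n

monF : ℤ → ℤ → ℤ → ℤ → Frac
monF i j k l =
  monomial 1ℤ (posPart i) (posPart j) (posPart k) (posPart l) ,
  monomial 1ℤ (negPart i) (negPart j) (negPart k) (negPart l)

poch : Frac → Frac → ℕ → Frac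
poch x p zero = 1F
poch x p (suc k) = poch x p k *F (1F -F x *F (p ^F k))

sumF : ℕ → (ℕ → Frac) → Frac
sumF zero f = f 0
sumF (suc N) f = sumF N f +F f (suc N)

-- A ≡ 0 (mod P): the numerator N of the reduced form N/D of A is divisible by P.
-- (A reduced form is N/D with D ≠ 0, N and D coprime, and A = N/D.)
CongZero : Frac → Poly → Set
CongZero (n , d) P =
  Σ Poly λ N → Σ Poly λ D →
    (¬ (D ≈P 0P)) × CoprimeP N D × (n *P D ≈P N *P d) × (P ∣P N)

Cong : Frac → Frac → Poly → Set
Cong A B P = CongZero (A -F B) P

-- Univariate integer polynomials (little-endian coefficient lists) and
-- cyclotomic polynomials, computed via  q^n - 1 = ∏_{d ∣ n} Φ_d(q).

UPoly : Set
UPoly = List ℤ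

uadd : UPoly → UPoly → UPoly
uadd [] r = r
uadd (x ∷ p) [] = x ∷ p
uadd (x ∷ p) (y ∷ r) = (x ℤ.+ y) ∷ uadd p r

umul : UPoly → UPoly → UPoly
umul [] r = []
umul (x ∷ p) r = uadd (map (x ℤ.*_) r) (0ℤ ∷ umul p r)

xn1 : ℕ → UPoly
xn1 zero = 0ℤ ∷ []
xn1 (suc n) = ℤ.- 1ℤ ∷ (replicate n 0ℤ ++ (1ℤ ∷ []))

subFront : List ℤ → List ℤ → List ℤ
subFront xs [] = xs
subFront [] (y ∷ ys) = ℤ.- y ∷ subFront [] ys
subFront (x ∷ xs) (y ∷ ys) = (x ℤ.- y) ∷ subFront xs ys

-- long division (big-endian) by a monic polynomial 1 ∷ gt; quotient only
divBE : ℕ → List ℤ → List ℤ → List ℤ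
divBE zero gt f = []
divBE (suc k) gt [] = []
divBE (suc k) gt (c ∷ rest) =
  if length rest <ᵇ length gt then []
  else c ∷ divBE k gt (subFront rest (map (c ℤ.*_) gt))

dropLead : List ℤ → List ℤ
dropLead [] = []
dropLead (_ ∷ xs) = xs

-- quotient of f by the monic polynomial g (little-endian, g with nonzero top coefficient 1)
udiv : UPoly → UPoly → UPoly
udiv f g = reverse (divBE (length f) (dropLead (reverse g)) (reverse f))

cycTable : ℕ → List (ℕ × UPoly)
prodDiv : ℕ → List (ℕ × UPoly) → UPoly
prodDiv m [] = 1ℤ ∷ []
prodDiv m ((d , φ) ∷ t) = if does (d ∣? m) then umul φ (prodDiv m t) else prodDiv m t

cycTable zero = []
cycTable (suc n) = cycTable n ++ ((suc n , udiv (xn1 (suc n)) (prodDiv (suc n) (cycTable n))) ∷ [])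

-- Φ_n(q) as a univariate coefficient list (Φ_0 := 1 by convention; unused)
cycU : ℕ → UPoly
cycU zero = 1ℤ ∷ []
cycU (suc n) = udiv (xn1 (suc n)) (prodDiv (suc n) (cycTable n))

toPolyFrom : ℕ → UPoly → Poly
toPolyFrom i [] = []
toPolyFrom i (x ∷ p) = (x , i , 0 , 0 , 0) ∷ toPolyFrom (suc i) p

negAlt : UPoly → UPoly
negAlt [] = []
negAlt (x ∷ []) = x ∷ []
negAlt (x ∷ y ∷ p) = x ∷ ℤ.- y ∷ negAlt p

Φ : ℕ → Poly
Φ n = toPolyFrom 0 (cycU n)

Φ⁻ : ℕ → Poly
Φ⁻ n = toPolyFrom 0 (negAlt (cycU n))

private
  z : ℕ → ℤ
  z n = + n

q⁴ : Frac
q⁴ = monF (+ 4) 0ℤ 0ℤ 0ℤ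

summand₁ : ℕ → Frac
summand₁ k =
  ((1F +F monF (+ (4 ℕ.* k) ℤ.- 1ℤ) 1ℤ 0ℤ 0ℤ)
     *F poch (monF (ℤ.- + 2) (+ 2) 0ℤ 0ℤ) q⁴ k
     *F poch (monF (ℤ.- + 2) 0ℤ 1ℤ 0ℤ) q⁴ k
     *F poch (monF (ℤ.- + 2) 0ℤ 0ℤ 1ℤ) q⁴ k)
  /F ((1F +F monF (ℤ.- 1ℤ) 1ℤ 0ℤ 0ℤ)
     *F poch (monF (+ 4) (+ 2) (ℤ.- 1ℤ) 0ℤ) q⁴ k
     *F poch (monF (+ 4) (+ 2) 0ℤ (ℤ.- 1ℤ)) q⁴ k
     *F poch q⁴ q⁴ k)
  *F (monF (+ 7) 1ℤ (ℤ.- 1ℤ) (ℤ.- 1ℤ) ^F k)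

summand₂ : ℕ → Frac
summand₂ k =
  ((1F +F monF (+ (4 ℕ.* k) ℤ.- 1ℤ) 0ℤ 0ℤ 0ℤ)
     *F (poch (monF (ℤ.- + 2) 0ℤ 0ℤ 0ℤ) q⁴ k ^F 3))
  /F ((1F +F monF 1ℤ 0ℤ 0ℤ 0ℤ) *F (poch q⁴ q⁴ k ^F 3))
  *F monF (+ (7 ℕ.* k)) 0ℤ 0ℤ 0ℤ

{-# OPTIONS --safe #-}

-- Put p = q⁴, N = (n + 1)/2 (odd, since n ≡ 1 mod 4). After cancelling monomials, the k-th summand is
--   (q + apᵏ)(aq)ᵏ ∏_{j<k} (q² - a²pʲ)(q² - bpʲ)(q² - cpʲ)  over  (q + a) ∏_{1≤i≤k} (b - a²pⁱ)(c - a²pⁱ)(1 - pⁱ).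
-- Modulo 1 - a²q²ⁿ one has a²pᴺ = q², and then the summands k and N - k, brought to the common
-- denominator, are opposite; as N is odd, the numerator vanishes.
--
-- The numerator is divisible by q + a, and what remains is in lowest terms: at b = a²y, c = a²z the
-- numerator has lowest term qᵐaᴺ with respect to a. So it is nonzero modulo each b - a²pⁱ and c - a²pⁱ,
-- and a non-zero-divisor modulo 1 - pⁱ, where q is a unit.
--
-- For a = b = c = 1 the modulus becomes 1 - q²ⁿ, a multiple of Φₙ(q)Φₙ(-q). The fraction, now in ℤ[q],
-- is reduced by pseudo-division and Gauss's lemma. The factor removed divides q ∏ (1 - pⁱ)³ with i < n,
-- which has no factor in common with Φₙ(q)Φₙ(-q): if n ∤ m, then qᵐ - 1 is a non-zero-divisor modulo Φₙ,
-- because the integer n/d lies in the ideal (Φₙ, qᵈ - 1) for d = gcd(m, n).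

module Submission where

open import Defs
open import Level using (0ℓ)
open import Algebra.Bundles using (CommutativeRing; RawRing)
import Algebra.Properties.Ring
import Algebra.Solver.Ring
open import Algebra.Solver.Ring.AlmostCommutativeRing
  using (AlmostCommutativeRing; fromCommutativeRing; _-Raw-AlmostCommutative⟶_)
open import Data.Bool as Bool using (if_then_else_; true; false)
open import Data.Integer as ℤ using (ℤ; +_; -[1+_]; 0ℤ; 1ℤ; ∣_∣)
import Data.Integer.Divisibility.Signed as ℤD
import Data.Integer.Properties as ℤP
import Data.Integer.Tactic.RingSolver as ℤSolver
open import Data.List using (List; []; _∷_; map; _++_; _∷ʳ_; length; replicate; reverse)
import Data.List.Properties as ListP
open import Data.List.Relation.Unary.All as All using (All; []; _∷_)
import Data.List.Relation.Unary.All.Properties as AllP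
open import Data.Maybe using (Maybe; just; nothing)
open import Data.Nat as ℕ using (ℕ; zero; suc; _<ᵇ_)
open import Data.Nat.Coprimality using (Coprime; coprime-Bézout; coprime-divisor)
import Data.Nat.Divisibility as ℕD
import Data.Nat.DivMod as ℕDM
open import Data.Nat.GCD using (module Bézout; gcd; gcd-GCD; gcd[m,n]∣m; gcd[m,n]∣n)
import Data.Nat.ListAction as ℕL
open import Data.Nat.Primality using (Prime; prime⇒irreducible; prime⇒nonZero)
open import Data.Nat.Primality.Factorisation using (factorise; PrimeFactorisation)
import Data.Nat.Properties as ℕP
import Data.Nat.Tactic.RingSolver as ℕSolver
open import Data.Product using (_×_; _,_; proj₁; proj₂; ∃)
open import Data.Sum using (_⊎_; inj₁; inj₂)
import Relation.Binary.Reasoning.Setoid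
open import Relation.Binary.PropositionalEquality as ≡ using (_≡_; _≢_)
open import Relation.Nullary using (¬_; yes; no; does; contradiction)
open import Relation.Nullary.Decidable using (dec-true)

-- Instead of unique factorisation the proof rests on `Reg u f`: multiplication by `f` is injective
-- modulo `u`. For a prime `u` this says that `u` does not divide `f`. It can be read off lowest
-- coefficients (`reg-lowest`), is multiplicative in `f`, and has the two consequences wanted of
-- coprimality: `f` may be removed from `u ∣ f * t`, and, for cancellable `u`, a common divisor of
-- `f` and `u * s` divides `s` (`drop-factor`).
--
-- The modulus 1 - a²q²ⁿ is (1 - aqⁿ)(1 + aqⁿ), so `a` has no single value modulo it, and the
-- pairing may use only a²pᴺ = q². With N = 2r + 1 the element v = apʳ satisfies v²p = q², hence
-- v²q² = 1, and this identity alone makes paired summands opposite.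
--
-- The congruences concern the reduced form of a fraction. For the second sum none is explicit: at a
-- = b = c = 1 numerator and denominator may acquire further common factors. Its reduced form
-- therefore comes from a gcd computation, and the argument has to work whatever factor this
-- removes.

module IntegerSolver (R : CommutativeRing 0ℓ 0ℓ) where
  open CommutativeRing R renaming (Carrier to A; zero to *-zero)
  open Algebra.Properties.Ring ring
  open Relation.Binary.Reasoning.Setoid setoid

  -- The case `1` is separate so that `int 1ℤ` is `1#` by definition; the constants `:1` in solver
  -- equations then match the goals without a trailing `+ 0#`.
  nat : ℕ → A
  nat 0 = 0#
  nat 1 = 1#
  nat (suc (suc n)) = 1# + nat (suc n)

  int : ℤ → A
  int (+ n) = nat n
  int -[1+ n ] = - nat (suc n)

  private
    nat-suc : ∀ n → nat (suc n) ≈ 1# + nat n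
    nat-suc zero = sym (+-identityʳ 1#)
    nat-suc (suc n) = refl

    nat-+ : ∀ m n → nat (m ℕ.+ n) ≈ nat m + nat n
    nat-+ zero n = sym (+-identityˡ _)
    nat-+ (suc m) n = begin
      nat (suc (m ℕ.+ n)) ≈⟨ nat-suc (m ℕ.+ n) ⟩
      1# + nat (m ℕ.+ n) ≈⟨ +-congˡ (nat-+ m n) ⟩
      1# + (nat m + nat n) ≈⟨ +-assoc _ _ _ ⟨
      1# + nat m + nat n ≈⟨ +-congʳ (nat-suc m) ⟨
      nat (suc m) + nat n ∎

    nat-* : ∀ m n → nat (m ℕ.* n) ≈ nat m * nat n
    nat-* zero n = sym (zeroˡ _)
    nat-* (suc m) n = begin
      nat (n ℕ.+ m ℕ.* n) ≈⟨ nat-+ n (m ℕ.* n) ⟩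
      nat n + nat (m ℕ.* n) ≈⟨ +-cong (sym (*-identityˡ _)) (nat-* m n) ⟩
      1# * nat n + nat m * nat n ≈⟨ distribʳ _ _ _ ⟨
      (1# + nat m) * nat n ≈⟨ *-congʳ (nat-suc m) ⟨
      nat (suc m) * nat n ∎

  int-neg : ∀ x → int (ℤ.- x) ≈ - int x
  int-neg (+ zero) = sym -0#≈0#
  int-neg (+ suc n) = refl
  int-neg -[1+ n ] = sym (-‿involutive _)

  private
    int-⊖ : ∀ m n → int (m ℤ.⊖ n) ≈ nat m - nat n
    int-⊖ m zero = begin
      int (m ℤ.⊖ 0) ≡⟨ ≡.cong int (ℤP.⊖-≥ {m} {0} ℕ.z≤n) ⟩
      nat m ≈⟨ +-identityʳ _ ⟨
      nat m + 0# ≈⟨ +-congˡ -0#≈0# ⟨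
      nat m - 0# ∎
    int-⊖ zero (suc n) = sym (+-identityˡ _)
    int-⊖ (suc m) (suc n) = begin
      int (suc m ℤ.⊖ suc n) ≡⟨ ≡.cong int (ℤP.[1+m]⊖[1+n]≡m⊖n m n) ⟩
      int (m ℤ.⊖ n) ≈⟨ int-⊖ m n ⟩
      nat m - nat n ≈⟨ +-congˡ (+-identityˡ _) ⟨
      nat m + (0# - nat n) ≈⟨ +-congˡ (+-congʳ (-‿inverseʳ 1#)) ⟨
      nat m + (1# - 1# - nat n) ≈⟨ +-congˡ (+-assoc _ _ _) ⟩
      nat m + (1# + (- 1# - nat n)) ≈⟨ +-assoc _ _ _ ⟨
      nat m + 1# + (- 1# - nat n) ≈⟨ +-cong (+-comm _ _) (-‿+-comm _ _) ⟩
      1# + nat m - (1# + nat n) ≈⟨ +-cong (nat-suc m) (-‿cong (nat-suc n)) ⟨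
      nat (suc m) - nat (suc n) ∎

  int-+ : ∀ x y → int (x ℤ.+ y) ≈ int x + int y
  int-+ (+ m) (+ n) = nat-+ m n
  int-+ (+ m) -[1+ n ] = int-⊖ m (suc n)
  int-+ -[1+ m ] (+ n) = trans (int-⊖ n (suc m)) (+-comm _ _)
  int-+ -[1+ m ] -[1+ n ] = begin
    - nat (suc (suc (m ℕ.+ n))) ≡⟨ ≡.cong (λ k → - nat (suc k)) (ℕP.+-suc m n) ⟨
    - nat (suc m ℕ.+ suc n) ≈⟨ -‿cong (nat-+ (suc m) (suc n)) ⟩
    - (nat (suc m) + nat (suc n)) ≈⟨ -‿+-comm _ _ ⟨
    - nat (suc m) - nat (suc n) ∎

  private
    int-nat-* : ∀ m y → int (+ m ℤ.* y) ≈ nat m * int y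
    int-nat-* m (+ n) = trans (reflexive (≡.cong int (≡.sym (ℤP.pos-* m n)))) (nat-* m n)
    int-nat-* m -[1+ n ] = begin
      int (+ m ℤ.* -[1+ n ]) ≡⟨ ≡.cong int (ℤP.neg-distribʳ-* (+ m) (+ suc n)) ⟨
      int (ℤ.- (+ m ℤ.* + suc n)) ≈⟨ int-neg (+ m ℤ.* + suc n) ⟩
      - int (+ m ℤ.* + suc n) ≈⟨ -‿cong (int-nat-* m (+ suc n)) ⟩
      - (nat m * nat (suc n)) ≈⟨ -‿distribʳ-* _ _ ⟩
      nat m * - nat (suc n) ∎

  int-* : ∀ x y → int (x ℤ.* y) ≈ int x * int y
  int-* (+ m) y = int-nat-* m y
  int-* -[1+ m ] y = begin
    int (-[1+ m ] ℤ.* y) ≡⟨ ≡.cong int (ℤP.neg-distribˡ-* (+ suc m) y) ⟨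
    int (ℤ.- (+ suc m ℤ.* y)) ≈⟨ int-neg (+ suc m ℤ.* y) ⟩
    - int (+ suc m ℤ.* y) ≈⟨ -‿cong (int-nat-* (suc m) y) ⟩
    - (nat (suc m) * int y) ≈⟨ -‿distribˡ-* _ _ ⟩
    - nat (suc m) * int y ∎

  private
    almostRing : AlmostCommutativeRing 0ℓ 0ℓ
    almostRing = fromCommutativeRing R

    ℤ-raw : RawRing 0ℓ 0ℓ
    ℤ-raw = CommutativeRing.rawRing ℤP.+-*-commutativeRing

    int-morphism : ℤ-raw -Raw-AlmostCommutative⟶ almostRing
    int-morphism = record
      { ⟦_⟧ = int
      ; +-homo = int-+
      ; *-homo = int-*
      ; -‿homo = int-neg
      ; 0-homo = refl
      ; 1-homo = refl
      }

    int-≟ : ∀ x y → Maybe (int x ≈ int y)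
    int-≟ x y with x ℤP.≟ y
    ... | yes e = just (reflexive (≡.cong int e))
    ... | no _ = nothing

  open Algebra.Solver.Ring ℤ-raw almostRing int-morphism int-≟ public
    using (Polynomial; solve; _:=_; _:+_; _:*_; _:-_; :-_; con)

  :0 :1 : ∀ {n} → Polynomial n
  :0 = con 0ℤ
  :1 = con 1ℤ

-- Powers depend on the operations only, so that a ring and its quotients share them.
power : {A : Set} → (A → A → A) → A → A → ℕ → A
power _∙_ e x zero = e
power _∙_ e x (suc n) = x ∙ power _∙_ e x n

-- Divisibility, regular elements, quotient rings and variables

module Divisibility (R : CommutativeRing 0ℓ 0ℓ) where
  open CommutativeRing R renaming (Carrier to A; zero to *-zero) public
  open Algebra.Properties.Ring ring public
    using (-0#≈0#; -‿involutive; -‿distribˡ-*; -‿distribʳ-*)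
  open IntegerSolver R public
  open Relation.Binary.Reasoning.Setoid setoid

  infixr 8 _^_

  _^_ : A → ℕ → A
  _^_ = power _*_ 1#

  ^-cong : ∀ {x y} n → x ≈ y → x ^ n ≈ y ^ n
  ^-cong zero e = refl
  ^-cong (suc n) e = *-cong e (^-cong n e)

  ^-+ : ∀ x m n → x ^ (m ℕ.+ n) ≈ x ^ m * x ^ n
  ^-+ x zero n = sym (*-identityˡ _)
  ^-+ x (suc m) n = trans (*-congˡ (^-+ x m n)) (sym (*-assoc _ _ _))

  ^-distrib-* : ∀ x y n → (x * y) ^ n ≈ x ^ n * y ^ n
  ^-distrib-* x y zero = sym (*-identityˡ _)
  ^-distrib-* x y (suc n) = trans (*-congˡ (^-distrib-* x y n))
    (solve 4 (λ x y s t → x :* y :* (s :* t) := x :* s :* (y :* t)) refl x y (x ^ n) (y ^ n))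

  1^ : ∀ n → 1# ^ n ≈ 1#
  1^ zero = refl
  1^ (suc n) = trans (*-identityˡ _) (1^ n)

  ^-* : ∀ x m n → x ^ (m ℕ.* n) ≈ (x ^ m) ^ n
  ^-* x zero n = sym (1^ n)
  ^-* x (suc m) n = begin
    x ^ (n ℕ.+ m ℕ.* n) ≈⟨ ^-+ x n (m ℕ.* n) ⟩
    x ^ n * x ^ (m ℕ.* n) ≈⟨ *-congˡ (^-* x m n) ⟩
    x ^ n * (x ^ m) ^ n ≈⟨ ^-distrib-* x (x ^ m) n ⟨
    (x * x ^ m) ^ n ∎

  infix 4 _∣_

  record _∣_ (x y : A) : Set where
    constructor divides
    field
      quotient : A
      equality : x * quotient ≈ y

  ∣-refl : ∀ {x} → x ∣ x
  ∣-refl = divides 1# (*-identityʳ _)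

  ∣-respʳ : ∀ {x y z} → y ≈ z → x ∣ y → x ∣ z
  ∣-respʳ e (divides s h) = divides s (trans h e)

  ∣-respˡ : ∀ {x y z} → x ≈ y → x ∣ z → y ∣ z
  ∣-respˡ e (divides s h) = divides s (trans (*-congʳ (sym e)) h)

  ∣-trans : ∀ {x y z} → x ∣ y → y ∣ z → x ∣ z
  ∣-trans (divides s h) (divides t k) =
    divides (s * t) (trans (sym (*-assoc _ _ _)) (trans (*-congʳ h) k))

  ∣*ʳ : ∀ {x y} z → x ∣ y → x ∣ y * z
  ∣*ʳ z (divides s h) = divides (s * z) (trans (sym (*-assoc _ _ _)) (*-congʳ h))

  ∣*ˡ : ∀ {x y} z → x ∣ y → x ∣ z * y
  ∣*ˡ z d = ∣-respʳ (*-comm _ _) (∣*ʳ z d)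

  ∣+ : ∀ {x y z} → x ∣ y → x ∣ z → x ∣ y + z
  ∣+ (divides s h) (divides t k) = divides (s + t) (trans (distribˡ _ _ _) (+-cong h k))

  ∣-neg : ∀ {x y} → x ∣ y → x ∣ - y
  ∣-neg (divides s h) = divides (- s) (trans (sym (-‿distribʳ-* _ _)) (-‿cong h))

  ∣- : ∀ {x y z} → x ∣ y → x ∣ z → x ∣ y - z
  ∣- d e = ∣+ d (∣-neg e)

  ∣0 : ∀ {x} → x ∣ 0#
  ∣0 = divides 0# (zeroʳ _)

  1∣ : ∀ {x} → 1# ∣ x
  1∣ {x} = divides x (*-identityˡ x)

  0∣⇒≈0 : ∀ {x} → 0# ∣ x → x ≈ 0#
  0∣⇒≈0 (divides s h) = trans (sym h) (zeroˡ s)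

  ≈0⇒∣ : ∀ {x y} → y ≈ 0# → x ∣ y
  ≈0⇒∣ e = ∣-respʳ (sym e) ∣0

  ∣-mono : ∀ {x y z w} → x ∣ y → z ∣ w → x * z ∣ y * w
  ∣-mono (divides s h) (divides t k) = divides (s * t)
    (trans (solve 4 (λ x z s t → x :* z :* (s :* t) := x :* s :* (z :* t)) refl _ _ _ _) (*-cong h k))

  -- f is not a zero divisor modulo u; for u = 0 this says that f is cancellable.
  record Reg (u f : A) : Set where
    constructor reg
    field
      cancel∣ : ∀ t → u ∣ f * t → u ∣ t
  open Reg public

  Cancellable : A → Set
  Cancellable = Reg 0#

  cancel : ∀ {f x y} → Cancellable f → f * x ≈ f * y → x ≈ y
  cancel {f} {x} {y} c e = begin
    x ≈⟨ solve 2 (λ x y → x := x :- y :+ y) refl x y ⟩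
    x - y + y ≈⟨ +-congʳ (0∣⇒≈0 (cancel∣ c (x - y) (≈0⇒∣ f[x-y]≈0))) ⟩
    0# + y ≈⟨ +-identityˡ y ⟩
    y ∎
    where
    f[x-y]≈0 : f * (x - y) ≈ 0#
    f[x-y]≈0 = begin
      f * (x - y) ≈⟨ solve 3 (λ f x y → f :* (x :- y) := f :* x :- f :* y) refl f x y ⟩
      f * x - f * y ≈⟨ +-congʳ e ⟩
      f * y - f * y ≈⟨ -‿inverseʳ _ ⟩
      0# ∎

  cancellable : ∀ {f} → (∀ t → f * t ≈ 0# → t ≈ 0#) → Cancellable f
  cancellable h = reg λ t d → ≈0⇒∣ (h t (0∣⇒≈0 d))

  cancel-∣ : ∀ {f x y} → Cancellable f → f * x ∣ f * y → x ∣ y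
  cancel-∣ c (divides s h) = divides s (cancel c (trans (sym (*-assoc _ _ _)) h))

  reg-1 : ∀ {u} → Reg u 1#
  reg-1 = reg λ t → ∣-respʳ (*-identityˡ t)

  reg-resp : ∀ {u f g} → f ≈ g → Reg u f → Reg u g
  reg-resp e r = reg λ t d → cancel∣ r t (∣-respʳ (*-congʳ (sym e)) d)

  reg-* : ∀ {u f g} → Reg u f → Reg u g → Reg u (f * g)
  reg-* r s = reg λ t d → cancel∣ s t (cancel∣ r _ (∣-respʳ (*-assoc _ _ _) d))

  reg-^ : ∀ {u f} n → Reg u f → Reg u (f ^ n)
  reg-^ zero r = reg-1
  reg-^ (suc n) r = reg-* r (reg-^ n r)

  -- From `u ∣ f * t` follows `u ∣ f * h * t`, and `f * h` acts as `g`. With `g = 1#` this shows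
  -- that units modulo `u` are regular; with an integer for `g`, that it suffices to find this
  -- integer in the ideal generated by `u` and `f`.
  reg-mod : ∀ {u f g} h → u ∣ f * h - g → Reg u g → Reg u f
  reg-mod {u} {f} {g} h d r = reg λ t e → cancel∣ r t (∣-respʳ
    (solve 4 (λ f g h t → h :* (f :* t) :- (f :* h :- g) :* t := g :* t) refl f g h t)
    (∣- (∣*ˡ h e) (∣*ʳ t d)))

  reg-factor : ∀ {u f g} → f ∣ g → Reg u g → Reg u f
  reg-factor {u} (divides h e) r =
    reg-mod h (≈0⇒∣ (trans (+-congʳ e) (-‿inverseʳ _))) r

  reg-neg : ∀ {u f} → Reg u f → Reg u (- f)
  reg-neg {u} {f} = reg-factor (divides (- 1#) (solve 1 (λ f → (:- f) :* (:- :1) := f) refl f))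

  -- A regular sequence read in the other order: if `f * w` is `u * t`, then `w` is `u * w′`, and
  -- cancelling `u` leaves `f * w′` equal to `t`.
  reg-swap : ∀ {u f} → Cancellable u → Reg u f → Reg f u
  reg-swap {u} {f} c r = reg λ t (divides w fw≈ut) →
    let divides w′ uw′≈w = cancel∣ r w (divides t (sym fw≈ut))
    in divides w′ (cancel c (begin
      u * (f * w′) ≈⟨ solve 3 (λ u f w → u :* (f :* w) := f :* (u :* w)) refl u f w′ ⟩
      f * (u * w′) ≈⟨ *-congˡ uw′≈w ⟩
      f * w ≈⟨ fw≈ut ⟩
      u * t ∎))

  reg-product : ∀ {f g x} → Cancellable f → Reg f x → Reg g x → Reg (f * g) x
  reg-product {f} {g} {x} c r s = reg λ t (divides w e) →
    let divides t′ ft′≈t = cancel∣ r t (divides (g * w) (trans (sym (*-assoc _ _ _)) e))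
        d = cancel∣ s t′ (divides w (cancel c (begin
          f * (g * w) ≈⟨ *-assoc _ _ _ ⟨
          f * g * w ≈⟨ e ⟩
          x * t ≈⟨ *-congˡ ft′≈t ⟨
          x * (f * t′) ≈⟨ solve 3 (λ u f w → u :* (f :* w) := f :* (u :* w)) refl x f t′ ⟩
          f * (x * t′) ∎)))
    in ∣-respʳ ft′≈t (∣-mono ∣-refl d)

  -- Plays the role of the least common multiple: in `x = f * s` the factor `f` can be removed
  -- modulo `g`, so `g` divides `s`.
  *-∣ : ∀ {f g x} → Reg g f → f ∣ x → g ∣ x → f * g ∣ x
  *-∣ r (divides s e) d = ∣-respʳ e (∣-mono ∣-refl (cancel∣ r s (∣-respʳ (sym e) d)))

  -- Euclid's lemma without primes: if `g * v` is `m` and `g * t` is `p * s`, then `m * t` is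
  -- `p * s * v`, so `p` divides `t` by regularity and can be cancelled. This is how common divisors
  -- are stripped of the factors of a denominator.
  drop-factor : ∀ {p m g} s → Cancellable p → Reg p m → g ∣ m → g ∣ p * s → g ∣ s
  drop-factor {p} {m} {g} s c r (divides v gv≈m) (divides t gt≈ps) =
    let divides t′ pt′≈t = cancel∣ r t (divides (s * v) (begin
          p * (s * v) ≈⟨ *-assoc _ _ _ ⟨
          p * s * v ≈⟨ *-congʳ gt≈ps ⟨
          g * t * v ≈⟨ solve 3 (λ g t v → g :* t :* v := g :* v :* t) refl g t v ⟩
          g * v * t ≈⟨ *-congʳ gv≈m ⟩
          m * t ∎))
    in divides t′ (cancel c (begin
      p * (g * t′) ≈⟨ solve 3 (λ u f w → u :* (f :* w) := f :* (u :* w)) refl p g t′ ⟩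
      g * (p * t′) ≈⟨ *-congˡ pt′≈t ⟩
      g * t ≈⟨ gt≈ps ⟩
      p * s ∎))

  infix 4 _≈_[_]

  record _≈_[_] (x y u : A) : Set where
    constructor mod
    field
      ∣-diff : u ∣ x - y
  open _≈_[_] public

  module _ (u : A) where
    private
      lift : ∀ {x y} → x ≈ y → x ≈ y [ u ]
      lift e = mod (≈0⇒∣ (trans (+-congʳ e) (-‿inverseʳ _)))

    quotientRing : CommutativeRing 0ℓ 0ℓ
    quotientRing = record
      { Carrier = A ; _≈_ = λ x y → x ≈ y [ u ] ; _+_ = _+_ ; _*_ = _*_ ; -_ = -_ ; 0# = 0# ; 1# = 1#
      ; isCommutativeRing = record
        { isRing = record
          { +-isAbelianGroup = record
            { isGroup = record
              { isMonoid = record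
                { isSemigroup = record
                  { isMagma = record
                    { isEquivalence = record
                      { refl = lift refl
                      ; sym = λ { {x} {y} (mod d) → mod (∣-respʳ
                          (solve 2 (λ x y → :- (x :- y) := y :- x) refl x y) (∣-neg d)) }
                      ; trans = λ { {x} {y} {z} (mod d) (mod e) → mod (∣-respʳ
                          (solve 3 (λ x y z → x :- y :+ (y :- z) := x :- z) refl x y z) (∣+ d e)) }
                      }
                    ; ∙-cong = λ { {x} {y} {z} {w} (mod d) (mod e) → mod (∣-respʳ
                        (solve 4 (λ x y z w → x :- y :+ (z :- w) := x :+ z :- (y :+ w)) refl x y z w)
                        (∣+ d e)) }
                    }
                  ; assoc = λ x y z → lift (+-assoc x y z)
                  }
                ; identity = (λ x → lift (+-identityˡ x)) , (λ x → lift (+-identityʳ x))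
                }
              ; inverse = (λ x → lift (-‿inverseˡ x)) , (λ x → lift (-‿inverseʳ x))
              ; ⁻¹-cong = λ { {x} {y} (mod d) → mod (∣-respʳ
                  (solve 2 (λ x y → :- (x :- y) := :- x :- :- y) refl x y) (∣-neg d)) }
              }
            ; comm = λ x y → lift (+-comm x y)
            }
          ; *-cong = λ { {x} {y} {z} {w} (mod d) (mod e) → mod (∣-respʳ
              (solve 4 (λ x y z w → (x :- y) :* z :+ y :* (z :- w) := x :* z :- y :* w) refl x y z w)
              (∣+ (∣*ʳ z d) (∣*ˡ y e))) }
          ; *-assoc = λ x y z → lift (*-assoc x y z)
          ; *-identity = (λ x → lift (*-identityˡ x)) , (λ x → lift (*-identityʳ x))
          ; distrib = (λ x y z → lift (distribˡ x y z)) , (λ x y z → lift (distribʳ x y z))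
          }
        ; *-comm = λ x y → lift (*-comm x y)
        }
      }

    ≈⇒≈mod : ∀ {x y} → x ≈ y → x ≈ y [ u ]
    ≈⇒≈mod = lift

  record Endo : Set where
    field
      ⟦_⟧ : A → A
      ⟦⟧-cong : ∀ {x y} → x ≈ y → ⟦ x ⟧ ≈ ⟦ y ⟧
      ⟦+⟧ : ∀ x y → ⟦ x + y ⟧ ≈ ⟦ x ⟧ + ⟦ y ⟧
      ⟦*⟧ : ∀ x y → ⟦ x * y ⟧ ≈ ⟦ x ⟧ * ⟦ y ⟧
      ⟦1⟧ : ⟦ 1# ⟧ ≈ 1#

    ⟦0⟧ : ⟦ 0# ⟧ ≈ 0#
    ⟦0⟧ = begin
      ⟦ 0# ⟧ ≈⟨ solve 1 (λ x → x := x :+ x :- x) refl _ ⟩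
      ⟦ 0# ⟧ + ⟦ 0# ⟧ - ⟦ 0# ⟧ ≈⟨ +-congʳ (⟦+⟧ 0# 0#) ⟨
      ⟦ 0# + 0# ⟧ - ⟦ 0# ⟧ ≈⟨ +-congʳ (⟦⟧-cong (+-identityʳ 0#)) ⟩
      ⟦ 0# ⟧ - ⟦ 0# ⟧ ≈⟨ -‿inverseʳ _ ⟩
      0# ∎

    ⟦-⟧ : ∀ x → ⟦ - x ⟧ ≈ - ⟦ x ⟧
    ⟦-⟧ x = begin
      ⟦ - x ⟧ ≈⟨ solve 2 (λ x y → y := x :+ y :- x) refl ⟦ x ⟧ _ ⟩
      ⟦ x ⟧ + ⟦ - x ⟧ - ⟦ x ⟧ ≈⟨ +-congʳ (⟦+⟧ x (- x)) ⟨
      ⟦ x - x ⟧ - ⟦ x ⟧ ≈⟨ +-congʳ (⟦⟧-cong (-‿inverseʳ x)) ⟩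
      ⟦ 0# ⟧ - ⟦ x ⟧ ≈⟨ +-congʳ ⟦0⟧ ⟩
      0# - ⟦ x ⟧ ≈⟨ +-identityˡ _ ⟩
      - ⟦ x ⟧ ∎

    ⟦int⟧ : ∀ x → ⟦ int x ⟧ ≈ int x
    ⟦int⟧ = go
      where
      go-nat : ∀ n → ⟦ nat n ⟧ ≈ nat n
      go-nat 0 = ⟦0⟧
      go-nat 1 = ⟦1⟧
      go-nat (suc (suc n)) = trans (⟦+⟧ 1# _) (+-cong ⟦1⟧ (go-nat (suc n)))
      go : ∀ x → ⟦ int x ⟧ ≈ int x
      go (+ n) = go-nat n
      go -[1+ n ] = trans (⟦-⟧ _) (-‿cong (go-nat (suc n)))

    ⟦^⟧ : ∀ x n → ⟦ x ^ n ⟧ ≈ ⟦ x ⟧ ^ n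
    ⟦^⟧ x zero = ⟦1⟧
    ⟦^⟧ x (suc n) = trans (⟦*⟧ x (x ^ n)) (*-congˡ (⟦^⟧ x n))

    ⟦⟧-∣ : ∀ {x y} → x ∣ y → ⟦ x ⟧ ∣ ⟦ y ⟧
    ⟦⟧-∣ (divides s e) = divides ⟦ s ⟧ (trans (sym (⟦*⟧ _ s)) (⟦⟧-cong e))

  _∘ᴱ_ : Endo → Endo → Endo
  g ∘ᴱ h = record
    { ⟦_⟧ = λ x → G.⟦ H.⟦ x ⟧ ⟧
    ; ⟦⟧-cong = λ e → G.⟦⟧-cong (H.⟦⟧-cong e)
    ; ⟦+⟧ = λ x y → trans (G.⟦⟧-cong (H.⟦+⟧ x y)) (G.⟦+⟧ _ _)
    ; ⟦*⟧ = λ x y → trans (G.⟦⟧-cong (H.⟦*⟧ x y)) (G.⟦*⟧ _ _)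
    ; ⟦1⟧ = trans (G.⟦⟧-cong H.⟦1⟧) G.⟦1⟧
    }
    where
    module G = Endo g
    module H = Endo h

  -- x behaves like a variable: ⟦_⟧ sets x to 0 and δ is the quotient by x of what remains.
  record Variable (x : A) : Set₁ where
    field
      endo : Endo
      δ : A → A
    open Endo endo public
    field
      ⟦x⟧ : ⟦ x ⟧ ≈ 0#
      split : ∀ p → p ≈ ⟦ p ⟧ + x * δ p
      x-cancel : ∀ {p r} → x * p ≈ x * r → p ≈ r
      DegreeBelow : ℕ → A → Set
      degree-bound : ∀ p → ∃ λ n → DegreeBelow n p
      degree-δ : ∀ {n p} → DegreeBelow (suc n) p → DegreeBelow n (δ p)
      degree-0 : ∀ {p} → DegreeBelow 0 p → p ≈ 0#

    -- The hypothesis says that `u` does not involve `x`. If `u * w` is `x * v`, setting `x` to 0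
    -- gives `u * ⟦ w ⟧ ≈ 0#`, so `w` may be replaced by `x * δ w` and `x` cancelled.
    reg-x : ∀ {u} → ⟦ u ⟧ ≈ u → Reg u x
    reg-x {u} fix = reg λ v (divides w uw≈xv) →
      let u⟦w⟧≈0 : u * ⟦ w ⟧ ≈ 0#
          u⟦w⟧≈0 = begin
            u * ⟦ w ⟧ ≈⟨ *-congʳ fix ⟨
            ⟦ u ⟧ * ⟦ w ⟧ ≈⟨ ⟦*⟧ u w ⟨
            ⟦ u * w ⟧ ≈⟨ ⟦⟧-cong uw≈xv ⟩
            ⟦ x * v ⟧ ≈⟨ ⟦*⟧ x v ⟩
            ⟦ x ⟧ * ⟦ v ⟧ ≈⟨ *-congʳ ⟦x⟧ ⟩
            0# * ⟦ v ⟧ ≈⟨ zeroˡ _ ⟩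
            0# ∎
      in divides (δ w) (x-cancel (begin
        x * (u * δ w) ≈⟨ +-identityˡ _ ⟨
        0# + x * (u * δ w) ≈⟨ +-congʳ u⟦w⟧≈0 ⟨
        u * ⟦ w ⟧ + x * (u * δ w) ≈⟨ solve 4 (λ u a x b → u :* a :+ x :* (u :* b) := u :* (a :+ x :* b)) refl u ⟦ w ⟧ x (δ w) ⟩
        u * (⟦ w ⟧ + x * δ w) ≈⟨ *-congˡ (split w) ⟨
        u * w ≈⟨ uw≈xv ⟩
        x * v ∎))

    -- Compare lowest coefficients with respect to x and divide what is left by x.
    reg-lowest : ∀ {u f} → ⟦ u ⟧ ≈ u → Reg u ⟦ f ⟧ → Reg u f
    reg-lowest {u} {f} fix r = reg λ t → let n , b = degree-bound t in go n t b
      where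
      go : ∀ n t → DegreeBelow n t → u ∣ f * t → u ∣ t
      go zero t b d = ≈0⇒∣ (degree-0 b)
      go (suc n) t b d = ∣-respʳ (sym (split t)) (∣+ u∣⟦t⟧ (∣*ˡ x (go n (δ t) (degree-δ b)
          (cancel∣ (reg-x fix) _ (∣-respʳ rearrange (∣- d (∣*ˡ f u∣⟦t⟧)))))))
        where
        u∣⟦t⟧ : u ∣ ⟦ t ⟧
        u∣⟦t⟧ = cancel∣ r ⟦ t ⟧ (∣-respʳ (⟦*⟧ f t) (∣-respˡ fix (⟦⟧-∣ d)))
        rearrange : f * t - f * ⟦ t ⟧ ≈ x * (f * δ t)
        rearrange = begin
          f * t - f * ⟦ t ⟧ ≈⟨ +-congʳ (*-congˡ (split t)) ⟩
          f * (⟦ t ⟧ + x * δ t) - f * ⟦ t ⟧ ≈⟨ solve 4 (λ f a x b → f :* (a :+ x :* b) :- f :* a := x :* (f :* b)) refl f ⟦ t ⟧ x (δ t) ⟩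
          x * (f * δ t) ∎

    cancellable-lowest : ∀ {f} → Cancellable ⟦ f ⟧ → Cancellable f
    cancellable-lowest = reg-lowest ⟦0⟧

    cancellable-x : Cancellable x
    cancellable-x = reg-x ⟦0⟧

-- The polynomial ring

module LinearForms where
  open ≡ using (refl; sym; trans; cong; cong₂; module ≡-Reasoning)

  form : (Mon → ℤ) → Poly → ℤ
  form φ [] = 0ℤ
  form φ ((c , e) ∷ p) = c ℤ.* φ e ℤ.+ form φ p

  form-cong : ∀ {φ ψ} → (∀ e → φ e ≡ ψ e) → ∀ p → form φ p ≡ form ψ p
  form-cong h [] = refl
  form-cong h ((c , e) ∷ p) = cong₂ ℤ._+_ (cong (c ℤ.*_) (h e)) (form-cong h p)

  form-++ : ∀ φ p r → form φ (p ++ r) ≡ form φ p ℤ.+ form φ r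
  form-++ φ [] r = sym (ℤP.+-identityˡ _)
  form-++ φ ((c , e) ∷ p) r =
    trans (cong (ℤ._+_ (c ℤ.* φ e)) (form-++ φ p r)) (sym (ℤP.+-assoc (c ℤ.* φ e) _ _))

  form-neg : ∀ φ p → form φ (-P p) ≡ ℤ.- form φ p
  form-neg φ [] = refl
  form-neg φ ((c , e) ∷ p) = begin
    ℤ.- c ℤ.* φ e ℤ.+ form φ (-P p) ≡⟨ cong (ℤ._+_ (ℤ.- c ℤ.* φ e)) (form-neg φ p) ⟩
    ℤ.- c ℤ.* φ e ℤ.+ ℤ.- form φ p ≡⟨ lemma c (φ e) (form φ p) ⟩
    ℤ.- (c ℤ.* φ e ℤ.+ form φ p) ∎
    where
    open ≡.≡-Reasoning
    lemma : ∀ c x y → ℤ.- c ℤ.* x ℤ.+ ℤ.- y ≡ ℤ.- (c ℤ.* x ℤ.+ y)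
    lemma = ℤSolver.solve-∀

  form-+ : ∀ φ ψ p → form (λ e → φ e ℤ.+ ψ e) p ≡ form φ p ℤ.+ form ψ p
  form-+ φ ψ [] = refl
  form-+ φ ψ ((c , e) ∷ p) = trans (cong (ℤ._+_ (c ℤ.* (φ e ℤ.+ ψ e))) (form-+ φ ψ p)) (lemma c (φ e) (ψ e) _ _)
    where
    lemma : ∀ c x y u v → c ℤ.* (x ℤ.+ y) ℤ.+ (u ℤ.+ v) ≡ c ℤ.* x ℤ.+ u ℤ.+ (c ℤ.* y ℤ.+ v)
    lemma = ℤSolver.solve-∀

  form-scale : ∀ k φ p → form (λ e → k ℤ.* φ e) p ≡ k ℤ.* form φ p
  form-scale k φ [] = sym (ℤP.*-zeroʳ k)
  form-scale k φ ((c , e) ∷ p) = trans (cong (ℤ._+_ (c ℤ.* (k ℤ.* φ e))) (form-scale k φ p)) (lemma c k (φ e) _)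
    where
    lemma : ∀ c k x u → c ℤ.* (k ℤ.* x) ℤ.+ k ℤ.* u ≡ k ℤ.* (c ℤ.* x ℤ.+ u)
    lemma = ℤSolver.solve-∀

  form-0 : ∀ p → form (λ _ → 0ℤ) p ≡ 0ℤ
  form-0 p = form-scale 0ℤ (λ _ → 0ℤ) p

  form-swap : ∀ (φ : Mon → Mon → ℤ) p r →
              form (λ e → form (φ e) r) p ≡ form (λ e′ → form (λ e → φ e e′) p) r
  form-swap φ [] r = sym (form-0 r)
  form-swap φ ((c , e) ∷ p) r = begin
    c ℤ.* form (φ e) r ℤ.+ form (λ e → form (φ e) r) p
      ≡⟨ cong₂ ℤ._+_ (form-scale c (φ e) r) (sym (form-swap φ p r)) ⟨
    form (λ e′ → c ℤ.* φ e e′) r ℤ.+ form (λ e′ → form (λ e → φ e e′) p) r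
      ≡⟨ form-+ (λ e′ → c ℤ.* φ e e′) _ r ⟨
    form (λ e′ → c ℤ.* φ e e′ ℤ.+ form (λ e → φ e e′) p) r ∎
    where open ≡.≡-Reasoning

  indicator : Mon → Mon → ℤ
  indicator x e = if does (e ≟M x) then 1ℤ else 0ℤ

  coeff≡form : ∀ p x → coeff p x ≡ form (indicator x) p
  coeff≡form [] x = refl
  coeff≡form ((c , e) ∷ p) x with does (e ≟M x)
  ... | true = cong₂ ℤ._+_ (sym (ℤP.*-identityʳ c)) (coeff≡form p x)
  ... | false = trans (coeff≡form p x) (sym (trans (cong (ℤ._+ form (indicator x) p) (ℤP.*-zeroʳ c)) (ℤP.+-identityˡ _)))

  remove : Mon → Poly → Poly
  remove x [] = []
  remove x ((c , e) ∷ p) = if does (e ≟M x) then remove x p else (c , e) ∷ remove x p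

  length-remove : ∀ x p → length (remove x p) ℕ.≤ length p
  length-remove x [] = ℕ.z≤n
  length-remove x ((c , e) ∷ p) with does (e ≟M x)
  ... | true = ℕP.m≤n⇒m≤1+n (length-remove x p)
  ... | false = ℕ.s≤s (length-remove x p)

  form-remove : ∀ φ x p → form φ p ≡ coeff p x ℤ.* φ x ℤ.+ form φ (remove x p)
  form-remove φ x [] = refl
  form-remove φ x ((c , e) ∷ p) with e ≟M x
  ... | yes refl = trans (cong (ℤ._+_ (c ℤ.* φ e)) (form-remove φ e p)) (lemma c (coeff p e) (φ e) _)
    where
    lemma : ∀ c k x u → c ℤ.* x ℤ.+ (k ℤ.* x ℤ.+ u) ≡ (c ℤ.+ k) ℤ.* x ℤ.+ u
    lemma = ℤSolver.solve-∀
  ... | no _ = trans (cong (ℤ._+_ (c ℤ.* φ e)) (form-remove φ x p)) (lemma (c ℤ.* φ e) (coeff p x ℤ.* φ x) _)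
    where
    lemma : ∀ x y u → x ℤ.+ (y ℤ.+ u) ≡ y ℤ.+ (x ℤ.+ u)
    lemma = ℤSolver.solve-∀

  -- Remove one exponent at a time.
  zero⇒form : ∀ n p → length p ℕ.≤ n → p ≈P 0P → ∀ φ → form φ p ≡ 0ℤ
  zero⇒form n [] _ h φ = refl
  zero⇒form (suc n) p@((c , e) ∷ p′) (ℕ.s≤s l) h φ = begin
    form φ p ≡⟨ form-remove φ e p ⟩
    coeff p e ℤ.* φ e ℤ.+ form φ (remove e p) ≡⟨ cong₂ ℤ._+_ (cong (ℤ._* φ e) (h e)) removed ⟩
    0ℤ ∎
    where
    open ≡.≡-Reasoning
    -- The head has exponent `e` itself, so it disappears; this makes the list shorter and the
    -- recursion terminate.
    remove-head : remove e p ≡ remove e p′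
    remove-head = cong (λ b → if b then remove e p′ else (c , e) ∷ remove e p′) (dec-true (e ≟M e) refl)
    coeff-remove : ∀ x → coeff (remove e p) x ≡ 0ℤ
    coeff-remove x = begin
      coeff (remove e p) x ≡⟨ coeff≡form (remove e p) x ⟩
      form (indicator x) (remove e p) ≡⟨ ℤP.+-identityˡ _ ⟨
      0ℤ ℤ.* indicator x e ℤ.+ form (indicator x) (remove e p) ≡⟨ cong (λ k → k ℤ.* indicator x e ℤ.+ form (indicator x) (remove e p)) (h e) ⟨
      coeff p e ℤ.* indicator x e ℤ.+ form (indicator x) (remove e p) ≡⟨ form-remove (indicator x) e p ⟨
      form (indicator x) p ≡⟨ coeff≡form p x ⟨
      coeff p x ≡⟨ h x ⟩
      0ℤ ∎
    removed : form φ (remove e p) ≡ 0ℤ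
    removed = zero⇒form n (remove e p)
      (ℕP.≤-trans (ℕP.≤-reflexive (cong length remove-head)) (ℕP.≤-trans (length-remove e p′) l)) coeff-remove φ

  ≈P⇒form : ∀ {p r} → p ≈P r → ∀ φ → form φ p ≡ form φ r
  ≈P⇒form {p} {r} h φ = ℤP.i-j≡0⇒i≡j (form φ p) (form φ r) (begin
    form φ p ℤ.- form φ r ≡⟨ cong (ℤ._+_ (form φ p)) (form-neg φ r) ⟨
    form φ p ℤ.+ form φ (-P r) ≡⟨ form-++ φ p (-P r) ⟨
    form φ (p -P r) ≡⟨ zero⇒form _ (p -P r) ℕP.≤-refl difference φ ⟩
    0ℤ ∎)
    where
    open ≡.≡-Reasoning
    difference : (p -P r) ≈P 0P
    difference e = begin
      coeff (p -P r) e ≡⟨ coeff≡form (p -P r) e ⟩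
      form (indicator e) (p ++ -P r) ≡⟨ form-++ (indicator e) p (-P r) ⟩
      form (indicator e) p ℤ.+ form (indicator e) (-P r) ≡⟨ cong (ℤ._+_ (form (indicator e) p)) (form-neg (indicator e) r) ⟩
      form (indicator e) p ℤ.- form (indicator e) r ≡⟨ cong₂ ℤ._-_ (coeff≡form p e) (coeff≡form r e) ⟨
      coeff p e ℤ.- coeff r e ≡⟨ cong (ℤ._- coeff r e) (h e) ⟩
      coeff r e ℤ.- coeff r e ≡⟨ ℤP.+-inverseʳ (coeff r e) ⟩
      0ℤ ∎

  -- Testing equality by all linear forms makes its compatibility with the ring operations immediate;
  -- the record lets unification recover the two polynomials.
  infix 4 _≋_

  record _≋_ (p r : Poly) : Set where
    constructor equal
    field
      forms : ∀ φ → form φ p ≡ form φ r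
  open _≋_

  ≈P⇒≋ : ∀ {p r} → p ≈P r → p ≋ r
  ≈P⇒≋ {p} {r} h = equal (≈P⇒form {p} {r} h)

  ≋⇒≈P : ∀ {p r} → p ≋ r → p ≈P r
  ≋⇒≈P {p} {r} (equal h) e = trans (coeff≡form p e) (trans (h (indicator e)) (sym (coeff≡form r e)))

  scale : ℤ → Poly → Poly
  scale c = map (λ t → c ℤ.* proj₁ t , proj₂ t)

  linear : (Mon → Poly) → Poly → Poly
  linear φ [] = []
  linear φ ((c , e) ∷ p) = scale c (φ e) ++ linear φ p

  form-scaleP : ∀ φ c p → form φ (scale c p) ≡ c ℤ.* form φ p
  form-scaleP φ c [] = sym (ℤP.*-zeroʳ c)
  form-scaleP φ c ((d , e) ∷ p) =
    trans (cong₂ ℤ._+_ (ℤP.*-assoc c d (φ e)) (form-scaleP φ c p)) (sym (ℤP.*-distribˡ-+ c _ _))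

  form-linear : ∀ φ ψ p → form φ (linear ψ p) ≡ form (λ e → form φ (ψ e)) p
  form-linear φ ψ [] = refl
  form-linear φ ψ ((c , e) ∷ p) = trans (form-++ φ (scale c (ψ e)) (linear ψ p))
    (cong₂ ℤ._+_ (form-scaleP φ c (ψ e)) (form-linear φ ψ p))

  form-* : ∀ φ p r → form φ (p *P r) ≡ form (λ e → form (λ e′ → φ (monAdd e e′)) r) p
  form-* φ [] r = refl
  form-* φ ((c , e) ∷ p) r = trans (form-++ φ (map _ r) (p *P r)) (cong₂ ℤ._+_ (shift r) (form-* φ p r))
    where
    shift : ∀ r → form φ (map (λ t → c ℤ.* proj₁ t , monAdd e (proj₂ t)) r) ≡ c ℤ.* form (λ e′ → φ (monAdd e e′)) r
    shift [] = sym (ℤP.*-zeroʳ c)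
    shift ((d , e′) ∷ r) = trans (cong₂ ℤ._+_ (ℤP.*-assoc c d (φ (monAdd e e′))) (shift r)) (sym (ℤP.*-distribˡ-+ c _ _))

  mon0 : Mon
  mon0 = 0 , 0 , 0 , 0

  monAdd-comm : ∀ e e′ → monAdd e e′ ≡ monAdd e′ e
  monAdd-comm (i , j , k , l) (i′ , j′ , k′ , l′) =
    cong₂ _,_ (ℕP.+-comm i i′) (cong₂ _,_ (ℕP.+-comm j j′) (cong₂ _,_ (ℕP.+-comm k k′) (ℕP.+-comm l l′)))

  monAdd-assoc : ∀ e e′ e″ → monAdd (monAdd e e′) e″ ≡ monAdd e (monAdd e′ e″)
  monAdd-assoc (i , j , k , l) (i′ , j′ , k′ , l′) (i″ , j″ , k″ , l″) =
    cong₂ _,_ (ℕP.+-assoc i i′ i″) (cong₂ _,_ (ℕP.+-assoc j j′ j″)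
      (cong₂ _,_ (ℕP.+-assoc k k′ k″) (ℕP.+-assoc l l′ l″)))

  polyRing : CommutativeRing 0ℓ 0ℓ
  polyRing = record
    { Carrier = Poly ; _≈_ = _≋_ ; _+_ = _+P_ ; _*_ = _*P_ ; -_ = -P_ ; 0# = 0P ; 1# = 1P
    ; isCommutativeRing = record
      { isRing = record
        { +-isAbelianGroup = record
          { isGroup = record
            { isMonoid = record
              { isSemigroup = record
                { isMagma = record
                  { isEquivalence = record
                    { refl = equal λ φ → refl
                    ; sym = λ (equal h) → equal λ φ → sym (h φ)
                    ; trans = λ (equal h) (equal k) → equal λ φ → trans (h φ) (k φ)
                    }
                  ; ∙-cong = λ { {p} {p′} {r} {r′} (equal h) (equal k) → equal λ φ →
                      trans (form-++ φ p r) (trans (cong₂ ℤ._+_ (h φ) (k φ)) (sym (form-++ φ p′ r′))) }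
                  }
                ; assoc = λ p r s → equal λ φ → begin
                    form φ ((p ++ r) ++ s) ≡⟨ form-++ φ (p ++ r) s ⟩
                    form φ (p ++ r) ℤ.+ form φ s ≡⟨ cong (ℤ._+ form φ s) (form-++ φ p r) ⟩
                    form φ p ℤ.+ form φ r ℤ.+ form φ s ≡⟨ ℤP.+-assoc (form φ p) _ _ ⟩
                    form φ p ℤ.+ (form φ r ℤ.+ form φ s) ≡⟨ cong (ℤ._+_ (form φ p)) (form-++ φ r s) ⟨
                    form φ p ℤ.+ form φ (r ++ s) ≡⟨ form-++ φ p (r ++ s) ⟨
                    form φ (p ++ (r ++ s)) ∎
                }
              ; identity = (λ p → equal λ φ → refl)
                         , (λ p → equal λ φ → trans (form-++ φ p []) (ℤP.+-identityʳ _))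
              }
            ; inverse = (λ p → equal λ φ → trans (form-++ φ (-P p) p)
                          (trans (cong (ℤ._+ form φ p) (form-neg φ p)) (ℤP.+-inverseˡ (form φ p))))
                      , (λ p → equal λ φ → trans (form-++ φ p (-P p))
                          (trans (cong (ℤ._+_ (form φ p)) (form-neg φ p)) (ℤP.+-inverseʳ (form φ p))))
            ; ⁻¹-cong = λ { {p} {r} (equal h) → equal λ φ →
                trans (form-neg φ p) (trans (cong ℤ.-_ (h φ)) (sym (form-neg φ r))) }
            }
          ; comm = λ p r → equal λ φ → trans (form-++ φ p r) (trans (ℤP.+-comm (form φ p) _) (sym (form-++ φ r p)))
          }
        ; *-cong = λ { {p} {p′} {r} {r′} (equal h) (equal k) → equal λ φ → begin
            form φ (p *P r) ≡⟨ form-* φ p r ⟩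
            form (λ e → form (λ e′ → φ (monAdd e e′)) r) p ≡⟨ h _ ⟩
            form (λ e → form (λ e′ → φ (monAdd e e′)) r) p′ ≡⟨ form-cong (λ e → k _) p′ ⟩
            form (λ e → form (λ e′ → φ (monAdd e e′)) r′) p′ ≡⟨ form-* φ p′ r′ ⟨
            form φ (p′ *P r′) ∎ }
        ; *-assoc = λ p r s → equal λ φ → begin
            form φ (p *P r *P s) ≡⟨ form-* φ (p *P r) s ⟩
            form (λ e → form (λ e″ → φ (monAdd e e″)) s) (p *P r) ≡⟨ form-* _ p r ⟩
            form (λ e → form (λ e′ → form (λ e″ → φ (monAdd (monAdd e e′) e″)) s) r) p
              ≡⟨ form-cong (λ e → form-cong (λ e′ → form-cong (λ e″ → cong φ (monAdd-assoc e e′ e″)) s) r) p ⟩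
            form (λ e → form (λ e′ → form (λ e″ → φ (monAdd e (monAdd e′ e″))) s) r) p
              ≡⟨ form-cong (λ e → form-* (λ e′ → φ (monAdd e e′)) r s) p ⟨
            form (λ e → form (λ e′ → φ (monAdd e e′)) (r *P s)) p ≡⟨ form-* φ p (r *P s) ⟨
            form φ (p *P (r *P s)) ∎
        ; *-identity = (λ p → equal (1-left p))
                     , (λ p → equal λ φ → trans (*-comm′ p 1P φ) (1-left p φ))
        ; distrib = (λ p r s → equal λ φ → trans (*-comm′ p (r ++ s) φ) (trans (distrib′ r s p φ) (begin
                      form φ (r *P p ++ s *P p) ≡⟨ form-++ φ (r *P p) (s *P p) ⟩
                      form φ (r *P p) ℤ.+ form φ (s *P p) ≡⟨ cong₂ ℤ._+_ (*-comm′ r p φ) (*-comm′ s p φ) ⟩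
                      form φ (p *P r) ℤ.+ form φ (p *P s) ≡⟨ form-++ φ (p *P r) (p *P s) ⟨
                      form φ (p *P r ++ p *P s) ∎)))
                  , (λ p r s → equal (distrib′ r s p))
        }
      ; *-comm = λ p r → equal (*-comm′ p r)
      }
    }
    where
    open ≡.≡-Reasoning
    *-comm′ : ∀ p r φ → form φ (p *P r) ≡ form φ (r *P p)
    *-comm′ p r φ = begin
      form φ (p *P r) ≡⟨ form-* φ p r ⟩
      form (λ e → form (λ e′ → φ (monAdd e e′)) r) p ≡⟨ form-swap (λ e e′ → φ (monAdd e e′)) p r ⟩
      form (λ e′ → form (λ e → φ (monAdd e e′)) p) r ≡⟨ form-cong (λ e′ → form-cong (λ e → cong φ (monAdd-comm e e′)) p) r ⟩
      form (λ e′ → form (λ e → φ (monAdd e′ e)) p) r ≡⟨ form-* φ r p ⟨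
      form φ (r *P p) ∎
    1-left : ∀ p φ → form φ (1P *P p) ≡ form φ p
    1-left p φ = trans (form-* φ 1P p) (trans (ℤP.+-identityʳ (1ℤ ℤ.* form φ p)) (ℤP.*-identityˡ (form φ p)))
    distrib′ : ∀ r s p φ → form φ ((r ++ s) *P p) ≡ form φ (r *P p ++ s *P p)
    distrib′ r s p φ = begin
      form φ ((r ++ s) *P p) ≡⟨ form-* φ (r ++ s) p ⟩
      form ψ (r ++ s) ≡⟨ form-++ ψ r s ⟩
      form ψ r ℤ.+ form ψ s ≡⟨ cong₂ ℤ._+_ (form-* φ r p) (form-* φ s p) ⟨
      form φ (r *P p) ℤ.+ form φ (s *P p) ≡⟨ form-++ φ (r *P p) (s *P p) ⟨
      form φ (r *P p ++ s *P p) ∎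
      where
      ψ : Mon → ℤ
      ψ e = form (λ e′ → φ (monAdd e e′)) p

-- The interface to ℤ[q, a, b, c]

module Univariate (R : CommutativeRing 0ℓ 0ℓ) (q : CommutativeRing.Carrier R) where
  open Divisibility R

  value : List ℤ → A
  value [] = 0#
  value (c ∷ l) = int c + q * value l

  value-uadd : ∀ l m → value (uadd l m) ≈ value l + value m
  value-uadd [] m = sym (+-identityˡ _)
  value-uadd (x ∷ l) [] = sym (+-identityʳ _)
  value-uadd (x ∷ l) (y ∷ m) = trans (+-cong (int-+ x y) (*-congˡ (value-uadd l m)))
    (solve 5 (λ x y q u v → x :+ y :+ q :* (u :+ v) := x :+ q :* u :+ (y :+ q :* v)) refl
      (int x) (int y) q (value l) (value m))

  value-monomial : ∀ n c → value (replicate n 0ℤ ++ c ∷ []) ≈ int c * q ^ n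
  value-monomial zero c = solve 2 (λ x q → x :+ q :* :0 := x :* :1) refl (int c) q
  value-monomial (suc n) c = trans (+-congˡ (*-congˡ (value-monomial n c)))
    (solve 3 (λ x q y → :0 :+ q :* (x :* y) := x :* (q :* y)) refl (int c) q (q ^ n))

module Generators (R : CommutativeRing 0ℓ 0ℓ) (q a b c : CommutativeRing.Carrier R) where
  open Divisibility R

  record Values (h : Endo) (Q A′ B C : A) : Set where
    open Endo h
    field
      at-q : ⟦ q ⟧ ≈ Q
      at-a : ⟦ a ⟧ ≈ A′
      at-b : ⟦ b ⟧ ≈ B
      at-c : ⟦ c ⟧ ≈ C

-- The arguments about the reduced sum, gcds and cyclotomic polynomials see the polynomial ring only
-- through these properties, never as lists of monomials.
record PolynomialRing : Set₁ where
  field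
    R : CommutativeRing 0ℓ 0ℓ
  open Divisibility R public
  field
    q a b c : A
  open Univariate R q public
  open Generators R q a b c public

  field
    var-q : Variable q
    var-a : Variable a
    var-b : Variable b
    var-c : Variable c
    var-a-values : Values (Variable.endo var-a) q 0# b c
    var-b-values : Values (Variable.endo var-b) q a 0# c
    var-c-values : Values (Variable.endo var-c) q a b 0#
    substitute : A → A → A → A → Endo
    substitute-values : ∀ Q A′ B C → Values (substitute Q A′ B C) Q A′ B C
    -- The factor theorem in relative form. It takes the place of division with remainder by
    -- `b - a²pⁱ` and `c - a²pⁱ`: modulo such a factor every polynomial equals its value at the
    -- point where the factor vanishes.
    substitute-mod : ∀ {u Q A′ B C} → q ≈ Q [ u ] → a ≈ A′ [ u ] → b ≈ B [ u ] → c ≈ C [ u ] →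
                     ∀ p → p ≈ Endo.⟦_⟧ (substitute Q A′ B C) p [ u ]
    unique : ∀ h → Values h q a b c → ∀ p → Endo.⟦_⟧ h p ≈ p
    univariate : ∀ p → ∃ λ l → Endo.⟦_⟧ (substitute q 1# 1# 1#) p ≈ value l
    int-cancellable : ∀ {x} → x ≢ 0ℤ → Cancellable (int x)
    1≉0 : ¬ 1# ≈ 0#

-- Lists of monomials satisfy the interface

module PolynomialInstance where
  open LinearForms
  open Divisibility polyRing

  open ≡ using () renaming (sym to ≡sym; trans to ≡trans; refl to ≡refl)

  mono : Mon → Poly
  mono e = (1ℤ , e) ∷ []

  form-mono : ∀ φ e → form φ (mono e) ≡ φ e
  form-mono φ e = ≡trans (ℤP.+-identityʳ _) (ℤP.*-identityˡ (φ e))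

  int≋ : ∀ x → int x ≋ ((x , mon0) ∷ [])
  int≋ x = equal (go x)
    where
    open ≡.≡-Reasoning
    go-nat : ∀ n φ → form φ (nat n) ≡ + n ℤ.* φ mon0 ℤ.+ 0ℤ
    go-nat 0 φ = ≡refl
    go-nat 1 φ = ≡refl
    go-nat (suc (suc n)) φ = begin
      1ℤ ℤ.* φ mon0 ℤ.+ form φ (nat (suc n)) ≡⟨ ≡.cong (ℤ._+_ (1ℤ ℤ.* φ mon0)) (go-nat (suc n) φ) ⟩
      1ℤ ℤ.* φ mon0 ℤ.+ (+ suc n ℤ.* φ mon0 ℤ.+ 0ℤ) ≡⟨ lemma 1ℤ (+ suc n) (φ mon0) ⟩
      (1ℤ ℤ.+ + suc n) ℤ.* φ mon0 ℤ.+ 0ℤ ∎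
      where
      lemma : ∀ x y z → x ℤ.* z ℤ.+ (y ℤ.* z ℤ.+ 0ℤ) ≡ (x ℤ.+ y) ℤ.* z ℤ.+ 0ℤ
      lemma = ℤSolver.solve-∀
    go : ∀ x φ → form φ (int x) ≡ x ℤ.* φ mon0 ℤ.+ 0ℤ
    go (+ n) φ = go-nat n φ
    go -[1+ n ] φ = begin
      form φ (-P nat (suc n)) ≡⟨ form-neg φ (nat (suc n)) ⟩
      ℤ.- form φ (nat (suc n)) ≡⟨ ≡.cong ℤ.-_ (go-nat (suc n) φ) ⟩
      ℤ.- (+ suc n ℤ.* φ mon0 ℤ.+ 0ℤ) ≡⟨ lemma (+ suc n) (φ mon0) ⟩
      -[1+ n ] ℤ.* φ mon0 ℤ.+ 0ℤ ∎
      where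
      lemma : ∀ x y → ℤ.- (x ℤ.* y ℤ.+ 0ℤ) ≡ ℤ.- x ℤ.* y ℤ.+ 0ℤ
      lemma = ℤSolver.solve-∀

  form-int* : ∀ φ x p → form φ (int x *P p) ≡ x ℤ.* form φ p
  form-int* φ x p = begin
    form φ (int x *P p) ≡⟨ _≋_.forms (*-congʳ {p} {int x} {(x , mon0) ∷ []} (int≋ x)) φ ⟩
    form φ (((x , mon0) ∷ []) *P p) ≡⟨ form-* φ ((x , mon0) ∷ []) p ⟩
    x ℤ.* form φ p ℤ.+ 0ℤ ≡⟨ ℤP.+-identityʳ _ ⟩
    x ℤ.* form φ p ∎
    where open ≡.≡-Reasoning

  scale≋ : ∀ x p → scale x p ≋ int x *P p
  scale≋ x p = equal λ φ → ≡trans (form-scaleP φ x p) (≡sym (form-int* φ x p))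

  -- The universal property of a monoid ring. Both setting one variable to 0 and evaluating at
  -- arbitrary polynomials arise in this way.
  multiplicative : (φ : Mon → Poly) → (∀ e e′ → φ (monAdd e e′) ≋ φ e *P φ e′) → φ mon0 ≋ 1P → Endo
  multiplicative φ φ-+ φ-0 = record
    { ⟦_⟧ = linear φ
    ; ⟦⟧-cong = λ { {p} {r} (equal h) → equal λ ψ → begin
        form ψ (linear φ p) ≡⟨ form-linear ψ φ p ⟩
        form (λ e → form ψ (φ e)) p ≡⟨ h _ ⟩
        form (λ e → form ψ (φ e)) r ≡⟨ form-linear ψ φ r ⟨
        form ψ (linear φ r) ∎ }
    ; ⟦+⟧ = λ p r → equal λ ψ → begin
        form ψ (linear φ (p ++ r)) ≡⟨ form-linear ψ φ (p ++ r) ⟩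
        form (λ e → form ψ (φ e)) (p ++ r) ≡⟨ form-++ _ p r ⟩
        form (λ e → form ψ (φ e)) p ℤ.+ form (λ e → form ψ (φ e)) r ≡⟨ ≡.cong₂ ℤ._+_ (form-linear ψ φ p) (form-linear ψ φ r) ⟨
        form ψ (linear φ p) ℤ.+ form ψ (linear φ r) ≡⟨ form-++ ψ (linear φ p) (linear φ r) ⟨
        form ψ (linear φ p ++ linear φ r) ∎
    ; ⟦*⟧ = λ p r → equal λ ψ → begin
        form ψ (linear φ (p *P r))
          ≡⟨ form-linear ψ φ (p *P r) ⟩
        form (λ e → form ψ (φ e)) (p *P r)
          ≡⟨ form-* _ p r ⟩
        form (λ e → form (λ e′ → form ψ (φ (monAdd e e′))) r) p
          ≡⟨ form-cong (λ e → form-cong (λ e′ → ≡trans (_≋_.forms (φ-+ e e′) ψ) (form-* ψ (φ e) (φ e′))) r) p ⟩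
        form (λ e → form (λ e′ → form (λ x → form (λ y → ψ (monAdd x y)) (φ e′)) (φ e)) r) p
          ≡⟨ form-cong (λ e → form-swap (λ x e′ → form (λ y → ψ (monAdd x y)) (φ e′)) (φ e) r) p ⟨
        form (λ e → form (λ x → form (λ e′ → form (λ y → ψ (monAdd x y)) (φ e′)) r) (φ e)) p
          ≡⟨ form-cong (λ e → form-cong (λ x → form-linear (λ y → ψ (monAdd x y)) φ r) (φ e)) p ⟨
        form (λ e → form (λ x → form (λ y → ψ (monAdd x y)) (linear φ r)) (φ e)) p
          ≡⟨ form-linear _ φ p ⟨
        form (λ x → form (λ y → ψ (monAdd x y)) (linear φ r)) (linear φ p)
          ≡⟨ form-* ψ (linear φ p) (linear φ r) ⟨
        form ψ (linear φ p *P linear φ r) ∎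
    ; ⟦1⟧ = equal λ ψ → begin
        form ψ (linear φ 1P) ≡⟨ form-linear ψ φ 1P ⟩
        form (λ e → form ψ (φ e)) 1P ≡⟨ form-mono (λ e → form ψ (φ e)) mon0 ⟩
        form ψ (φ mon0) ≡⟨ _≋_.forms φ-0 ψ ⟩
        form ψ 1P ∎
    }
    where open ≡.≡-Reasoning

  linear-mono : ∀ φ e → linear φ (mono e) ≋ φ e
  linear-mono φ e = equal λ ψ → ≡trans (form-linear ψ φ (mono e)) (form-mono (λ x → form ψ (φ x)) e)

  record Coordinate : Set where
    field
      degree : Mon → ℕ
      unit : Mon
      lower : Mon → Mon
      degree-+ : ∀ e e′ → degree (monAdd e e′) ≡ degree e ℕ.+ degree e′
      degree-0 : degree mon0 ≡ 0
      degree-lower : ∀ e → degree (lower e) ≡ ℕ.pred (degree e)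
      lower-+ : ∀ e → lower (monAdd unit e) ≡ e
      +-lower : ∀ e n → degree e ≡ suc n → monAdd unit (lower e) ≡ e
      degree-unit : degree unit ≡ 1

  module _ (X : Coordinate) where
    open Coordinate X

    constantTerm : ℕ → Mon → Poly
    constantTerm zero e = mono e
    constantTerm (suc n) e = []

    quotientTerm : ℕ → Mon → Poly
    quotientTerm zero e = []
    quotientTerm (suc n) e = mono (lower e)

    φε φδ : Mon → Poly
    φε e = constantTerm (degree e) e
    φδ e = quotientTerm (degree e) e

    endoε : Endo
    endoε = multiplicative φε hom (reflexive (≡.cong (λ n → constantTerm n mon0) degree-0))
      where
      hom : ∀ e e′ → φε (monAdd e e′) ≋ φε e *P φε e′
      hom e e′ rewrite degree-+ e e′ with degree e | degree e′
      ... | zero | zero = equal λ _ → ≡refl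
      ... | zero | suc _ = equal λ _ → ≡refl
      ... | suc _ | _ = equal λ _ → ≡refl

    form-x* : ∀ ψ p → form ψ (mono unit *P p) ≡ form (λ e → ψ (monAdd unit e)) p
    form-x* ψ p = ≡trans (form-* ψ (mono unit) p) (form-mono (λ e → form (λ e′ → ψ (monAdd e e′)) p) unit)

    below-scale : ∀ {n} z p → All (λ t → degree (proj₂ t) ℕ.< n) p →
                  All (λ t → degree (proj₂ t) ℕ.< n) (scale z p)
    below-scale z [] [] = []
    below-scale z (t ∷ p) (h ∷ hs) = h ∷ below-scale z p hs

    variable-of : Variable (mono unit)
    variable-of = record
      { endo = endoε
      ; δ = linear φδ
      ; ⟦x⟧ = equal λ ψ → ≡trans (_≋_.forms (linear-mono φε unit) ψ)
                (≡.cong (λ n → form ψ (constantTerm n unit)) degree-unit)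
      ; split = λ p → equal λ ψ → begin
          form ψ p
            ≡⟨ form-cong (split-mono ψ) p ⟩
          form (λ e → form ψ (φε e) ℤ.+ form (λ x → ψ (monAdd unit x)) (φδ e)) p
            ≡⟨ form-+ _ _ p ⟩
          form (λ e → form ψ (φε e)) p ℤ.+ form (λ e → form (λ x → ψ (monAdd unit x)) (φδ e)) p
            ≡⟨ ≡.cong₂ ℤ._+_ (form-linear ψ φε p) (≡trans (form-x* ψ (linear φδ p)) (form-linear _ φδ p)) ⟨
          form ψ (linear φε p) ℤ.+ form ψ (mono unit *P linear φδ p)
            ≡⟨ form-++ ψ (linear φε p) _ ⟨
          form ψ (linear φε p +P mono unit *P linear φδ p) ∎
      -- The form built from `ψ` and `lower` undoes multiplication by the variable, because
      -- `lower (monAdd unit e)` is `e`.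
      ; x-cancel = λ { {p} {r} (equal h) → equal λ ψ → begin
          form ψ p ≡⟨ form-cong (λ e → ≡.cong ψ (lower-+ e)) p ⟨
          form (λ e → ψ (lower (monAdd unit e))) p ≡⟨ form-x* (λ e → ψ (lower e)) p ⟨
          form (λ e → ψ (lower e)) (mono unit *P p) ≡⟨ h _ ⟩
          form (λ e → ψ (lower e)) (mono unit *P r) ≡⟨ form-x* (λ e → ψ (lower e)) r ⟩
          form (λ e → ψ (lower (monAdd unit e))) r ≡⟨ form-cong (λ e → ≡.cong ψ (lower-+ e)) r ⟩
          form ψ r ∎ }
      ; DegreeBelow = λ n → All (λ t → degree (proj₂ t) ℕ.< n)
      ; degree-bound = bound
      ; degree-δ = below-δ
      ; degree-0 = λ { {[]} [] → equal λ _ → ≡refl ; {_ ∷ _} (() ∷ _) }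
      }
      where
      open ≡.≡-Reasoning
      split-mono : ∀ ψ e → ψ e ≡ form ψ (φε e) ℤ.+ form (λ x → ψ (monAdd unit x)) (φδ e)
      split-mono ψ e with degree e in eq
      ... | zero = ≡sym (≡trans (ℤP.+-identityʳ _) (form-mono ψ e))
      ... | suc n = ≡sym (≡trans (ℤP.+-identityˡ _) (≡trans (form-mono (λ x → ψ (monAdd unit x)) (lower e)) (≡.cong ψ (+-lower e n eq))))
      bound : ∀ p → ∃ λ n → All (λ t → degree (proj₂ t) ℕ.< n) p
      bound [] = 0 , []
      bound ((z , e) ∷ p) = let n , h = bound p in
        suc (degree e) ℕ.⊔ n , ℕP.m≤m⊔n _ n ∷ All.map (λ l → ℕP.≤-trans l (ℕP.m≤n⊔m (suc (degree e)) n)) h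
      below-φδ : ∀ {n} e → degree e ℕ.< suc n → All (λ t → degree (proj₂ t) ℕ.< n) (φδ e)
      below-φδ e h with degree e in eq
      ... | zero = []
      ... | suc k = ℕP.≤-trans (ℕP.≤-reflexive (≡.cong suc (≡trans (degree-lower e) (≡.cong ℕ.pred eq)))) (ℕ.s≤s⁻¹ h) ∷ []
      below-δ : ∀ {n p} → All (λ t → degree (proj₂ t) ℕ.< suc n) p → All (λ t → degree (proj₂ t) ℕ.< n) (linear φδ p)
      below-δ {p = []} [] = []
      below-δ {p = (z , e) ∷ p} (h ∷ hs) = AllP.++⁺ (below-scale z (φδ e) (below-φδ e h)) (below-δ hs)

    ε-other : ∀ e → degree e ≡ 0 → linear φε (mono e) ≋ mono e
    ε-other e h = equal λ ψ → ≡trans (_≋_.forms (linear-mono φε e) ψ) (≡.cong (λ n → form ψ (constantTerm n e)) h)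

  coordinate-q coordinate-a coordinate-b coordinate-c : Coordinate
  coordinate-q = record
    { degree = λ (i , j , k , l) → i ; unit = 1 , 0 , 0 , 0 ; lower = λ (i , j , k , l) → ℕ.pred i , j , k , l
    ; degree-+ = λ _ _ → ≡refl ; degree-0 = ≡refl ; degree-lower = λ _ → ≡refl ; lower-+ = λ _ → ≡refl
    ; +-lower = λ { (suc i , j , k , l) n h → ≡refl } ; degree-unit = ≡refl }
  coordinate-a = record
    { degree = λ (i , j , k , l) → j ; unit = 0 , 1 , 0 , 0 ; lower = λ (i , j , k , l) → i , ℕ.pred j , k , l
    ; degree-+ = λ _ _ → ≡refl ; degree-0 = ≡refl ; degree-lower = λ _ → ≡refl ; lower-+ = λ _ → ≡refl
    ; +-lower = λ { (i , suc j , k , l) n h → ≡refl } ; degree-unit = ≡refl }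
  coordinate-b = record
    { degree = λ (i , j , k , l) → k ; unit = 0 , 0 , 1 , 0 ; lower = λ (i , j , k , l) → i , j , ℕ.pred k , l
    ; degree-+ = λ _ _ → ≡refl ; degree-0 = ≡refl ; degree-lower = λ _ → ≡refl ; lower-+ = λ _ → ≡refl
    ; +-lower = λ { (i , j , suc k , l) n h → ≡refl } ; degree-unit = ≡refl }
  coordinate-c = record
    { degree = λ (i , j , k , l) → l ; unit = 0 , 0 , 0 , 1 ; lower = λ (i , j , k , l) → i , j , k , ℕ.pred l
    ; degree-+ = λ _ _ → ≡refl ; degree-0 = ≡refl ; degree-lower = λ _ → ≡refl ; lower-+ = λ _ → ≡refl
    ; +-lower = λ { (i , j , k , suc l) n h → ≡refl } ; degree-unit = ≡refl }

  module _ (Q A′ B C : Poly) where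
    evalMon : Mon → Poly
    evalMon (i , j , k , l) = Q ^ i * A′ ^ j * B ^ k * C ^ l

    evalMon-+ : ∀ e e′ → evalMon (monAdd e e′) ≋ evalMon e *P evalMon e′
    evalMon-+ (i , j , k , l) (i′ , j′ , k′ , l′) = begin
      Q ^ (i ℕ.+ i′) * A′ ^ (j ℕ.+ j′) * B ^ (k ℕ.+ k′) * C ^ (l ℕ.+ l′)
        ≈⟨ *-cong {Q ^ (i ℕ.+ i′) * A′ ^ (j ℕ.+ j′) * B ^ (k ℕ.+ k′)} {_} {C ^ (l ℕ.+ l′)}
             (*-cong {Q ^ (i ℕ.+ i′) * A′ ^ (j ℕ.+ j′)} {_} {B ^ (k ℕ.+ k′)}
               (*-cong {Q ^ (i ℕ.+ i′)} {_} {A′ ^ (j ℕ.+ j′)} (^-+ Q i i′) (^-+ A′ j j′)) (^-+ B k k′)) (^-+ C l l′) ⟩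
      (Q ^ i * Q ^ i′) * (A′ ^ j * A′ ^ j′) * (B ^ k * B ^ k′) * (C ^ l * C ^ l′)
        ≈⟨ solve 8 (λ x x′ y y′ z z′ w w′ → (x :* x′) :* (y :* y′) :* (z :* z′) :* (w :* w′)
              := x :* y :* z :* w :* (x′ :* y′ :* z′ :* w′)) refl
              (Q ^ i) (Q ^ i′) (A′ ^ j) (A′ ^ j′) (B ^ k) (B ^ k′) (C ^ l) (C ^ l′) ⟩
      (Q ^ i * A′ ^ j * B ^ k * C ^ l) * (Q ^ i′ * A′ ^ j′ * B ^ k′ * C ^ l′) ∎
      where open import Relation.Binary.Reasoning.Setoid setoid

    unpack : ∀ i j k l → linear evalMon (mono (i , j , k , l)) ≋ Q ^ i * A′ ^ j * B ^ k * C ^ l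
    unpack i j k l = linear-mono evalMon (i , j , k , l)

    evaluation : Endo
    evaluation = multiplicative evalMon evalMon-+
      (equal λ _ → ≡refl)

    evaluation-values : Generators.Values polyRing (mono (1 , 0 , 0 , 0)) (mono (0 , 1 , 0 , 0))
      (mono (0 , 0 , 1 , 0)) (mono (0 , 0 , 0 , 1)) evaluation Q A′ B C
    evaluation-values = record
      { at-q = trans (unpack 1 0 0 0) (solve 1 (λ x → x :* :1 :* :1 :* :1 :* :1 := x) refl Q)
      ; at-a = trans (unpack 0 1 0 0) (solve 1 (λ x → :1 :* (x :* :1) :* :1 :* :1 := x) refl A′)
      ; at-b = trans (unpack 0 0 1 0) (solve 1 (λ x → :1 :* :1 :* (x :* :1) :* :1 := x) refl B)
      ; at-c = trans (unpack 0 0 0 1) (solve 1 (λ x → :1 :* :1 :* :1 :* (x :* :1) := x) refl C)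
      }

  mono^ : ∀ (e : ℕ → Mon) → e 0 ≡ mon0 → (∀ n → e (suc n) ≡ monAdd (e 1) (e n)) → ∀ n → mono (e 1) ^ n ≋ mono (e n)
  mono^ e e0 e+ zero = reflexive (≡.cong mono (≡sym e0))
  mono^ e e0 e+ (suc n) = trans (*-congˡ {mono (e 1)} (mono^ e e0 e+ n))
    (reflexive (≡.cong mono (≡sym (e+ n))))

  monomial≋ : ∀ i j k l → monomial 1ℤ i j k l ≋
    mono (1 , 0 , 0 , 0) ^ i * mono (0 , 1 , 0 , 0) ^ j * mono (0 , 0 , 1 , 0) ^ k * mono (0 , 0 , 0 , 1) ^ l
  monomial≋ i j k l = sym (begin
    Q ^ i * A′ ^ j * B ^ k * C ^ l
      ≈⟨ *-cong {Q ^ i * A′ ^ j * B ^ k} {_} {C ^ l} (*-cong {Q ^ i * A′ ^ j} {_} {B ^ k}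
           (*-cong {Q ^ i} {_} {A′ ^ j}
             (mono^ (λ n → n , 0 , 0 , 0) ≡refl (λ _ → ≡refl) i)
             (mono^ (λ n → 0 , n , 0 , 0) ≡refl (λ _ → ≡refl) j))
             (mono^ (λ n → 0 , 0 , n , 0) ≡refl (λ _ → ≡refl) k))
             (mono^ (λ n → 0 , 0 , 0 , n) ≡refl (λ _ → ≡refl) l) ⟩
    mono (i , 0 , 0 , 0) * mono (0 , j , 0 , 0) * mono (0 , 0 , k , 0) * mono (0 , 0 , 0 , l)
      ≈⟨ reflexive (≡.cong mono (≡.cong₂ _,_ (≡trans (ℕP.+-identityʳ _) (≡trans (ℕP.+-identityʳ _) (ℕP.+-identityʳ i)))
           (≡.cong₂ _,_ (≡trans (ℕP.+-identityʳ _) (ℕP.+-identityʳ j)) (≡.cong₂ _,_ (ℕP.+-identityʳ k) ≡refl)))) ⟩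
    mono (i , j , k , l) ∎)
    where
    open import Relation.Binary.Reasoning.Setoid setoid
    Q A′ B C : Poly
    Q = mono (1 , 0 , 0 , 0)
    A′ = mono (0 , 1 , 0 , 0)
    B = mono (0 , 0 , 1 , 0)
    C = mono (0 , 0 , 0 , 1)

  polynomials : PolynomialRing
  polynomials = record
    { R = polyRing
    ; q = X ; a = Y ; b = Z ; c = W
    ; var-q = variable-of coordinate-q
    ; var-a = variable-of coordinate-a
    ; var-b = variable-of coordinate-b
    ; var-c = variable-of coordinate-c
    ; var-a-values = record
      { at-q = ε-other coordinate-a ex ≡refl ; at-a = Variable.⟦x⟧ (variable-of coordinate-a)
      ; at-b = ε-other coordinate-a ez ≡refl ; at-c = ε-other coordinate-a ew ≡refl }
    ; var-b-values = record
      { at-q = ε-other coordinate-b ex ≡refl ; at-a = ε-other coordinate-b ey ≡refl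
      ; at-b = Variable.⟦x⟧ (variable-of coordinate-b) ; at-c = ε-other coordinate-b ew ≡refl }
    ; var-c-values = record
      { at-q = ε-other coordinate-c ex ≡refl ; at-a = ε-other coordinate-c ey ≡refl
      ; at-b = ε-other coordinate-c ez ≡refl ; at-c = Variable.⟦x⟧ (variable-of coordinate-c) }
    ; substitute = evaluation
    ; substitute-values = evaluation-values
    ; substitute-mod = λ hq ha hb hc p → mod (∣-respʳ
        (+-cong {linear (evalMon X Y Z W) p} {p} (identity p) (refl { -P linear (evalMon _ _ _ _) p }))
        (_≈_[_].∣-diff (congruent hq ha hb hc p)))
    ; unique = λ h v → fixed h (Generators.Values.at-q v) (Generators.Values.at-a v) (Generators.Values.at-b v) (Generators.Values.at-c v)
    ; univariate = one-variable
    ; int-cancellable = λ {x} x≢0 → cancellable λ t h → equal λ φ →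
        cancel-ℤ x≢0 (≡trans (≡sym (form-int* φ x t)) (_≋_.forms h φ))
    ; 1≉0 = λ h → 1≢0 (_≋_.forms h (λ _ → 1ℤ))
    }
    where
    ex ey ez ew : Mon
    ex = 1 , 0 , 0 , 0
    ey = 0 , 1 , 0 , 0
    ez = 0 , 0 , 1 , 0
    ew = 0 , 0 , 0 , 1
    X Y Z W : Poly
    X = mono ex
    Y = mono ey
    Z = mono ez
    W = mono ew

    1≢0 : 1ℤ ≢ 0ℤ
    1≢0 ()

    cancel-ℤ : ∀ {x y} → x ≢ 0ℤ → x ℤ.* y ≡ 0ℤ → y ≡ 0ℤ
    cancel-ℤ {x} x≢0 h with ℤP.i*j≡0⇒i≡0∨j≡0 x h
    ... | inj₁ x≡0 = contradiction x≡0 x≢0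
    ... | inj₂ y≡0 = y≡0

    identity : ∀ p → linear (evalMon X Y Z W) p ≋ p
    identity p = equal λ ψ → ≡trans (form-linear ψ (evalMon X Y Z W) p)
      (form-cong (λ { e@(i , j , k , l) → ≡trans (≡sym (_≋_.forms (monomial≋ i j k l) ψ)) (form-mono ψ e) }) p)

    congruent : ∀ {u Q A′ B C} → X ≈ Q [ u ] → Y ≈ A′ [ u ] → Z ≈ B [ u ] → W ≈ C [ u ] →
                ∀ p → linear (evalMon X Y Z W) p ≈ linear (evalMon Q A′ B C) p [ u ]
    congruent {u} {Q} {A′} {B} {C} hq ha hb hc = go
      where
      module M = Divisibility (quotientRing u)
      go : ∀ p → linear (evalMon X Y Z W) p ≈ linear (evalMon Q A′ B C) p [ u ]
      go [] = M.refl
      go ((z , e@(i , j , k , l)) ∷ p) = M.+-cong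
        (M.trans (≈⇒≈mod u (scale≋ z (evalMon X Y Z W e)))
          (M.trans (M.*-congˡ {int z} (M.*-cong (M.*-cong (M.*-cong (M.^-cong i hq) (M.^-cong j ha)) (M.^-cong k hb)) (M.^-cong l hc)))
            (M.sym (≈⇒≈mod u (scale≋ z (evalMon Q A′ B C e))))))
        (go p)

    fixed : ∀ h → Endo.⟦_⟧ h X ≋ X → Endo.⟦_⟧ h Y ≋ Y → Endo.⟦_⟧ h Z ≋ Z → Endo.⟦_⟧ h W ≋ W →
            ∀ p → Endo.⟦_⟧ h p ≋ p
    fixed h hX hY hZ hW = go
      where
      open Endo h
      open import Relation.Binary.Reasoning.Setoid setoid
      go : ∀ p → ⟦ p ⟧ ≋ p
      go [] = ⟦0⟧
      go ((z , e@(i , j , k , l)) ∷ p) = trans (⟦+⟧ ((z , e) ∷ []) p) (+-cong {⟦ (z , e) ∷ [] ⟧} {(z , e) ∷ []} {⟦ p ⟧} {p} (begin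
        ⟦ (z , e) ∷ [] ⟧
          ≈⟨ ⟦⟧-cong expand ⟩
        ⟦ int z * (X ^ i * Y ^ j * Z ^ k * W ^ l) ⟧
          ≈⟨ times {int z} {X ^ i * Y ^ j * Z ^ k * W ^ l} (⟦int⟧ z)
               (times {X ^ i * Y ^ j * Z ^ k} {W ^ l} (times {X ^ i * Y ^ j} {Z ^ k} (times {X ^ i} {Y ^ j}
                 (pow hX i) (pow hY j)) (pow hZ k)) (pow hW l)) ⟩
        int z * (X ^ i * Y ^ j * Z ^ k * W ^ l)
          ≈⟨ expand ⟨
        (z , e) ∷ [] ∎) (go p))
        where
        expand : ((z , e) ∷ []) ≋ int z * (X ^ i * Y ^ j * Z ^ k * W ^ l)
        expand = trans (reflexive (≡.cong (λ z → (z , e) ∷ []) (≡sym (ℤP.*-identityʳ z))))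
          (trans (scale≋ z (mono e)) (*-congˡ {int z} (monomial≋ i j k l)))
        times : ∀ {x y} → ⟦ x ⟧ ≋ x → ⟦ y ⟧ ≋ y → ⟦ x * y ⟧ ≋ x * y
        times {x} {y} ex ey = trans (⟦*⟧ x y) (*-cong {⟦ x ⟧} {x} {⟦ y ⟧} {y} ex ey)
        pow : ∀ {x} → ⟦ x ⟧ ≋ x → ∀ n → ⟦ x ^ n ⟧ ≋ x ^ n
        pow {x} ex n = trans (⟦^⟧ x n) (^-cong n ex)

    open Univariate polyRing X
    one-variable : ∀ p → ∃ λ l → linear (evalMon X 1P 1P 1P) p ≋ value l
    one-variable [] = [] , refl {0P}
    one-variable ((z , e@(i , j , k , l)) ∷ p) =
      let m , h = one-variable p in
      uadd (replicate i 0ℤ ++ z ∷ []) m , (begin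
        scale z (evalMon X 1P 1P 1P e) + linear (evalMon X 1P 1P 1P) p
          ≈⟨ +-cong {scale z (evalMon X 1P 1P 1P e)} {_} {linear (evalMon X 1P 1P 1P) p} (term e) h ⟩
        value (replicate i 0ℤ ++ z ∷ []) + value m
          ≈⟨ value-uadd (replicate i 0ℤ ++ z ∷ []) m ⟨
        value (uadd (replicate i 0ℤ ++ z ∷ []) m) ∎)
      where
      open import Relation.Binary.Reasoning.Setoid setoid
      term : ∀ e → scale z (evalMon X 1P 1P 1P e) ≋ value (replicate (proj₁ e) 0ℤ ++ z ∷ [])
      term e@(i , j , k , l) = begin
        scale z (evalMon X 1P 1P 1P e)
          ≈⟨ scale≋ z (evalMon X 1P 1P 1P e) ⟩
        int z * (X ^ i * 1P ^ j * 1P ^ k * 1P ^ l)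
          ≈⟨ *-congˡ {int z} (*-cong {X ^ i * 1P ^ j * 1P ^ k} {_} {1P ^ l} (*-cong {X ^ i * 1P ^ j} {_} {1P ^ k} (*-cong {X ^ i} {_} {1P ^ j} (refl {X ^ i}) (1^ j)) (1^ k)) (1^ l)) ⟩
        int z * (X ^ i * 1P * 1P * 1P)
          ≈⟨ solve 2 (λ z x → z :* (x :* :1 :* :1 :* :1) := z :* x) (refl {_}) (int z) (X ^ i) ⟩
        int z * X ^ i
          ≈⟨ value-monomial i z ⟨
        value (replicate i 0ℤ ++ z ∷ []) ∎

  toPolyFrom≋ : ∀ l → toPolyFrom 0 l ≋ PolynomialRing.value polynomials l
  toPolyFrom≋ l = equal λ φ → go 0 l φ
    where
    open Univariate polyRing (mono (1 , 0 , 0 , 0))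
    -- `toPolyFrom i l` stands for qⁱ times the value of `l`; the shift of the exponent is put into
    -- the form.
    go : ∀ i l φ → form φ (toPolyFrom i l) ≡ form (λ (j , e) → φ (i ℕ.+ j , e)) (value l)
    go i [] φ = ≡refl
    go i (z ∷ l) φ = begin
      z ℤ.* φ (i , 0 , 0 , 0) ℤ.+ form φ (toPolyFrom (suc i) l)
        ≡⟨ ≡.cong₂ ℤ._+_ (≡.cong (λ n → z ℤ.* φ (n , 0 , 0 , 0)) (≡sym (ℕP.+-identityʳ i)))
             (≡trans (go (suc i) l φ) (form-cong (λ (j , e) → ≡.cong (λ n → φ (n , e)) (≡sym (ℕP.+-suc i j))) (value l))) ⟩
      z ℤ.* ψ mon0 ℤ.+ form (λ e → ψ (monAdd (1 , 0 , 0 , 0) e)) (value l)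
        ≡⟨ ≡.cong₂ ℤ._+_ (≡trans (_≋_.forms (int≋ z) ψ) (ℤP.+-identityʳ (z ℤ.* ψ mon0))) (form-x* coordinate-q ψ (value l)) ⟨
      form ψ (int z) ℤ.+ form ψ (mono (1 , 0 , 0 , 0) *P value l)
        ≡⟨ form-++ ψ (int z) _ ⟨
      form ψ (int z +P mono (1 , 0 , 0 , 0) *P value l) ∎
      where
      open ≡.≡-Reasoning
      ψ : Mon → ℤ
      ψ (j , e) = φ (i ℕ.+ j , e)

open LinearForms using (_≋_; equal; ≈P⇒≋; ≋⇒≈P; polyRing)
open PolynomialInstance using (polynomials; monomial≋; toPolyFrom≋)

-- The sum over an abstract polynomial ring

-- With p = q⁴, the k-th summand is numerator k / ((q + a) · denominator k), and the n-th partial sum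
-- is partialSum n / ((q + a) · denominator n).
module Summation {A : Set} (_+_ _*_ : A → A → A) (-_ : A → A) (1# q a b c : A) where
  infixr 21 p^_

  p^_ : ℕ → A
  p^ k = power _*_ 1# (power _*_ 1# q 4) k

  -- dᵏ (x/d; p)ₖ
  pochhammer : A → A → ℕ → A
  pochhammer d x zero = 1#
  pochhammer d x (suc k) = pochhammer d x k * (d + (- (x * p^ k)))

  falling : A → ℕ → A
  falling = pochhammer (q * q)

  numerator : ℕ → A
  numerator k = ((q + (a * p^ k)) * power _*_ 1# (a * q) k) * (falling (a * a) k * (falling b k * falling c k))

  step : ℕ → A
  step i = (b + (- ((a * a) * p^ i))) * ((c + (- ((a * a) * p^ i))) * (1# + (- p^ i)))

  denominator : ℕ → A
  denominator zero = 1#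
  denominator (suc k) = denominator k * step (suc k)

  partialSum : ℕ → A
  partialSum zero = numerator 0
  partialSum (suc n) = (partialSum n * step (suc n)) + numerator (suc n)

-- Pairing of the summands k and N - k

triangle : ℕ → ℕ
triangle zero = 0
triangle (suc n) = triangle n ℕ.+ n

-- For odd d = 2e + 1 the exponent d(d-1)/2 is the multiple ed of d, so that the power of `P` in
-- `t-+` becomes a d-th power.
triangle-odd : ∀ e → triangle (suc (e ℕ.+ e)) ≡ e ℕ.* suc (e ℕ.+ e)
triangle-odd zero = ≡.refl
triangle-odd (suc e) = begin
  triangle (suc (suc e ℕ.+ suc e)) ≡⟨ ≡.cong (λ n → triangle (suc (suc n))) (ℕP.+-suc e e) ⟩
  triangle (suc (e ℕ.+ e)) ℕ.+ suc (e ℕ.+ e) ℕ.+ suc (suc (e ℕ.+ e)) ≡⟨ ≡.cong (λ n → n ℕ.+ suc (e ℕ.+ e) ℕ.+ suc (suc (e ℕ.+ e))) (triangle-odd e) ⟩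
  e ℕ.* suc (e ℕ.+ e) ℕ.+ suc (e ℕ.+ e) ℕ.+ suc (suc (e ℕ.+ e)) ≡⟨ lemma e ⟩
  suc e ℕ.* suc (suc e ℕ.+ suc e) ∎
  where
  open ≡.≡-Reasoning
  lemma : ∀ e → e ℕ.* suc (e ℕ.+ e) ℕ.+ suc (e ℕ.+ e) ℕ.+ suc (suc (e ℕ.+ e)) ≡ suc e ℕ.* suc (suc e ℕ.+ suc e)
  lemma = ℕSolver.solve-∀

-- If a²pᴺ = q² with N odd, then the summands k and N - k of the partial sum, brought to the common
-- denominator, cancel.
module Pairing (R : CommutativeRing 0ℓ 0ℓ) (q a b c : CommutativeRing.Carrier R) where
  open Divisibility R
  open Summation _+_ _*_ -_ 1# q a b c
  open Relation.Binary.Reasoning.Setoid setoid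

  -- Summation over the pairs (k, m) with k + m = n. Reflection of the summation index is then an
  -- exchange of arguments, without truncated subtraction.
  convolution : ℕ → (ℕ → ℕ → A) → A
  convolution zero f = f 0 0
  convolution (suc n) f = convolution n (λ k m → f k (suc m)) + f (suc n) 0

  convolution-cong : ∀ n {f g : ℕ → ℕ → A} → (∀ k m → k ℕ.+ m ≡ n → f k m ≈ g k m) → convolution n f ≈ convolution n g
  convolution-cong zero h = h 0 0 ≡.refl
  convolution-cong (suc n) h = +-cong
    (convolution-cong n λ k m e → h k (suc m) (≡.trans (ℕP.+-suc k m) (≡.cong suc e)))
    (h (suc n) 0 (ℕP.+-identityʳ (suc n)))

  convolution-* : ∀ n (f : ℕ → ℕ → A) z → convolution n (λ k m → f k m * z) ≈ convolution n f * z
  convolution-* zero f z = refl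
  convolution-* (suc n) f z = trans (+-congʳ (convolution-* n (λ k m → f k (suc m)) z)) (sym (distribʳ z _ _))

  convolution-first : ∀ n (f : ℕ → ℕ → A) →
    convolution (suc n) f ≈ f 0 (suc n) + convolution n (λ k m → f (suc k) m)
  convolution-first zero f = refl
  convolution-first (suc n) f = trans (+-congʳ (convolution-first n λ k m → f k (suc m))) (+-assoc _ _ _)

  -- The two end terms are removed together. As the index 2r + 1 is odd, the process ends with the
  -- pair (0, 1), (1, 0) and never meets a middle term paired with itself.
  convolution-antisymmetric : ∀ r (f : ℕ → ℕ → A) →
    (∀ k m → k ℕ.+ m ≡ suc (r ℕ.+ r) → f k m + f m k ≈ 0#) → convolution (suc (r ℕ.+ r)) f ≈ 0#
  convolution-antisymmetric zero f h = h 0 1 ≡.refl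
  convolution-antisymmetric (suc r) f h rewrite ℕP.+-suc r r = begin
    convolution (suc (suc n)) f
      ≈⟨ +-congʳ (convolution-first n λ k m → f k (suc m)) ⟩
    f 0 (suc (suc n)) + convolution n (λ k m → f (suc k) (suc m)) + f (suc (suc n)) 0
      ≈⟨ solve 3 (λ x y z → x :+ y :+ z := y :+ (x :+ z)) refl _ _ _ ⟩
    convolution n (λ k m → f (suc k) (suc m)) + (f 0 (suc (suc n)) + f (suc (suc n)) 0)
      ≈⟨ +-cong (convolution-antisymmetric r (λ k m → f (suc k) (suc m))
           λ k m e → h (suc k) (suc m) (≡.cong suc (≡.trans (ℕP.+-suc k m) (≡.cong suc e))))
           (h 0 (suc (suc n)) ≡.refl) ⟩
    0# + 0#
      ≈⟨ +-identityˡ 0# ⟩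
    0# ∎
    where
    n : ℕ
    n = suc (r ℕ.+ r)

  -- The quotient of `denominator (k + m)` by `denominator k`: the factor that brings the summand
  -- `k` to the common denominator.
  tail : ℕ → ℕ → A
  tail k zero = 1#
  tail k (suc m) = step (suc k) * tail (suc k) m

  tail-last : ∀ k m → tail k (suc m) ≈ tail k m * step (suc (k ℕ.+ m))
  tail-last k zero rewrite ℕP.+-identityʳ k = *-comm _ _
  tail-last k (suc m) rewrite ℕP.+-suc k m = trans (*-congˡ (tail-last (suc k) m)) (sym (*-assoc _ _ _))

  partialSum≈convolution : ∀ n → partialSum n ≈ convolution n (λ k m → numerator k * tail k m)
  partialSum≈convolution zero = sym (*-identityʳ _)
  partialSum≈convolution (suc n) = +-cong (begin
      partialSum n * step (suc n)
        ≈⟨ *-congʳ (partialSum≈convolution n) ⟩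
      convolution n (λ k m → numerator k * tail k m) * step (suc n)
        ≈⟨ convolution-* n _ _ ⟨
      convolution n (λ k m → numerator k * tail k m * step (suc n))
        ≈⟨ convolution-cong n (λ { k m ≡.refl → trans (*-assoc _ _ _) (*-congˡ (sym (tail-last k m))) }) ⟩
      convolution n (λ k m → numerator k * tail k (suc m)) ∎)
    (sym (*-identityʳ _))

  p^-+ : ∀ k m → p^ (k ℕ.+ m) ≈ p^ k * p^ m
  p^-+ = ^-+ (q ^ 4)

  -- The product (p; p)ₖ₊ₘ / (p; p)ₖ, that is, the factors 1 - pⁱ with k < i ≤ k + m.
  gaussian : ℕ → ℕ → A
  gaussian k zero = 1#
  gaussian k (suc m) = (1# - p^ suc k) * gaussian (suc k) m

  P : A
  P = q ^ 4 * (q ^ 4 * q ^ 4)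

  P^ : ∀ k → P ^ k ≈ p^ k * (p^ k * p^ k)
  P^ k = trans (^-distrib-* _ _ k) (*-congˡ (^-distrib-* _ _ k))

  s : A
  s = - (a * a * (a * q))

  -- This is sᵏ p^(3k(k-1)/2), or `monomialPart k` times p^(k(k-1)). Multiplying both summands of a
  -- pair by p^(k(k-1)) p^(m(m-1)) turns their parts that are not symmetric in k and m into (q +
  -- apᵏ) `t k` and (q + apᵐ) `t m`.
  t : ℕ → A
  t zero = 1#
  t (suc k) = t k * (s * P ^ k)

  t-+ : ∀ k d → t (k ℕ.+ d) ≈ t k * ((s * P ^ k) ^ d * P ^ triangle d)
  t-+ k zero rewrite ℕP.+-identityʳ k = solve 1 (λ x → x := x :* (:1 :* :1)) refl (t k)
  t-+ k (suc d) rewrite ℕP.+-suc k d = begin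
    t (k ℕ.+ d) * (s * P ^ (k ℕ.+ d))
      ≈⟨ *-cong (t-+ k d) (*-congˡ (^-+ P k d)) ⟩
    t k * ((s * P ^ k) ^ d * P ^ triangle d) * (s * (P ^ k * P ^ d))
      ≈⟨ solve 6 (λ t x y s z w → t :* (x :* y) :* (s :* (z :* w)) := t :* (s :* z :* x :* (y :* w))) refl _ _ _ _ _ _ ⟩
    t k * (s * P ^ k * (s * P ^ k) ^ d * (P ^ triangle d * P ^ d))
      ≈⟨ *-congˡ (*-congˡ (^-+ P (triangle d) d)) ⟨
    t k * (s * P ^ k * (s * P ^ k) ^ d * P ^ (triangle d ℕ.+ d)) ∎

  monomialPart : ℕ → A
  monomialPart k = (a * q) ^ k * ((- (a * a)) ^ k * p^ triangle k)

  t-monomial : ∀ k → t k ≈ p^ triangle k * p^ triangle k * monomialPart k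
  t-monomial zero = solve 0 (:1 := :1 :* :1 :* (:1 :* (:1 :* :1))) refl
  t-monomial (suc k) = begin
    t k * (s * P ^ k)
      ≈⟨ *-cong (t-monomial k) (*-congˡ (P^ k)) ⟩
    T * T * (x * (y * T)) * (s * (p^ k * (p^ k * p^ k)))
      ≈⟨ solve 6 (λ T x y a q r → T :* T :* (x :* (y :* T)) :* (:- (a :* a :* (a :* q)) :* (r :* (r :* r)))
           := T :* r :* (T :* r) :* (a :* q :* x :* ((:- (a :* a)) :* y :* (T :* r)))) refl T x y a q (p^ k) ⟩
    T * p^ k * (T * p^ k) * (a * q * x * ((- (a * a)) * y * (T * p^ k)))
      ≈⟨ *-cong (*-cong T+ T+) (*-congˡ (*-congˡ T+)) ⟨
    p^ triangle (suc k) * p^ triangle (suc k) * monomialPart (suc k) ∎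
    where
    T x y : A
    T = p^ triangle k
    x = (a * q) ^ k
    y = (- (a * a)) ^ k
    T+ : p^ (triangle k ℕ.+ k) ≈ T * p^ k
    T+ = p^-+ (triangle k) k

  module _ {q⁻¹ : A} (inverse : q * q⁻¹ ≈ 1#) where
    q-cancellable : Cancellable q
    q-cancellable = reg-mod q⁻¹ (≈0⇒∣ (trans (+-congʳ inverse) (-‿inverseʳ 1#))) reg-1

    p^-cancellable : ∀ k → Cancellable (p^ k)
    p^-cancellable k = reg-^ k (reg-^ 4 q-cancellable)

    module _ (N : ℕ) (balanced : a * a * p^ N ≈ q * q) where
      balanced-+ : ∀ k m → k ℕ.+ m ≡ N → a * a * (p^ k * p^ m) ≈ q * q
      balanced-+ k m ≡.refl = trans (*-congˡ (sym (p^-+ k m))) balanced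

      -- Since q² = a²pᴺ, each factor q² - a²pʲ equals -a²pʲ(1 - pᴺ⁻ʲ); the exponents N - j for j <
      -- k are those from m + 1 to N.
      falling-a² : ∀ k m → k ℕ.+ m ≡ N →
        falling (a * a) k ≈ (- (a * a)) ^ k * p^ triangle k * gaussian m k
      falling-a² zero m e = solve 0 (:1 := :1 :* :1 :* :1) refl
      falling-a² (suc k) m e = begin
        falling (a * a) k * (q * q - a * a * p^ k)
          ≈⟨ *-cong (falling-a² k (suc m) e′) (+-congʳ (sym (balanced-+ k (suc m) e′))) ⟩
        x * T * G * (a * a * (p^ k * p^ suc m) - a * a * p^ k)
          ≈⟨ solve 6 (λ x T G a r u → x :* T :* G :* (a :* a :* (r :* u) :- a :* a :* r)
               := (:- (a :* a)) :* x :* (T :* r) :* ((:1 :- u) :* G)) refl x T G a (p^ k) (p^ suc m) ⟩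
        (- (a * a)) * x * (T * p^ k) * ((1# - p^ suc m) * G)
          ≈⟨ *-congʳ (*-congˡ (p^-+ (triangle k) k)) ⟨
        (- (a * a)) ^ suc k * p^ triangle (suc k) * gaussian m (suc k) ∎
        where
        e′ : k ℕ.+ suc m ≡ N
        e′ = ≡.trans (ℕP.+-suc k m) e
        x T G : A
        x = (- (a * a)) ^ k
        T = p^ triangle k
        G = gaussian (suc m) k

      -- For i + j = N one has pʲ(b - a²pⁱ) = -(q² - bpʲ), and likewise for `c`, so the two signs
      -- cancel. The factors of the tail thus become those of the falling products in reverse order;
      -- the powers pʲ, one for `b` and one for `c`, make up the two factors `p^ triangle m`.
      tail-reflected : ∀ m k → k ℕ.+ m ≡ N →
        p^ triangle m * p^ triangle m * tail k m ≈ falling b m * falling c m * gaussian k m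
      tail-reflected zero k e = refl
      tail-reflected (suc m) k e = begin
        p^ (triangle m ℕ.+ m) * p^ (triangle m ℕ.+ m) * (step (suc k) * tail (suc k) m)
          ≈⟨ *-congʳ (*-cong (p^-+ (triangle m) m) (p^-+ (triangle m) m)) ⟩
        T * r * (T * r) * ((b - a * a * u) * ((c - a * a * u) * (1# - u)) * V)
          ≈⟨ solve 7 (λ T r b c x u V → T :* r :* (T :* r) :* ((b :- x :* u) :* ((c :- x :* u) :* (:1 :- u)) :* V)
               := T :* T :* V :* ((x :* (u :* r) :- b :* r) :* (x :* (u :* r) :- c :* r)) :* (:1 :- u)) refl T r b c (a * a) u V ⟩
        T * T * V * ((a * a * (u * r) - b * r) * (a * a * (u * r) - c * r)) * (1# - u)
          ≈⟨ *-congʳ (*-cong (tail-reflected m (suc k) e′) (*-cong (+-congʳ (balanced-+ (suc k) m e′)) (+-congʳ (balanced-+ (suc k) m e′)))) ⟩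
        B * C * G * ((q * q - b * r) * (q * q - c * r)) * (1# - u)
          ≈⟨ solve 6 (λ B C G x y z → B :* C :* G :* (x :* y) :* z := B :* x :* (C :* y) :* (z :* G)) refl B C G _ _ (1# - u) ⟩
        B * (q * q - b * r) * (C * (q * q - c * r)) * ((1# - u) * G) ∎
        where
        e′ : suc k ℕ.+ m ≡ N
        e′ = ≡.trans (≡.sym (ℕP.+-suc k m)) e
        T r u V B C G : A
        T = p^ triangle m
        r = p^ m
        u = p^ suc k
        V = tail (suc k) m
        B = falling b m
        C = falling c m
        G = gaussian (suc k) m

      symmetricPart : ℕ → ℕ → A
      symmetricPart k m = gaussian k m * gaussian m k * (falling b k * falling c k * (falling b m * falling c m))

      summand : ∀ k m → k ℕ.+ m ≡ N →
        p^ triangle m * p^ triangle m * (numerator k * tail k m) ≈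
        (q + a * p^ k) * monomialPart k * symmetricPart k m
      summand k m e = begin
        TT * ((h * x) * (F * (B * C)) * V)
          ≈⟨ solve 7 (λ TT h x F B C V → TT :* ((h :* x) :* (F :* (B :* C)) :* V) := TT :* V :* (h :* x :* F :* (B :* C))) refl TT h x F B C V ⟩
        TT * V * (h * x * F * (B * C))
          ≈⟨ *-cong (tail-reflected m k e) (*-congʳ (*-congˡ (falling-a² k m e))) ⟩
        B′ * C′ * g * (h * x * (y * T * g′) * (B * C))
          ≈⟨ solve 10 (λ B′ C′ g h x y T g′ B C → B′ :* C′ :* g :* (h :* x :* (y :* T :* g′) :* (B :* C))
               := h :* (x :* (y :* T)) :* (g :* g′ :* (B :* C :* (B′ :* C′)))) refl B′ C′ g h x y T g′ B C ⟩
        h * (x * (y * T)) * (g * g′ * (B * C * (B′ * C′))) ∎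
        where
        TT h x F B C V B′ C′ g g′ y T : A
        TT = p^ triangle m * p^ triangle m
        h = q + a * p^ k
        x = (a * q) ^ k
        F = falling (a * a) k
        B = falling b k
        C = falling c k
        V = tail k m
        B′ = falling b m
        C′ = falling c m
        g = gaussian k m
        g′ = gaussian m k
        y = (- (a * a)) ^ k
        T = p^ triangle k

      -- Put v = a pᵏ⁺ᵉ. Then v²p = q², hence v²q² = 1, and t (k + d) = - t k · q v³ (v⁴)ᵉ for d = 2e + 1.
      weights-cancel : ∀ k e → k ℕ.+ (k ℕ.+ suc (e ℕ.+ e)) ≡ N →
        (q + a * p^ k) * t k + (q + a * p^ (k ℕ.+ suc (e ℕ.+ e))) * t (k ℕ.+ suc (e ℕ.+ e)) ≈ 0#
      -- The extra factor pᵉ combines with (v⁴)ᵉ to (v⁴p)ᵉ = 1, which removes all powers with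
      -- exponent e from the second summand.
      weights-cancel k e hN = cancel (p^-cancellable e) (begin
        E * ((q + a * K) * t k + (q + a * p^ (k ℕ.+ d)) * t (k ℕ.+ d))
          ≈⟨ *-congˡ (+-congˡ (*-cong (+-congˡ (*-congˡ p^k+d)) t-k+d)) ⟩
        E * ((q + a * K) * t k + (q + a * (K * (r * (E * E)))) * (t k * (s′ * v4e)))
          ≈⟨ solve 7 (λ E q a K T r z → E :* ((q :+ a :* K) :* T :+ (q :+ a :* (K :* (r :* (E :* E)))) :* (T :* (:- (q :* (a :* (K :* E) :* (a :* (K :* E) :* (a :* (K :* E))))) :* z)))
               := T :* (E :* q :+ a :* (K :* E) :- (q :+ a :* (K :* E) :* (r :* E)) :* (q :* (a :* (K :* E) :* (a :* (K :* E) :* (a :* (K :* E))))) :* (z :* E))) refl E q a K (t k) r v4e ⟩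
        t k * (E * q + v - (q + v * (r * E)) * (q * (v * (v * v))) * (v4e * E))
          ≈⟨ *-congˡ (+-congˡ (-‿cong (*-congˡ v4eE))) ⟩
        t k * (E * q + v - (q + v * (r * E)) * (q * (v * (v * v))) * 1#)
          ≈⟨ solve 5 (λ T E q v r → T :* (E :* q :+ v :- (q :+ v :* (r :* E)) :* (q :* (v :* (v :* v))) :* :1)
               := T :* (E :* q :* (:1 :- v :* v :* (v :* v) :* r) :+ v :* (:1 :- v :* v :* (q :* q)))) refl (t k) E q v r ⟩
        t k * (E * q * (1# - v * v * (v * v) * r) + v * (1# - v * v * (q * q)))
          ≈⟨ *-congˡ (+-cong (*-congˡ (+-congˡ (-‿cong v4r))) (*-congˡ (+-congˡ (-‿cong vvqq)))) ⟩
        t k * (E * q * (1# - 1#) + v * (1# - 1#))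
          ≈⟨ solve 4 (λ T E q v → T :* (E :* q :* (:1 :- :1) :+ v :* (:1 :- :1)) := E :* :0) refl (t k) E q v ⟩
        E * 0# ∎)
        where
        d : ℕ
        d = suc (e ℕ.+ e)
        E K r v s′ v4e : A
        E = p^ e
        K = p^ k
        r = q ^ 4
        v = a * (K * E)
        s′ = - (q * (v * (v * v)))
        v4e = (v * v * (v * v)) ^ e
        p^d : p^ d ≈ r * (E * E)
        p^d = *-congˡ (p^-+ e e)
        p^k+d : p^ (k ℕ.+ d) ≈ K * (r * (E * E))
        p^k+d = trans (p^-+ k d) (*-congˡ p^d)
        vvr : v * v * r ≈ q * q
        vvr = begin
          v * v * r ≈⟨ solve 4 (λ a K E r → a :* (K :* E) :* (a :* (K :* E)) :* r := a :* a :* (K :* (K :* (r :* (E :* E))))) refl a K E r ⟩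
          a * a * (K * (K * (r * (E * E)))) ≈⟨ *-congˡ (*-congˡ p^k+d) ⟨
          a * a * (K * p^ (k ℕ.+ d)) ≈⟨ balanced-+ k (k ℕ.+ d) hN ⟩
          q * q ∎
        vvqq : v * v * (q * q) ≈ 1#
        vvqq = cancel q-cancellable (cancel q-cancellable (begin
          q * (q * (v * v * (q * q))) ≈⟨ solve 2 (λ q v → q :* (q :* (v :* v :* (q :* q))) := v :* v :* (q :* (q :* (q :* (q :* :1))))) refl q v ⟩
          v * v * r ≈⟨ vvr ⟩
          q * q ≈⟨ *-congˡ (*-identityʳ q) ⟨
          q * (q * 1#) ∎))
        v4r : v * v * (v * v) * r ≈ 1#
        v4r = begin
          v * v * (v * v) * r ≈⟨ *-assoc _ _ _ ⟩
          v * v * (v * v * r) ≈⟨ *-congˡ vvr ⟩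
          v * v * (q * q) ≈⟨ vvqq ⟩
          1# ∎
        v4eE : v4e * E ≈ 1#
        v4eE = begin
          v4e * E ≈⟨ ^-distrib-* (v * v * (v * v)) r e ⟨
          (v * v * (v * v) * r) ^ e ≈⟨ ^-cong e v4r ⟩
          1# ^ e ≈⟨ 1^ e ⟩
          1# ∎
        s′s′ : s′ * s′ ≈ v * v * (v * v)
        s′s′ = begin
          s′ * s′ ≈⟨ solve 2 (λ q v → :- (q :* (v :* (v :* v))) :* :- (q :* (v :* (v :* v))) := v :* v :* (v :* v) :* (v :* v :* (q :* q))) refl q v ⟩
          v * v * (v * v) * (v * v * (q * q)) ≈⟨ *-congˡ vvqq ⟩
          v * v * (v * v) * 1# ≈⟨ *-identityʳ _ ⟩
          v * v * (v * v) ∎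
        t-k+d : t (k ℕ.+ d) ≈ t k * (s′ * v4e)
        t-k+d = trans (t-+ k d) (*-congˡ (begin
          (s * P ^ k) ^ d * P ^ triangle d ≡⟨ ≡.cong (λ n → (s * P ^ k) ^ d * P ^ n) (triangle-odd e) ⟩
          (s * P ^ k) ^ d * P ^ (e ℕ.* d) ≈⟨ *-congˡ (^-* P e d) ⟩
          (s * P ^ k) ^ d * (P ^ e) ^ d ≈⟨ ^-distrib-* (s * P ^ k) (P ^ e) d ⟨
          (s * P ^ k * P ^ e) ^ d ≈⟨ ^-cong d (*-cong (*-congˡ (P^ k)) (P^ e)) ⟩
          (s * (K * (K * K)) * (E * (E * E))) ^ d
            ≈⟨ ^-cong d (solve 4 (λ a q K E → :- (a :* a :* (a :* q)) :* (K :* (K :* K)) :* (E :* (E :* E)) := :- (q :* (a :* (K :* E) :* (a :* (K :* E) :* (a :* (K :* E)))))) refl a q K E) ⟩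
          s′ * s′ ^ (e ℕ.+ e) ≈⟨ *-congˡ (^-+ s′ e e) ⟩
          s′ * (s′ ^ e * s′ ^ e) ≈⟨ *-congˡ (^-distrib-* s′ s′ e) ⟨
          s′ * (s′ * s′) ^ e ≈⟨ *-congˡ (^-cong e s′s′) ⟩
          s′ * v4e ∎))

      weights : ∀ r k m → N ≡ suc (r ℕ.+ r) → k ℕ.+ m ≡ N → k ℕ.≤ r →
        (q + a * p^ k) * t k + (q + a * p^ m) * t m ≈ 0#
      weights r k m hN h k≤r with ℕP.m≤n⇒∃[o]m+o≡n k≤r
      ... | e , ≡.refl = ≡.subst (λ m → (q + a * p^ k) * t k + (q + a * p^ m) * t m ≈ 0#) m≡
              (weights-cancel k e (≡.trans (≡.cong (k ℕ.+_) m≡) h))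
        where
        lemma : ∀ k e → suc (k ℕ.+ e ℕ.+ (k ℕ.+ e)) ≡ k ℕ.+ (k ℕ.+ suc (e ℕ.+ e))
        lemma = ℕSolver.solve-∀
        m≡ : k ℕ.+ suc (e ℕ.+ e) ≡ m
        m≡ = ℕP.+-cancelˡ-≡ k _ _ (≡.trans (≡.sym (lemma k e)) (≡.trans (≡.sym hN) (≡.sym h)))

      pair-cancels : ∀ r k m → N ≡ suc (r ℕ.+ r) → k ℕ.+ m ≡ N →
        numerator k * tail k m + numerator m * tail m k ≈ 0#
      pair-cancels r k m hN h = cancel (reg-* (reg-* (p^-cancellable (triangle k)) (p^-cancellable (triangle k)))
                                              (reg-* (p^-cancellable (triangle m)) (p^-cancellable (triangle m)))) (begin
        Tk * Tk * (Tm * Tm) * (X + Y)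
          ≈⟨ solve 4 (λ x y X Y → x :* y :* (X :+ Y) := x :* (y :* X) :+ y :* (x :* Y)) refl (Tk * Tk) (Tm * Tm) X Y ⟩
        Tk * Tk * (Tm * Tm * X) + Tm * Tm * (Tk * Tk * Y)
          ≈⟨ +-cong (*-congˡ (summand k m h)) (*-congˡ (summand m k (≡.trans (ℕP.+-comm m k) h))) ⟩
        Tk * Tk * (u * monomialPart k * symmetricPart k m) + Tm * Tm * (w * monomialPart m * symmetricPart m k)
          ≈⟨ +-congˡ (*-congˡ (*-congˡ (*-cong (*-comm _ _) (*-comm _ _)))) ⟩
        Tk * Tk * (u * monomialPart k * symmetricPart k m) + Tm * Tm * (w * monomialPart m * symmetricPart k m)
          ≈⟨ solve 7 (λ x y u w M M′ S → x :* (u :* M :* S) :+ y :* (w :* M′ :* S) := S :* (u :* (x :* M) :+ w :* (y :* M′))) refl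
               (Tk * Tk) (Tm * Tm) u w (monomialPart k) (monomialPart m) (symmetricPart k m) ⟩
        symmetricPart k m * (u * (Tk * Tk * monomialPart k) + w * (Tm * Tm * monomialPart m))
          ≈⟨ *-congˡ (+-cong (*-congˡ (t-monomial k)) (*-congˡ (t-monomial m))) ⟨
        symmetricPart k m * (u * t k + w * t m)
          ≈⟨ *-congˡ total ⟩
        symmetricPart k m * 0#
          ≈⟨ trans (zeroʳ _) (sym (zeroʳ _)) ⟩
        Tk * Tk * (Tm * Tm) * 0# ∎)
        where
        Tk Tm X Y u w : A
        Tk = p^ triangle k
        Tm = p^ triangle m
        X = numerator k * tail k m
        Y = numerator m * tail m k
        u = q + a * p^ k
        w = q + a * p^ m
        total : u * t k + w * t m ≈ 0#
        -- As k + m = 2r + 1, exactly one of k and m is at most r; `weights` expects that one first.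
        total with k ℕ.≤? r
        ... | yes k≤r = weights r k m hN h k≤r
        ... | no k≰r = trans (+-comm _ _) (weights r m k hN (≡.trans (ℕP.+-comm m k) h)
              (ℕP.+-cancelˡ-≤ (suc r) m r (ℕP.≤-trans (ℕP.+-monoˡ-≤ m (ℕP.≰⇒> k≰r)) (ℕP.≤-reflexive (≡.trans h hN)))))

      partialSum-vanishes : ∀ r → N ≡ suc (r ℕ.+ r) → partialSum N ≈ 0#
      partialSum-vanishes r ≡.refl = trans (partialSum≈convolution N)
        (convolution-antisymmetric r (λ k m → numerator k * tail k m) (λ k m → pair-cancels r k m ≡.refl))

-- Images of the sum under ring endomorphisms

module Naturality (R : CommutativeRing 0ℓ 0ℓ) (h : Divisibility.Endo R) where
  open Divisibility R
  open Endo h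

  ⟦-⟧₂ : ∀ {x y X Y} → ⟦ x ⟧ ≈ X → ⟦ y ⟧ ≈ Y → ⟦ x - y ⟧ ≈ X - Y
  ⟦-⟧₂ ex ey = trans (⟦+⟧ _ _) (+-cong ex (trans (⟦-⟧ _) (-‿cong ey)))

  ⟦*⟧₂ : ∀ {x y X Y} → ⟦ x ⟧ ≈ X → ⟦ y ⟧ ≈ Y → ⟦ x * y ⟧ ≈ X * Y
  ⟦*⟧₂ ex ey = trans (⟦*⟧ _ _) (*-cong ex ey)

  ⟦+⟧₂ : ∀ {x y X Y} → ⟦ x ⟧ ≈ X → ⟦ y ⟧ ≈ Y → ⟦ x + y ⟧ ≈ X + Y
  ⟦+⟧₂ ex ey = trans (⟦+⟧ _ _) (+-cong ex ey)

  ⟦^⟧₂ : ∀ {x X} n → ⟦ x ⟧ ≈ X → ⟦ x ^ n ⟧ ≈ X ^ n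
  ⟦^⟧₂ n ex = trans (⟦^⟧ _ n) (^-cong n ex)

  module _ {q a b c q′ a′ b′ c′ : A} (hq : ⟦ q ⟧ ≈ q′) (ha : ⟦ a ⟧ ≈ a′) (hb : ⟦ b ⟧ ≈ b′) (hc : ⟦ c ⟧ ≈ c′) where
    private
      module S = Summation _+_ _*_ -_ 1# q a b c
      module T = Summation _+_ _*_ -_ 1# q′ a′ b′ c′

      falling-natural : ∀ {x x′} → ⟦ x ⟧ ≈ x′ → ∀ k → ⟦ S.falling x k ⟧ ≈ T.falling x′ k
      falling-natural hx zero = ⟦1⟧
      falling-natural hx (suc k) = ⟦*⟧₂ (falling-natural hx k)
        (⟦-⟧₂ (⟦*⟧₂ hq hq) (⟦*⟧₂ hx (⟦^⟧₂ k (⟦^⟧₂ 4 hq))))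

    step-natural : ∀ k → ⟦ S.step k ⟧ ≈ T.step k
    step-natural k = ⟦*⟧₂ (⟦-⟧₂ hb aap) (⟦*⟧₂ (⟦-⟧₂ hc aap) (⟦-⟧₂ ⟦1⟧ p^k))
      where
      p^k : ⟦ S.p^ k ⟧ ≈ T.p^ k
      p^k = ⟦^⟧₂ k (⟦^⟧₂ 4 hq)
      aap : ⟦ a * a * S.p^ k ⟧ ≈ a′ * a′ * T.p^ k
      aap = ⟦*⟧₂ (⟦*⟧₂ ha ha) p^k

    numerator-natural : ∀ k → ⟦ S.numerator k ⟧ ≈ T.numerator k
    numerator-natural k = ⟦*⟧₂ (⟦*⟧₂ (⟦+⟧₂ hq (⟦*⟧₂ ha (⟦^⟧₂ k (⟦^⟧₂ 4 hq)))) (⟦^⟧₂ k (⟦*⟧₂ ha hq)))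
      (⟦*⟧₂ (falling-natural (⟦*⟧₂ ha ha) k) (⟦*⟧₂ (falling-natural hb k) (falling-natural hc k)))

    denominator-natural : ∀ n → ⟦ S.denominator n ⟧ ≈ T.denominator n
    denominator-natural zero = ⟦1⟧
    denominator-natural (suc n) = ⟦*⟧₂ (denominator-natural n) (step-natural (suc n))

    partialSum-natural : ∀ n → ⟦ S.partialSum n ⟧ ≈ T.partialSum n
    partialSum-natural zero = numerator-natural zero
    partialSum-natural (suc n) = ⟦+⟧₂ (⟦*⟧₂ (partialSum-natural n) (step-natural (suc n))) (numerator-natural (suc n))

-- Lowest terms and divisibility of the first sum

module ReducedSum (X : PolynomialRing) where
  open PolynomialRing X
  open Summation _+_ _*_ -_ 1# q a b c public
  open Relation.Binary.Reasoning.Setoid setoid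

  private
    -- For k = 0 the linear factor itself is q + a; for k > 0 the first factor of the falling
    -- product at a² is q² - a².
    numerator-factor : ∀ k → q + a ∣ numerator k
    numerator-factor zero = ∣*ʳ _ (∣*ʳ _ (∣-respʳ (+-congˡ (sym (*-identityʳ a))) ∣-refl))
    numerator-factor (suc k) = ∣*ˡ _ (∣*ʳ _ (factor k))
      where
      factor : ∀ k → q + a ∣ falling (a * a) (suc k)
      factor zero = divides (q - a) (solve 2 (λ q a → (q :+ a) :* (q :- a) := :1 :* (q :* q :- a :* a :* :1)) refl q a)
      factor (suc k) = ∣*ʳ _ (factor k)

    partialSum-factor : ∀ n → q + a ∣ partialSum n
    partialSum-factor zero = numerator-factor zero
    partialSum-factor (suc n) = ∣+ (∣*ʳ _ (partialSum-factor n)) (numerator-factor (suc n))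

  reducedSum : ℕ → A
  reducedSum n = _∣_.quotient (partialSum-factor n)

  reducedSum-equality : ∀ n → (q + a) * reducedSum n ≈ partialSum n
  reducedSum-equality n = _∣_.equality (partialSum-factor n)

  private
    module Va = Variable var-a
    module Vb = Variable var-b
    module Vc = Variable var-c
    module Vq = Variable var-q
    open Values

  b-cancellable : Cancellable b
  b-cancellable = Vb.cancellable-x

  c-cancellable : Cancellable c
  c-cancellable = Vc.cancellable-x

  q-cancellable : Cancellable q
  q-cancellable = Vq.cancellable-x

  private
    at-a=0 : ∀ x y → Va.⟦ x - a * a * y ⟧ ≈ Va.⟦ x ⟧
    at-a=0 x y = begin
      Va.⟦ x - a * a * y ⟧ ≈⟨ ⟦-⟧₂ refl (⟦*⟧₂ (⟦*⟧₂ Va.⟦x⟧ Va.⟦x⟧) refl) ⟩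
      Va.⟦ x ⟧ - 0# * 0# * Va.⟦ y ⟧ ≈⟨ solve 2 (λ x y → x :- :0 :* :0 :* y := x) refl _ _ ⟩
      Va.⟦ x ⟧ ∎
      where open Naturality R Va.endo

  x-a²y-cancellable : ∀ {x} y → Cancellable Va.⟦ x ⟧ → Cancellable (x - a * a * y)
  x-a²y-cancellable y r = Va.cancellable-lowest (reg-resp (sym (at-a=0 _ y)) r)

  1-q^-cancellable : ∀ x → Cancellable (1# - q * x)
  1-q^-cancellable x = Vq.cancellable-lowest (reg-resp (sym (begin
    Vq.⟦ 1# - q * x ⟧ ≈⟨ ⟦-⟧₂ Vq.⟦1⟧ (⟦*⟧₂ Vq.⟦x⟧ refl) ⟩
    1# - 0# * Vq.⟦ x ⟧ ≈⟨ solve 1 (λ x → :1 :- :0 :* x := :1) refl _ ⟩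
    1# ∎)) reg-1)
    where open Naturality R Vq.endo

  private
    p^-suc : ∀ k → p^ suc k ≈ q * (q * (q * (q * 1#)) * p^ k)
    p^-suc k = *-assoc q _ _

  b-factor-cancellable : ∀ i → Cancellable (b - a * a * p^ i)
  b-factor-cancellable i = x-a²y-cancellable (p^ i) (reg-resp (sym (at-b var-a-values)) b-cancellable)

  c-factor-cancellable : ∀ i → Cancellable (c - a * a * p^ i)
  c-factor-cancellable i = x-a²y-cancellable (p^ i) (reg-resp (sym (at-c var-a-values)) c-cancellable)

  q-factor-cancellable : ∀ i → Cancellable (1# - p^ suc i)
  q-factor-cancellable i = reg-resp (+-congˡ (-‿cong (sym (p^-suc i)))) (1-q^-cancellable _)

  denominator-cancellable : ∀ n → Cancellable (denominator n)
  denominator-cancellable zero = reg-1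
  denominator-cancellable (suc n) = reg-* (denominator-cancellable n)
    (reg-* (b-factor-cancellable (suc n)) (reg-* (c-factor-cancellable (suc n)) (q-factor-cancellable n)))

  q+a-cancellable : Cancellable (q + a)
  q+a-cancellable = Va.cancellable-lowest (reg-resp (sym (begin
    Va.⟦ q + a ⟧ ≈⟨ ⟦+⟧₂ (at-q var-a-values) Va.⟦x⟧ ⟩
    q + 0# ≈⟨ +-identityʳ q ⟩
    q ∎)) q-cancellable)
    where open Naturality R Va.endo

  private
    -- The lowest coefficient with respect to `a` is required to be a power of q, with coefficient
    -- 1. This form is stable under products, and regularity of such an element modulo any `u` free
    -- of `a` reduces to regularity of q.
    record Lowest (k : ℕ) (f : A) : Set where
      constructor lowest
      field
        exponent : ℕ
        rest : A
        shape : f ≈ a ^ k * (q ^ exponent + a * rest)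

    lowest-* : ∀ {k l f g} → Lowest k f → Lowest l g → Lowest (k ℕ.+ l) (f * g)
    lowest-* {k} {l} {f} {g} (lowest m r ef) (lowest n s eg) =
      lowest (m ℕ.+ n) (q ^ m * s + r * q ^ n + a * (r * s)) (begin
        f * g
          ≈⟨ *-cong ef eg ⟩
        a ^ k * (q ^ m + a * r) * (a ^ l * (q ^ n + a * s))
          ≈⟨ solve 7 (λ x y u v a r s → x :* (u :+ a :* r) :* (y :* (v :+ a :* s))
               := x :* y :* (u :* v :+ a :* (u :* s :+ r :* v :+ a :* (r :* s)))) refl (a ^ k) (a ^ l) (q ^ m) (q ^ n) a r s ⟩
        a ^ k * a ^ l * (q ^ m * q ^ n + a * (q ^ m * s + r * q ^ n + a * (r * s)))
          ≈⟨ *-cong (^-+ a k l) (+-congʳ (^-+ q m n)) ⟨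
        a ^ (k ℕ.+ l) * (q ^ (m ℕ.+ n) + a * (q ^ m * s + r * q ^ n + a * (r * s))) ∎)

    lowest-+ : ∀ {k f} g → Lowest k f → Lowest k (a ^ k * (a * g) + f)
    lowest-+ {k} {f} g (lowest m r e) = lowest m (g + r) (trans (+-congˡ e)
      (solve 5 (λ x u a g r → x :* (a :* g) :+ x :* (u :+ a :* r) := x :* (u :+ a :* (g :+ r))) refl (a ^ k) (q ^ m) a g r))

    lowest-resp : ∀ {k f g} → f ≈ g → Lowest k f → Lowest k g
    lowest-resp e (lowest m r s) = lowest m r (trans (sym e) s)

    -- The pairs (B, C) that occur later are (a²pⁱ, 0), (0, a²pⁱ) and (0, 0).
    module _ {B C : A} (hB : a * a ∣ B) (hC : a * a ∣ C) where
      module T = Summation _+_ _*_ -_ 1# q a B C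

      lowest-falling : ∀ {x} → a * a ∣ x → ∀ k → Lowest 0 (T.falling x k)
      lowest-falling d zero = lowest 0 0# (solve 1 (λ a → :1 := :1 :* (:1 :+ a :* :0)) refl a)
      lowest-falling {x} d@(divides y e) (suc k) = lowest-* (lowest-falling d k)
        (lowest 2 (- (a * y * p^ k)) (trans (+-congˡ (-‿cong (*-congʳ (sym e))))
          (solve 4 (λ q a y p → q :* q :- a :* a :* y :* p := :1 :* (q :* (q :* :1) :+ a :* (:- (a :* y :* p)))) refl q a y (p^ k))))

      lowest-numerator : ∀ k → Lowest k (T.numerator k)
      lowest-numerator k = ≡.subst (λ n → Lowest n (T.numerator k)) (ℕP.+-identityʳ k)
        (lowest-* (lowest-* linear (power-lowest k)) (lowest-* (lowest-falling ∣-refl k) (lowest-* (lowest-falling hB k) (lowest-falling hC k))))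
        where
        linear : Lowest 0 (q + a * p^ k)
        linear = lowest 1 (p^ k) (solve 3 (λ q a p → q :+ a :* p := :1 :* (q :* :1 :+ a :* p)) refl q a (p^ k))
        power-lowest : ∀ k → Lowest k ((a * q) ^ k)
        power-lowest k = lowest k 0# (trans (^-distrib-* a q k)
          (solve 3 (λ x y a → x :* y := x :* (y :+ a :* :0)) refl (a ^ k) (q ^ k) a))

      -- At such B and C every `step` is divisible by a⁴, whereas the lowest term of the numerator
      -- gains only one factor a. So the earlier partial sum contributes in higher order, and the
      -- last numerator alone determines the lowest term.
      lowest-partialSum : ∀ n → Lowest n (T.partialSum n)
      lowest-partialSum zero = lowest-numerator zero
      lowest-partialSum (suc n) with lowest-partialSum n
      ... | lowest m r e = lowest-resp (+-congʳ (sym rearrange)) (lowest-+ g (lowest-numerator (suc n)))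
        where
        u v g y z : A
        u = p^ suc n
        y = _∣_.quotient hB
        z = _∣_.quotient hC
        v = q ^ m + a * r
        g = v * (a * a * (y - u) * (z - u) * (1# - u))
        rearrange : T.partialSum n * T.step (suc n) ≈ a ^ suc n * (a * g)
        rearrange = begin
          T.partialSum n * T.step (suc n)
            ≈⟨ *-cong e (*-cong (+-congʳ (sym (_∣_.equality hB))) (*-congʳ (+-congʳ (sym (_∣_.equality hC))))) ⟩
          a ^ n * v * ((a * a * y - a * a * u) * ((a * a * z - a * a * u) * (1# - u)))
            ≈⟨ solve 6 (λ x v a y z u → x :* v :* ((a :* a :* y :- a :* a :* u) :* ((a :* a :* z :- a :* a :* u) :* (:1 :- u)))
                 := a :* x :* (a :* (v :* (a :* a :* (y :- u) :* (z :- u) :* (:1 :- u))))) refl (a ^ n) v a y z u ⟩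
          a ^ suc n * (a * g) ∎

    reg-Lowest : ∀ {u k f} → Va.⟦ u ⟧ ≈ u → Reg u q → Lowest k f → Reg u f
    reg-Lowest {u} {k} {f} fix r (lowest m s e) = reg-resp (sym e)
      (reg-* (reg-^ k (Va.reg-x fix)) (Va.reg-lowest fix (reg-resp (sym (begin
        Va.⟦ q ^ m + a * s ⟧ ≈⟨ ⟦+⟧₂ (⟦^⟧₂ m (at-q var-a-values)) (⟦*⟧₂ Va.⟦x⟧ refl) ⟩
        q ^ m + 0# * Va.⟦ s ⟧ ≈⟨ solve 2 (λ x y → x :+ :0 :* y := x) refl _ _ ⟩
        q ^ m ∎)) (reg-^ m r))))
      where open Naturality R Va.endo

    module S = Summation _+_ _*_ -_ 1#

  private
    a²p : ℕ → A
    a²p i = a * a * p^ i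

    fixes-a²p : ∀ h → Endo.⟦_⟧ h q ≈ q → Endo.⟦_⟧ h a ≈ a → ∀ i → Endo.⟦_⟧ h (a²p i) ≈ a²p i
    fixes-a²p h hq ha i = ⟦*⟧₂ (⟦*⟧₂ ha ha) (⟦^⟧₂ i (⟦^⟧₂ 4 hq))
      where open Naturality R h

    -- Modulo f the sum is its value at a point where f vanishes.
    regular-at-zero : ∀ {f} n B C → Endo.⟦_⟧ (substitute q a B C) f ≈ 0# → b ≈ B [ f ] → c ≈ C [ f ] →
      Cancellable (S.partialSum q a B C n) → Reg f (partialSum n)
    regular-at-zero {f} n B C σf b≈B c≈C regular = reg λ t d →
      let σt≈0 = 0∣⇒≈0 (cancel∣ regular σ.⟦ t ⟧ (∣-respʳ (⟦*⟧₂ σS refl) (∣-respˡ σf (σ.⟦⟧-∣ d))))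
      in ∣-respʳ (trans (+-congˡ (trans (-‿cong σt≈0) -0#≈0#)) (+-identityʳ t))
           (∣-diff (substitute-mod (≈⇒≈mod f refl) (≈⇒≈mod f refl) b≈B c≈C t))
      where
      module σ = Endo (substitute q a B C)
      open Naturality R (substitute q a B C)
      vals : Values (substitute q a B C) q a B C
      vals = substitute-values q a B C
      σS : σ.⟦ partialSum n ⟧ ≈ S.partialSum q a B C n
      σS = partialSum-natural (at-q vals) (at-a vals) (at-b vals) (at-c vals) n

  -- At b = a²pⁱ the lowest term of the sum with respect to c and a is a power of q times aⁿ.
  b-factor-regular : ∀ i n → Reg (b - a * a * p^ i) (partialSum n)
  b-factor-regular i n = regular-at-zero n (a²p i) c
    (trans (N.⟦-⟧₂ (at-b vals) (fixes-a²p σ (at-q vals) (at-a vals) i)) (-‿inverseʳ _)) (mod ∣-refl) (≈⇒≈mod _ refl)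
    (Vc.cancellable-lowest (reg-resp
      (sym (Nc.partialSum-natural (at-q var-c-values) (at-a var-c-values)
        (fixes-a²p Vc.endo (at-q var-c-values) (at-a var-c-values) i) Vc.⟦x⟧ n))
      (reg-Lowest Va.⟦0⟧ q-cancellable (lowest-partialSum (∣*ʳ _ ∣-refl) ∣0 n))))
    where
    σ : Endo
    σ = substitute q a (a²p i) c
    vals : Values σ q a (a²p i) c
    vals = substitute-values q a (a²p i) c
    module N = Naturality R σ
    module Nc = Naturality R Vc.endo

  c-factor-regular : ∀ i n → Reg (c - a * a * p^ i) (partialSum n)
  c-factor-regular i n = regular-at-zero n b (a²p i)
    (trans (N.⟦-⟧₂ (at-c vals) (fixes-a²p σ (at-q vals) (at-a vals) i)) (-‿inverseʳ _)) (≈⇒≈mod _ refl) (mod ∣-refl)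
    (Vb.cancellable-lowest (reg-resp
      (sym (Nb.partialSum-natural (at-q var-b-values) (at-a var-b-values) Vb.⟦x⟧
        (fixes-a²p Vb.endo (at-q var-b-values) (at-a var-b-values) i) n))
      (reg-Lowest Va.⟦0⟧ q-cancellable (lowest-partialSum ∣0 (∣*ʳ _ ∣-refl) n))))
    where
    σ : Endo
    σ = substitute q a b (a²p i)
    vals : Values σ q a b (a²p i)
    vals = substitute-values q a b (a²p i)
    module N = Naturality R σ
    module Nb = Naturality R Vb.endo

  -- The lowest coefficient of the sum with respect to b, c, a is a power of q, a unit modulo 1 - pⁱ.
  q-factor-regular : ∀ i n → Reg (1# - p^ suc i) (partialSum n)
  q-factor-regular i n = Vb.reg-lowest (fixed Vb.endo (at-q var-b-values))
    (reg-resp (sym (Nb.partialSum-natural (at-q var-b-values) (at-a var-b-values) Vb.⟦x⟧ (at-c var-b-values) n))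
      (Vc.reg-lowest (fixed Vc.endo (at-q var-c-values))
        (reg-resp (sym (Nc.partialSum-natural (at-q var-c-values) (at-a var-c-values) Vc.⟦0⟧ Vc.⟦x⟧ n))
          (reg-Lowest (fixed Va.endo (at-q var-a-values)) q-regular (lowest-partialSum ∣0 ∣0 n)))))
    where
    module Nb = Naturality R Vb.endo
    module Nc = Naturality R Vc.endo
    fixed : ∀ h → Endo.⟦_⟧ h q ≈ q → Endo.⟦_⟧ h (1# - p^ suc i) ≈ 1# - p^ suc i
    fixed h hq = ⟦-⟧₂ (Endo.⟦1⟧ h) (⟦^⟧₂ (suc i) (⟦^⟧₂ 4 hq))
      where open Naturality R h
    q-regular : Reg (1# - p^ suc i) q
    q-regular = reg-mod (q * (q * (q * 1#)) * p^ i) (divides (- 1#)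
      (solve 2 (λ q p → (:1 :- q :* (q :* (q :* (q :* :1))) :* p) :* (:- :1)
        := q :* (q :* (q :* (q :* :1)) :* p) :- :1) refl q (p^ i))) reg-1

  -- The sum is regular modulo each factor of the denominator, so a common divisor can be stripped
  -- of these factors one at a time until it divides 1.
  reducedSum-coprime : ∀ n {g} → g ∣ reducedSum n → ∀ k → g ∣ denominator k → g ∣ 1#
  reducedSum-coprime n g∣N zero d = d
  reducedSum-coprime n {g} g∣N (suc k) d = reducedSum-coprime n g∣N k
    (drop-factor _ (q-factor-cancellable k) (regular (q-factor-regular k n)) g∣N
    (drop-factor _ (c-factor-cancellable (suc k)) (regular (c-factor-regular (suc k) n)) g∣N
    (drop-factor _ (b-factor-cancellable (suc k)) (regular (b-factor-regular (suc k) n)) g∣N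
      (∣-respʳ (solve 4 (λ x y z w → x :* (y :* (z :* w)) := y :* (z :* (w :* x))) refl _ _ _ _) d))))
    where
    regular : ∀ {u} → Reg u (partialSum n) → Reg u (reducedSum n)
    regular = reg-factor (divides (q + a) (trans (*-comm _ _) (reducedSum-equality n)))

  module _ (r : ℕ) where
    private
      N w : ℕ
      N = suc (r ℕ.+ r)
      -- For n = 4r + 1 these are N = (n + 1)/2 and w = 2n. The form `suc` of `w` makes visible that
      -- q is a unit modulo 1 - a²q²ⁿ, with inverse a²q²ⁿ⁻¹.
      w = suc (r ℕ.* 8 ℕ.+ 1)

    -- 1 - a²q²ⁿ for n = 4r + 1
    modulus : A
    modulus = 1# - q ^ w * (a * a)

    private
      p^N : p^ N ≈ q * q * q ^ w
      p^N = begin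
        p^ N ≈⟨ ^-* q 4 N ⟨
        q ^ (4 ℕ.* N) ≡⟨ ≡.cong (q ^_) (lemma r) ⟩
        q ^ (2 ℕ.+ w) ≈⟨ *-assoc q q _ ⟨
        q * q * q ^ w ∎
        where
        lemma : ∀ r → 4 ℕ.* suc (r ℕ.+ r) ≡ 2 ℕ.+ suc (r ℕ.* 8 ℕ.+ 1)
        lemma = ℕSolver.solve-∀

      -- The quotient ring has the same carrier and operations, so the partial sum formed in it is
      -- the same polynomial, and its vanishing there is divisibility. The balancing condition holds
      -- because a²pᴺ - q² = q²(a²q²ⁿ - 1).
      modulus∣partialSum : modulus ∣ partialSum N
      modulus∣partialSum = ∣-respʳ (solve 1 (λ x → x :- :0 := x) refl _) (∣-diff
        (Pairing.partialSum-vanishes (quotientRing modulus) q a b c {q ^ (r ℕ.* 8 ℕ.+ 1) * (a * a)}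
          (mod (divides (- 1#) (solve 3 (λ q x a → (:1 :- q :* x :* (a :* a)) :* (:- :1)
            := q :* (x :* (a :* a)) :- :1) refl q _ a)))
          N
          (mod (divides (- (q * q)) (begin
            modulus * - (q * q) ≈⟨ solve 3 (λ q x a → (:1 :- x :* (a :* a)) :* (:- (q :* q)) := a :* a :* (q :* q :* x) :- q :* q) refl q (q ^ w) a ⟩
            a * a * (q * q * q ^ w) - q * q ≈⟨ +-congʳ (*-congˡ p^N) ⟨
            a * a * p^ N - q * q ∎)))
          r ≡.refl))

      modulus-fixed : Va.⟦ 1# - p^ N ⟧ ≈ 1# - p^ N
      modulus-fixed = ⟦-⟧₂ Va.⟦1⟧ (⟦^⟧₂ N (⟦^⟧₂ 4 (at-q var-a-values)))
        where open Naturality R Va.endo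

      -- (q + a)(q - a)q²ⁿ ≡ q²ⁿ⁺² - 1 modulo 1 - a²q²ⁿ, and the latter has constant term 1 with respect to a.
      q+a-regular : Reg modulus (q + a)
      q+a-regular = reg-mod ((q - a) * q ^ w)
        (divides 1# (trans
          (solve 3 (λ q a x → (:1 :- x :* (a :* a)) :* :1 := (q :+ a) :* ((q :- a) :* x) :- :- (:1 :- q :* q :* x)) refl q a (q ^ w))
          (+-congˡ (-‿cong (-‿cong (+-congˡ (-‿cong (sym p^N))))))))
        (reg-neg (reg-swap (q-factor-cancellable (r ℕ.+ r)) (Va.reg-lowest modulus-fixed (reg-resp (sym (begin
          Va.⟦ modulus ⟧ ≈⟨ ⟦-⟧₂ Va.⟦1⟧ (⟦*⟧₂ refl (⟦*⟧₂ Va.⟦x⟧ Va.⟦x⟧)) ⟩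
          1# - Va.⟦ q ^ w ⟧ * (0# * 0#) ≈⟨ solve 1 (λ x → :1 :- x :* (:0 :* :0) := :1) refl _ ⟩
          1# ∎)) reg-1))))
        where open Naturality R Va.endo

    modulus∣reducedSum : modulus ∣ reducedSum N
    modulus∣reducedSum = cancel∣ q+a-regular _ (∣-respʳ (sym (reducedSum-equality N)) modulus∣partialSum)

-- Fractions

module Fractions (R : CommutativeRing 0ℓ 0ℓ) where
  open Divisibility R
  open Relation.Binary.Reasoning.Setoid setoid

  Fraction : Set
  Fraction = A × A

  infixl 6 _⊕_ _⊖_
  infixl 7 _⊗_ _⊘_
  infix 4 _~_

  _⊕_ _⊖_ _⊗_ _⊘_ : Fraction → Fraction → Fraction
  (n , d) ⊕ (n′ , d′) = n * d′ + n′ * d , d * d′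
  (n , d) ⊖ (n′ , d′) = n * d′ - n′ * d , d * d′
  (n , d) ⊗ (n′ , d′) = n * n′ , d * d′
  (n , d) ⊘ (n′ , d′) = n * d′ , d * n′

  -- Transitivity would require cancellable denominators. The given fraction therefore stays on the
  -- left throughout, while the right-hand side is brought into shape by `reshape`, `expand` and
  -- `reduce`; only `reduce` asks for a cancellable element.
  record _~_ (x y : Fraction) : Set where
    constructor cross
    field
      equation : proj₁ x * proj₂ y ≈ proj₁ y * proj₂ x
  open _~_ public

  ~-refl : ∀ {x} → x ~ x
  ~-refl = cross refl

  ~-components : ∀ {n d n′ d′} → n ≈ n′ → d ≈ d′ → (n , d) ~ (n′ , d′)
  ~-components e f = cross (*-cong e (sym f))

  ⊕-cong : ∀ {x x′ y y′} → x ~ x′ → y ~ y′ → (x ⊕ y) ~ (x′ ⊕ y′)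
  ⊕-cong {n , d} {n′ , d′} {m , e} {m′ , e′} (cross h) (cross k) = cross (begin
    (n * e + m * d) * (d′ * e′) ≈⟨ solve 6 (λ n d m e d′ e′ → (n :* e :+ m :* d) :* (d′ :* e′) := n :* d′ :* (e :* e′) :+ m :* e′ :* (d :* d′)) refl n d m e d′ e′ ⟩
    n * d′ * (e * e′) + m * e′ * (d * d′) ≈⟨ +-cong (*-congʳ h) (*-congʳ k) ⟩
    n′ * d * (e * e′) + m′ * e * (d * d′) ≈⟨ solve 6 (λ n d m e d′ e′ → n :* d :* (e :* e′) :+ m :* e :* (d :* d′) := (n :* e′ :+ m :* d′) :* (d :* e)) refl n′ d m′ e d′ e′ ⟩
    (n′ * e′ + m′ * d′) * (d * e) ∎)

  ⊖-cong : ∀ {x x′ y y′} → x ~ x′ → y ~ y′ → (x ⊖ y) ~ (x′ ⊖ y′)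
  ⊖-cong {y = m , e} {m′ , e′} h (cross k) = cross (trans (*-congʳ (+-congˡ (-‿distribˡ-* _ _)))
    (trans (equation (⊕-cong h (cross { - m , e} { - m′ , e′} negated))) (*-congʳ (+-congˡ (sym (-‿distribˡ-* _ _))))))
    where
    negated : - m * e′ ≈ - m′ * e
    negated = trans (sym (-‿distribˡ-* _ _)) (trans (-‿cong k) (-‿distribˡ-* _ _))

  ⊗-cong : ∀ {x x′ y y′} → x ~ x′ → y ~ y′ → (x ⊗ y) ~ (x′ ⊗ y′)
  ⊗-cong {n , d} {n′ , d′} {m , e} {m′ , e′} (cross h) (cross k) = cross (begin
    n * m * (d′ * e′) ≈⟨ solve 4 (λ n m d e → n :* m :* (d :* e) := n :* d :* (m :* e)) refl n m d′ e′ ⟩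
    n * d′ * (m * e′) ≈⟨ *-cong h k ⟩
    n′ * d * (m′ * e) ≈⟨ solve 4 (λ n m d e → n :* d :* (m :* e) := n :* m :* (d :* e)) refl n′ m′ d e ⟩
    n′ * m′ * (d * e) ∎)

  ⊘-cong : ∀ {x x′ y y′} → x ~ x′ → y ~ y′ → (x ⊘ y) ~ (x′ ⊘ y′)
  ⊘-cong {n , d} {n′ , d′} {m , e} {m′ , e′} (cross h) (cross k) = cross (begin
    n * e * (d′ * m′) ≈⟨ solve 4 (λ n e d m → n :* e :* (d :* m) := n :* d :* (m :* e)) refl n e d′ m′ ⟩
    n * d′ * (m′ * e) ≈⟨ *-cong h (sym k) ⟩
    n′ * d * (m * e′) ≈⟨ solve 4 (λ n d m e → n :* d :* (m :* e) := n :* e :* (d :* m)) refl n′ d m e′ ⟩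
    n′ * e′ * (d * m) ∎)

  reshape : ∀ {x n d n′ d′} → n ≈ n′ → d ≈ d′ → x ~ (n , d) → x ~ (n′ , d′)
  reshape e f (cross h) = cross (trans (*-congˡ (sym f)) (trans h (*-congʳ e)))

  expand : ∀ {x n d} z → x ~ (n , d) → x ~ (n * z , d * z)
  expand {x} {n} {d} z (cross h) = cross (begin
    proj₁ x * (d * z) ≈⟨ *-assoc _ _ _ ⟨
    proj₁ x * d * z ≈⟨ *-congʳ h ⟩
    n * proj₂ x * z ≈⟨ solve 3 (λ x y z → x :* y :* z := x :* z :* y) refl _ _ _ ⟩
    n * z * proj₂ x ∎)

  reduce : ∀ {x n d z} → Cancellable z → x ~ (z * n , z * d) → x ~ (n , d)
  reduce {x} {n} {d} {z} r (cross h) = cross (cancel r (begin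
    z * (proj₁ x * d) ≈⟨ solve 3 (λ x y z → z :* (x :* y) := x :* (z :* y)) refl _ _ _ ⟩
    proj₁ x * (z * d) ≈⟨ h ⟩
    z * n * proj₂ x ≈⟨ *-assoc _ _ _ ⟩
    z * (n * proj₂ x) ∎))

-- Closed forms of the summands

module Shapes (X : PolynomialRing) where
  open PolynomialRing X
  open ReducedSum X
  open Fractions R
  open Relation.Binary.Reasoning.Setoid setoid

  𝟙 : Fraction
  𝟙 = 1# , 1#

  pochhammer-step : ∀ {k x y d P F} → x ~ (y , d) → P ~ (p^ k , 1#) → F ~ (pochhammer d y k , d ^ k) →
                    F ⊗ (𝟙 ⊖ x ⊗ P) ~ (pochhammer d y (suc k) , d ^ suc k)
  pochhammer-step {k} {x} {y} {d} hx hP hF = reshape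
    (solve 4 (λ f d y r → f :* (:1 :* (d :* :1) :- y :* r :* :1) := f :* (d :- y :* r)) refl _ d y (p^ k))
    (solve 2 (λ f d → f :* (:1 :* (d :* :1)) := d :* f) refl _ d)
    (⊗-cong hF (⊖-cong {𝟙} ~-refl (⊗-cong hx hP)))

  -- The exponent 4k - 1 is negative exactly for k = 0, where `monF` places q in the denominator.
  -- For k > 0 the power of q is in the numerator, and `prefactor-suc` expands by q to reach the
  -- same denominator.
  prefactor-zero : ∀ {M z} → M ~ (z , q) → 𝟙 ⊕ M ~ (q + z * p^ 0 , q)
  prefactor-zero {M} {z} h = reshape
    (solve 2 (λ q z → :1 :* q :+ z :* :1 := q :+ z :* :1) refl q z) (*-identityˡ q) (⊕-cong {𝟙} ~-refl h)

  prefactor-suc : ∀ {M z} k e → suc e ≡ 4 ℕ.* suc k → M ~ (q ^ e * z , 1#) → 𝟙 ⊕ M ~ (q + z * p^ suc k , q)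
  prefactor-suc {M} {z} k e he h = reshape
    (begin
      (1# * 1# + q ^ e * z * 1#) * q ≈⟨ solve 3 (λ q x z → (:1 :* :1 :+ x :* z :* :1) :* q := q :+ z :* (q :* x)) refl q (q ^ e) z ⟩
      q + z * q ^ suc e ≡⟨ ≡.cong (λ n → q + z * q ^ n) he ⟩
      q + z * q ^ (4 ℕ.* suc k) ≈⟨ +-congˡ (*-congˡ (^-* q 4 (suc k))) ⟩
      q + z * p^ suc k ∎)
    (solve 1 (λ q → :1 :* :1 :* q := q) refl q)
    (expand q (⊕-cong {𝟙} ~-refl h))

  denominator-split : ∀ k → denominator k ≈
    pochhammer b (a * a * q ^ 4) k * (pochhammer c (a * a * q ^ 4) k * pochhammer 1# (q ^ 4) k)
  denominator-split zero = solve 0 (:1 := :1 :* (:1 :* :1)) refl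
  denominator-split (suc k) = trans (*-congʳ (denominator-split k))
    (solve 8 (λ B C G b c x r u → B :* (C :* G) :* ((b :- x :* (r :* u)) :* ((c :- x :* (r :* u)) :* (:1 :- r :* u)))
      := B :* (b :- x :* r :* u) :* (C :* (c :- x :* r :* u) :* (G :* (:1 :- r :* u)))) refl _ _ _ b c (a * a) (q ^ 4) (p^ k))

  private
    -- Of q⁷ᵏ, the part qᵏ belongs to (aq)ᵏ in `numerator`, and three copies of (q²)ᵏ cancel the
    -- denominators of the three Pochhammer symbols with q⁻² in their arguments.
    q⁷^ : ∀ k → (q ^ 7) ^ k ≈ q ^ k * ((q * q) ^ k * ((q * q) ^ k * (q * q) ^ k))
    q⁷^ k = begin
      (q ^ 7) ^ k
        ≈⟨ ^-cong k (solve 1 (λ q → q :* (q :* (q :* (q :* (q :* (q :* (q :* :1)))))) := q :* (q :* q :* (q :* q :* (q :* q)))) refl q) ⟩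
      (q * (q * q * (q * q * (q * q)))) ^ k
        ≈⟨ ^-distrib-* q _ k ⟩
      q ^ k * (q * q * (q * q * (q * q))) ^ k
        ≈⟨ *-congˡ (trans (^-distrib-* (q * q) _ k) (*-congˡ (^-distrib-* (q * q) (q * q) k))) ⟩
      q ^ k * ((q * q) ^ k * ((q * q) ^ k * (q * q) ^ k)) ∎

  summand₁-shape : ∀ k {H A B C H₀ A′ B′ C′ M} →
    H ~ (q + a * p^ k , q) →
    A ~ (falling (a * a) k , (q * q) ^ k) → B ~ (falling b k , (q * q) ^ k) → C ~ (falling c k , (q * q) ^ k) →
    H₀ ~ (q + a , q) →
    A′ ~ (pochhammer b (a * a * q ^ 4) k , b ^ k) → B′ ~ (pochhammer c (a * a * q ^ 4) k , c ^ k) →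
    C′ ~ (pochhammer 1# (q ^ 4) k , 1# ^ k) →
    M ~ ((q ^ 7 * a) ^ k , (b * c) ^ k) →
    (H ⊗ A ⊗ B ⊗ C) ⊘ (H₀ ⊗ A′ ⊗ B′ ⊗ C′) ⊗ M ~ (numerator k , (q + a) * denominator k)
  summand₁-shape k hH hA hB hC hH₀ hA′ hB′ hC′ hM = reduce z-cancellable (reshape
    (begin
      h * fa * fb * fc * (q * b ^ k * c ^ k * 1# ^ k) * (q ^ 7 * a) ^ k
        ≈⟨ *-cong (*-congˡ (*-congˡ (1^ k))) (trans (^-distrib-* (q ^ 7) a k) (*-congʳ (q⁷^ k))) ⟩
      h * fa * fb * fc * (q * b ^ k * c ^ k * 1#) * (q ^ k * (Q * (Q * Q)) * a ^ k)
        ≈⟨ solve 10 (λ h fa fb fc q x y u Q v → h :* fa :* fb :* fc :* (q :* x :* y :* :1) :* (u :* (Q :* (Q :* Q)) :* v)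
             := (q :* (Q :* (Q :* Q)) :* (x :* y)) :* (h :* (v :* u) :* (fa :* (fb :* fc)))) refl h fa fb fc q (b ^ k) (c ^ k) (q ^ k) Q (a ^ k) ⟩
      z * (h * (a ^ k * q ^ k) * (fa * (fb * fc)))
        ≈⟨ *-congˡ (*-congʳ (*-congˡ (^-distrib-* a q k))) ⟨
      z * numerator k ∎)
    (begin
      q * Q * Q * Q * ((q + a) * db * dc * dg) * (b * c) ^ k
        ≈⟨ *-congˡ (^-distrib-* b c k) ⟩
      q * Q * Q * Q * ((q + a) * db * dc * dg) * (b ^ k * c ^ k)
        ≈⟨ solve 8 (λ q Q w db dc dg x y → q :* Q :* Q :* Q :* (w :* db :* dc :* dg) :* (x :* y)
             := (q :* (Q :* (Q :* Q)) :* (x :* y)) :* (w :* (db :* (dc :* dg)))) refl q Q (q + a) db dc dg (b ^ k) (c ^ k) ⟩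
      z * ((q + a) * (db * (dc * dg)))
        ≈⟨ *-congˡ (*-congˡ (denominator-split k)) ⟨
      z * ((q + a) * denominator k) ∎)
    (⊗-cong (⊘-cong (⊗-cong (⊗-cong (⊗-cong hH hA) hB) hC) (⊗-cong (⊗-cong (⊗-cong hH₀ hA′) hB′) hC′)) hM))
    where
    h fa fb fc Q db dc dg z : A
    h = q + a * p^ k
    fa = falling (a * a) k
    fb = falling b k
    fc = falling c k
    Q = (q * q) ^ k
    db = pochhammer b (a * a * q ^ 4) k
    dc = pochhammer c (a * a * q ^ 4) k
    dg = pochhammer 1# (q ^ 4) k
    z = q * (Q * (Q * Q)) * (b ^ k * c ^ k)
    Q-cancellable : Cancellable Q
    Q-cancellable = reg-^ k (reg-* q-cancellable q-cancellable)
    z-cancellable : Cancellable z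
    z-cancellable = reg-* (reg-* q-cancellable (reg-* Q-cancellable (reg-* Q-cancellable Q-cancellable)))
      (reg-* (reg-^ k b-cancellable) (reg-^ k c-cancellable))

  module S₁ = Summation _+_ _*_ -_ 1# q 1# 1# 1#

  private
    pochhammer-cong : ∀ d {x y} → x ≈ y → ∀ k → pochhammer d x k ≈ pochhammer d y k
    pochhammer-cong d e zero = refl
    pochhammer-cong d e (suc k) = *-cong (pochhammer-cong d e k) (+-congˡ (-‿cong (*-congʳ e)))

    S₁-falling : ∀ k → S₁.falling (1# * 1#) k ≈ pochhammer (q * q) 1# k
    S₁-falling k = pochhammer-cong (q * q) (*-identityʳ 1#) k

    S₁-denominator : ∀ k → S₁.denominator k ≈
      pochhammer 1# (q ^ 4) k * (pochhammer 1# (q ^ 4) k * pochhammer 1# (q ^ 4) k)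
    S₁-denominator zero = solve 0 (:1 := :1 :* (:1 :* :1)) refl
    S₁-denominator (suc k) = trans (*-congʳ (S₁-denominator k))
      (solve 3 (λ G r u → G :* (G :* G) :* ((:1 :- :1 :* :1 :* (r :* u)) :* ((:1 :- :1 :* :1 :* (r :* u)) :* (:1 :- r :* u)))
        := G :* (:1 :- r :* u) :* (G :* (:1 :- r :* u) :* (G :* (:1 :- r :* u)))) refl _ (q ^ 4) (p^ k))

  -- The extra q in the denominator is due to the prefactor 1 + q: at a = 1 the first sum has 1 +
  -- q⁻¹ = (q + 1)/q in its place.
  summand₂-shape : ∀ k {H E H₀ G M} →
    H ~ (q + 1# * p^ k , q) → E ~ (pochhammer (q * q) 1# k , (q * q) ^ k) →
    H₀ ~ (1# + q , 1#) → G ~ (pochhammer 1# (q ^ 4) k , 1# ^ k) → M ~ (q ^ (7 ℕ.* k) , 1#) →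
    (H ⊗ (E ⊗ (E ⊗ (E ⊗ 𝟙)))) ⊘ (H₀ ⊗ (G ⊗ (G ⊗ (G ⊗ 𝟙)))) ⊗ M ~
    (S₁.numerator k , q * (q + 1#) * S₁.denominator k)
  summand₂-shape k hH hE hH₀ hG hM = reduce z-cancellable (reshape
    (begin
      h * (e * (e * (e * 1#))) * (1# * (1# ^ k * (1# ^ k * (1# ^ k * 1#)))) * q ^ (7 ℕ.* k)
        ≈⟨ *-cong (*-congˡ (*-congˡ (*-cong (1^ k) (*-cong (1^ k) (*-congʳ (1^ k)))))) (trans (^-* q 7 k) (q⁷^ k)) ⟩
      h * (e * (e * (e * 1#))) * (1# * (1# * (1# * (1# * 1#)))) * (q ^ k * (Q * (Q * Q)))
        ≈⟨ solve 4 (λ h e u Q → h :* (e :* (e :* (e :* :1))) :* (:1 :* (:1 :* (:1 :* (:1 :* :1)))) :* (u :* (Q :* (Q :* Q)))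
             := Q :* (Q :* Q) :* (h :* (:1 :* u) :* (e :* (e :* e)))) refl h e (q ^ k) Q ⟩
      z * (h * (1# * q ^ k) * (e * (e * e)))
        ≈⟨ *-congˡ (*-cong (*-congˡ (trans (^-distrib-* 1# q k) (*-congʳ (1^ k)))) (*-congʳ (S₁-falling k))) ⟨
      z * S₁.numerator k ∎)
    (begin
      q * (Q * (Q * (Q * 1#))) * ((1# + q) * (g * (g * (g * 1#)))) * 1#
        ≈⟨ solve 3 (λ q Q g → q :* (Q :* (Q :* (Q :* :1))) :* ((:1 :+ q) :* (g :* (g :* (g :* :1)))) :* :1
             := Q :* (Q :* Q) :* (q :* (q :+ :1) :* (g :* (g :* g)))) refl q Q g ⟩
      z * (q * (q + 1#) * (g * (g * g)))
        ≈⟨ *-congˡ (*-congˡ (S₁-denominator k)) ⟨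
      z * (q * (q + 1#) * S₁.denominator k) ∎)
    (⊗-cong (⊘-cong (⊗-cong hH (cube hE)) (⊗-cong hH₀ (cube hG))) hM))
    where
    cube : ∀ {x y} → x ~ y → x ⊗ (x ⊗ (x ⊗ 𝟙)) ~ y ⊗ (y ⊗ (y ⊗ 𝟙))
    cube h = ⊗-cong h (⊗-cong h (⊗-cong h ~-refl))
    h e Q g z : A
    h = q + 1# * p^ k
    e = pochhammer (q * q) 1# k
    Q = (q * q) ^ k
    g = pochhammer 1# (q ^ 4) k
    z = Q * (Q * Q)
    Q-cancellable : Cancellable Q
    Q-cancellable = reg-^ k (reg-* q-cancellable q-cancellable)
    z-cancellable : Cancellable z
    z-cancellable = reg-* Q-cancellable (reg-* Q-cancellable Q-cancellable)

  sum-step : ∀ {F f S x w y} z → Cancellable (w * y) →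
    F ~ (S , w * y) → f ~ (x , w * (y * z)) → F ⊕ f ~ (S * z + x , w * (y * z))
  sum-step {F} {f} {S} {x} {w} {y} z r hF hf = reduce r (reshape
    (solve 5 (λ S w y z x → S :* (w :* (y :* z)) :+ x :* (w :* y) := w :* y :* (S :* z :+ x)) refl S w y z x)
    refl (⊕-cong hF hf))

-- The two sums as single fractions

module Sums where
  open Divisibility polyRing
  open PolynomialRing polynomials using (q; a; b; c)
  open ReducedSum polynomials
  open Shapes polynomials
  open Fractions polyRing

  monF-shape : ∀ i j k l {n d} →
    q ^ posPart i * a ^ posPart j * b ^ posPart k * c ^ posPart l ≈ n →
    q ^ negPart i * a ^ negPart j * b ^ negPart k * c ^ negPart l ≈ d →
    monF i j k l ~ (n , d)
  monF-shape i j k l e f = ~-components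
    (trans (monomial≋ (posPart i) (posPart j) (posPart k) (posPart l)) e)
    (trans (monomial≋ (negPart i) (negPart j) (negPart k) (negPart l)) f)

  q⁴-shape : q⁴ ~ (q ^ 4 , 1#)
  q⁴-shape = monF-shape (+ 4) 0ℤ 0ℤ 0ℤ
    (solve 1 (λ x → x :* :1 :* :1 :* :1 := x) refl (q ^ 4))
    (equal λ _ → ≡.refl)

  q⁴^-shape : ∀ k → q⁴ ^F k ~ (p^ k , 1#)
  q⁴^-shape zero = ~-refl
  q⁴^-shape (suc k) = reshape refl (*-identityˡ 1#) (⊗-cong q⁴-shape (q⁴^-shape k))

  poch-shape : ∀ {x y d} → x ~ (y , d) → ∀ k → poch x q⁴ k ~ (pochhammer d y k , d ^ k)
  poch-shape h zero = ~-refl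
  poch-shape h (suc k) = pochhammer-step {k} h (q⁴^-shape k) (poch-shape h k)

  drop-units : ∀ x → x * 1# * 1# * 1# ≈ x
  drop-units x = solve 1 (λ x → x :* :1 :* :1 :* :1 := x) refl x

  prefactor-shape : ∀ {j} z → monF (ℤ.- 1ℤ) j 0ℤ 0ℤ ~ (z , q) → (∀ e → monF (+ e) j 0ℤ 0ℤ ~ (q ^ e * z , 1#)) →
    ∀ k → 1F +F monF (+ (4 ℕ.* k) ℤ.- 1ℤ) j 0ℤ 0ℤ ~ (q + z * p^ k , q)
  prefactor-shape z h₀ h₁ zero = prefactor-zero {_} {z} h₀
  -- The integer 4(k + 1) - 1 computes to the natural number k + 3(k + 1), so the required equation
  -- of exponents is `refl`.
  prefactor-shape z h₀ h₁ (suc k) = prefactor-suc {_} {z} k _ ≡.refl (h₁ (k ℕ.+ 3 ℕ.* suc k))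

  power-shape : ∀ {x y d} → x ~ (y , d) → ∀ k → x ^F k ~ (y ^ k , d ^ k)
  power-shape h zero = ~-refl
  power-shape h (suc k) = ⊗-cong h (power-shape h k)

  summand₁~ : ∀ k → summand₁ k ~ (numerator k , (q + a) * denominator k)
  summand₁~ k = summand₁-shape k
    (prefactor-shape {1ℤ} a
    (monF-shape (ℤ.- 1ℤ) 1ℤ 0ℤ 0ℤ
      (solve 1 (λ a → :1 :* (a :* :1) :* :1 :* :1 := a) refl a)
      (solve 1 (λ q → (q :* :1) :* :1 :* :1 :* :1 := q) refl q))
    (λ e → monF-shape (+ e) 1ℤ 0ℤ 0ℤ
      (solve 2 (λ x a → x :* (a :* :1) :* :1 :* :1 := x :* a) refl (q ^ e) a)
      (equal λ _ → ≡.refl)) k)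
    (poch-shape (monF-shape (ℤ.- + 2) (+ 2) 0ℤ 0ℤ
      (solve 1 (λ a → :1 :* (a :* (a :* :1)) :* :1 :* :1 := a :* a) refl a)
      (solve 1 (λ q → q :* (q :* :1) :* :1 :* :1 :* :1 := q :* q) refl q)) k)
    (poch-shape (monF-shape (ℤ.- + 2) 0ℤ 1ℤ 0ℤ
      (solve 1 (λ b → :1 :* :1 :* (b :* :1) :* :1 := b) refl b)
      (solve 1 (λ q → q :* (q :* :1) :* :1 :* :1 :* :1 := q :* q) refl q)) k)
    (poch-shape (monF-shape (ℤ.- + 2) 0ℤ 0ℤ 1ℤ
      (solve 1 (λ c → :1 :* :1 :* :1 :* (c :* :1) := c) refl c)
      (solve 1 (λ q → q :* (q :* :1) :* :1 :* :1 :* :1 := q :* q) refl q)) k)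
    (reshape (solve 2 (λ q a → :1 :* q :+ a :* :1 := q :+ a) refl q a) (*-identityˡ q)
      (⊕-cong {1F} ~-refl (monF-shape (ℤ.- 1ℤ) 1ℤ 0ℤ 0ℤ
        (solve 1 (λ a → :1 :* (a :* :1) :* :1 :* :1 := a) refl a)
        (solve 1 (λ q → (q :* :1) :* :1 :* :1 :* :1 := q) refl q))))
    (poch-shape (monF-shape (+ 4) (+ 2) (ℤ.- 1ℤ) 0ℤ
      (solve 2 (λ q a → q :* (a :* (a :* :1)) :* :1 :* :1 := a :* a :* q) refl (q ^ 4) a)
      (solve 1 (λ b → :1 :* :1 :* (b :* :1) :* :1 := b) refl b)) k)
    (poch-shape (monF-shape (+ 4) (+ 2) 0ℤ (ℤ.- 1ℤ)
      (solve 2 (λ q a → q :* (a :* (a :* :1)) :* :1 :* :1 := a :* a :* q) refl (q ^ 4) a)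
      (solve 1 (λ c → :1 :* :1 :* :1 :* (c :* :1) := c) refl c)) k)
    (poch-shape q⁴-shape k)
    (power-shape (monF-shape (+ 7) 1ℤ (ℤ.- 1ℤ) (ℤ.- 1ℤ)
      (solve 2 (λ q a → q :* (a :* :1) :* :1 :* :1 := q :* a) refl (q ^ 7) a)
      (solve 2 (λ b c → :1 :* :1 :* (b :* :1) :* (c :* :1) := b :* c) refl b c)) k)

  summand₂~ : ∀ k → summand₂ k ~ (S₁.numerator k , q * (q + 1#) * S₁.denominator k)
  summand₂~ k = summand₂-shape k
    (prefactor-shape {0ℤ} 1#
    (monF-shape (ℤ.- 1ℤ) 0ℤ 0ℤ 0ℤ {1#} (equal λ _ → ≡.refl)
      (solve 1 (λ q → (q :* :1) :* :1 :* :1 :* :1 := q) refl q))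
    (λ e → monF-shape (+ e) 0ℤ 0ℤ 0ℤ
      (solve 1 (λ x → x :* :1 :* :1 :* :1 := x :* :1) refl (q ^ e))
      (equal λ _ → ≡.refl)) k)
    (poch-shape (monF-shape (ℤ.- + 2) 0ℤ 0ℤ 0ℤ {1#} (equal λ _ → ≡.refl)
      (solve 1 (λ q → q :* (q :* :1) :* :1 :* :1 :* :1 := q :* q) refl q)) k)
    (reshape (solve 1 (λ q → :1 :* :1 :+ q :* :1 := :1 :+ q) refl q) (*-identityˡ 1#)
      (⊕-cong {1F} ~-refl (monF-shape 1ℤ 0ℤ 0ℤ 0ℤ {q} {1#}
        (solve 1 (λ q → (q :* :1) :* :1 :* :1 :* :1 := q) refl q) (equal λ _ → ≡.refl))))
    (poch-shape q⁴-shape k)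
    (monF-shape (+ (7 ℕ.* k)) 0ℤ 0ℤ 0ℤ (drop-units (q ^ (7 ℕ.* k))) (equal λ _ → ≡.refl))

  sum₁~ : ∀ n → sumF n summand₁ ~ (partialSum n , (q + a) * denominator n)
  sum₁~ zero = summand₁~ zero
  sum₁~ (suc n) = sum-step {w = q + a} {denominator n} (step (suc n)) (reg-* q+a-cancellable (denominator-cancellable n)) (sum₁~ n) (summand₁~ (suc n))

  sum₂~ : (∀ n → Cancellable (q * (q + 1#) * S₁.denominator n)) →
          ∀ n → sumF n summand₂ ~ (S₁.partialSum n , q * (q + 1#) * S₁.denominator n)
  sum₂~ r zero = summand₂~ zero
  sum₂~ r (suc n) = sum-step {w = q * (q + 1#)} {S₁.denominator n} (S₁.step (suc n)) (r n) (sum₂~ r n) (summand₂~ (suc n))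

-- Greatest common divisors in ℤ[q]

module Reduction (X : PolynomialRing) where
  open PolynomialRing X
  open Values
  open Relation.Binary.Reasoning.Setoid setoid
  private
    module Vq = Variable var-q

  -- leading coefficient first
  valueᴮ : List ℤ → A
  valueᴮ [] = 0#
  valueᴮ (c ∷ l) = int c * q ^ length l + valueᴮ l

  value-∷ʳ : ∀ l c → value (l ∷ʳ c) ≈ int c * q ^ length l + value l
  value-∷ʳ [] c = solve 2 (λ c q → c :+ q :* :0 := c :* :1 :+ :0) refl (int c) q
  value-∷ʳ (x ∷ l) c = trans (+-congˡ (*-congˡ (value-∷ʳ l c)))
    (solve 5 (λ x q c y l → x :+ q :* (c :* y :+ l) := c :* (q :* y) :+ (x :+ q :* l)) refl
      (int x) q (int c) (q ^ length l) (value l))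

  value-reverse : ∀ l → value (reverse l) ≈ valueᴮ l
  value-reverse [] = refl
  value-reverse (c ∷ l) = begin
    value (reverse (c ∷ l)) ≡⟨ ≡.cong value (ListP.unfold-reverse c l) ⟩
    value (reverse l ∷ʳ c) ≈⟨ value-∷ʳ (reverse l) c ⟩
    int c * q ^ length (reverse l) + value (reverse l) ≡⟨ ≡.cong (λ n → int c * q ^ n + value (reverse l)) (ListP.length-reverse l) ⟩
    int c * q ^ length l + value (reverse l) ≈⟨ +-congˡ (value-reverse l) ⟩
    int c * q ^ length l + valueᴮ l ∎

  valueᴮ-reverse : ∀ l → valueᴮ (reverse l) ≈ value l
  valueᴮ-reverse l = begin
    valueᴮ (reverse l) ≈⟨ value-reverse (reverse l) ⟨
    value (reverse (reverse l)) ≡⟨ ≡.cong value (ListP.reverse-involutive l) ⟩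
    value l ∎

  valueᴮ-map : ∀ d f → valueᴮ (map (d ℤ.*_) f) ≈ int d * valueᴮ f
  valueᴮ-map d [] = sym (zeroʳ _)
  valueᴮ-map d (x ∷ f) = begin
    int (d ℤ.* x) * q ^ length (map (d ℤ.*_) f) + valueᴮ (map (d ℤ.*_) f)
      ≈⟨ +-cong (*-cong (int-* d x) (reflexive (≡.cong (q ^_) (ListP.length-map (d ℤ.*_) f)))) (valueᴮ-map d f) ⟩
    int d * int x * q ^ length f + int d * valueᴮ f
      ≈⟨ solve 4 (λ d x y z → d :* x :* y :+ d :* z := d :* (x :* y :+ z)) refl _ _ _ _ ⟩
    int d * (int x * q ^ length f + valueᴮ f) ∎

  -- d f - c qᵏ g, where k is the difference of the lengths
  combine : ℤ → ℤ → List ℤ → List ℤ → List ℤ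
  combine d c f [] = map (d ℤ.*_) f
  combine d c (x ∷ f) (y ∷ g) = d ℤ.* x ℤ.- c ℤ.* y ∷ combine d c f g
  combine d c [] (y ∷ g) = []

  length-combine : ∀ d c f g → length (combine d c f g) ≡ length f
  length-combine d c (x ∷ f) (y ∷ g) = ≡.cong suc (length-combine d c f g)
  length-combine d c f [] = ListP.length-map (d ℤ.*_) f
  length-combine d c [] (y ∷ g) = ≡.refl

  valueᴮ-combine : ∀ d c f g k → length f ≡ k ℕ.+ length g →
    valueᴮ (combine d c f g) ≈ int d * valueᴮ f - int c * q ^ k * valueᴮ g
  valueᴮ-combine d c f [] k h = trans (valueᴮ-map d f) (solve 3 (λ x y z → x :* z := x :* z :- y :* :0) refl _ _ _)
  valueᴮ-combine d c [] (y ∷ g) k h with () ← ≡.trans h (ℕP.+-suc k (length g))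
  valueᴮ-combine d c (x ∷ f) (y ∷ g) k h = begin
    int (d ℤ.* x ℤ.- c ℤ.* y) * q ^ length (combine d c f g) + valueᴮ (combine d c f g)
      ≈⟨ +-cong (*-cong head (reflexive (≡.cong (q ^_) (≡.trans (length-combine d c f g) h′)))) (valueᴮ-combine d c f g k h′) ⟩
    (int d * int x - int c * int y) * q ^ (k ℕ.+ length g) + (int d * valueᴮ f - int c * q ^ k * valueᴮ g)
      ≈⟨ +-congʳ (*-congˡ (^-+ q k (length g))) ⟩
    (int d * int x - int c * int y) * (q ^ k * q ^ length g) + (int d * valueᴮ f - int c * q ^ k * valueᴮ g)
      ≈⟨ solve 8 (λ d x c y u v F G → (d :* x :- c :* y) :* (u :* v) :+ (d :* F :- c :* u :* G)
           := d :* (x :* (u :* v) :+ F) :- c :* u :* (y :* v :+ G)) refl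
           (int d) (int x) (int c) (int y) (q ^ k) (q ^ length g) (valueᴮ f) (valueᴮ g) ⟩
    int d * (int x * (q ^ k * q ^ length g) + valueᴮ f) - int c * q ^ k * (int y * q ^ length g + valueᴮ g)
      ≈⟨ +-congʳ (*-congˡ (+-congʳ (*-congˡ (trans (reflexive (≡.cong (q ^_) h′)) (^-+ q k (length g)))))) ⟨
    int d * (int x * q ^ length f + valueᴮ f) - int c * q ^ k * (int y * q ^ length g + valueᴮ g) ∎
    where
    h′ : length f ≡ k ℕ.+ length g
    h′ = ℕP.suc-injective (≡.trans h (ℕP.+-suc k (length g)))
    head : int (d ℤ.* x ℤ.- c ℤ.* y) ≈ int d * int x - int c * int y
    head = trans (int-+ (d ℤ.* x) (ℤ.- (c ℤ.* y))) (+-cong (int-* d x) (trans (int-neg (c ℤ.* y)) (-‿cong (int-* c y))))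

  -- A gcd over ℚ with denominators cleared. Pseudo-division keeps `h` in the ideal of `F` and `G`,
  -- but `h` divides them only after multiplication by a non-zero integer `m`.
  record RationalGcd (F G : A) : Set where
    field
      h : List ℤ
      u v : A
      m : ℤ
      m≢0 : m ≢ 0ℤ
      h∣F : value h ∣ int m * F
      h∣G : value h ∣ int m * G
      combination : value h ≈ u * F + v * G

  swap : ∀ {F G} → RationalGcd F G → RationalGcd G F
  swap r = record
    { h = h ; u = v ; v = u ; m = m ; m≢0 = m≢0 ; h∣F = h∣G ; h∣G = h∣F
    ; combination = trans combination (+-comm _ _) }
    where open RationalGcd r

  transport : ∀ {F F′ G} → F ≈ F′ → RationalGcd F G → RationalGcd F′ G
  transport e r = record
    { h = h ; u = u ; v = v ; m = m ; m≢0 = m≢0 ; h∣F = ∣-respʳ (*-congˡ e) h∣F ; h∣G = h∣G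
    ; combination = trans combination (+-congʳ (*-congˡ e)) }
    where open RationalGcd r

  with-zero : ∀ f → RationalGcd (valueᴮ f) 0#
  with-zero f = record
    { h = reverse f ; u = 1# ; v = 0# ; m = 1ℤ ; m≢0 = λ ()
    ; h∣F = ∣-respʳ (trans (value-reverse f) (sym (*-identityˡ _))) ∣-refl
    ; h∣G = ∣-respʳ (sym (zeroʳ _)) ∣0
    ; combination = trans (value-reverse f) (solve 1 (λ x → x := :1 :* x :+ :0 :* :0) refl _) }

  ℤ-*≢0 : ∀ {x y} → x ≢ 0ℤ → y ≢ 0ℤ → x ℤ.* y ≢ 0ℤ
  ℤ-*≢0 {x} hx hy e with ℤP.i*j≡0⇒i≡0∨j≡0 x e
  ... | inj₁ p = hx p
  ... | inj₂ p = hy p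

  pseudo-step : ∀ {F F′ G} d e → d ≢ 0ℤ → F′ ≈ int d * F - e * G → RationalGcd F′ G → RationalGcd F G
  pseudo-step {F} {F′} {G} d e d≢0 eq r = record
    { h = h ; u = u * int d ; v = v - u * e ; m = m ℤ.* d ; m≢0 = ℤ-*≢0 m≢0 d≢0
    ; h∣F = ∣-respʳ (begin
        int m * F′ + e * (int m * G) ≈⟨ +-congʳ (*-congˡ eq) ⟩
        int m * (int d * F - e * G) + e * (int m * G) ≈⟨ solve 5 (λ m d F e G → m :* (d :* F :- e :* G) :+ e :* (m :* G) := m :* d :* F) refl _ _ _ _ _ ⟩
        int m * int d * F ≈⟨ *-congʳ (int-* m d) ⟨
        int (m ℤ.* d) * F ∎) (∣+ h∣F (∣*ˡ e h∣G))
    ; h∣G = ∣-respʳ (trans (solve 3 (λ m d G → d :* (m :* G) := m :* d :* G) refl _ _ _) (*-congʳ (sym (int-* m d)))) (∣*ˡ (int d) h∣G)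
    ; combination = begin
        value h ≈⟨ combination ⟩
        u * F′ + v * G ≈⟨ +-congʳ (*-congˡ eq) ⟩
        u * (int d * F - e * G) + v * G ≈⟨ solve 6 (λ u d F e G v → u :* (d :* F :- e :* G) :+ v :* G := u :* d :* F :+ (v :- u :* e) :* G) refl _ _ _ _ _ _ ⟩
        u * int d * F + (v - u * e) * G ∎ }
    where open RationalGcd r

  drop-zero : ∀ f → valueᴮ f ≈ valueᴮ (0ℤ ∷ f)
  drop-zero f = solve 2 (λ x y → y := :0 :* x :+ y) refl _ _

  -- Lists may begin with zeros, so the recursion is on the total length and not on degrees. A
  -- leading zero is dropped; otherwise a pseudo-division step eliminates the leading entry of the
  -- longer list. Either way one entry disappears.
  euclid : ∀ n f g → length f ℕ.+ length g ℕ.≤ n → RationalGcd (valueᴮ f) (valueᴮ g)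
  euclid-longer : ∀ n c f d g → suc (length f ℕ.+ length g) ℕ.≤ n → d ≢ 0ℤ → length g ℕ.≤ length f →
                  RationalGcd (valueᴮ (c ∷ f)) (valueᴮ (d ∷ g))

  euclid n f [] l = with-zero f
  euclid n [] (d ∷ g) l = swap (with-zero (d ∷ g))
  euclid (suc n) (c ∷ f) (d ∷ g) (ℕ.s≤s l) with c ℤP.≟ 0ℤ | d ℤP.≟ 0ℤ | ℕP.≤-total (length g) (length f)
  ... | yes ≡.refl | _ | _ = transport (drop-zero f) (euclid n f (d ∷ g) l)
  ... | no c≢0 | yes ≡.refl | _ = swap (transport (drop-zero g) (swap (euclid n (c ∷ f) g
          (ℕP.≤-trans (ℕP.≤-reflexive (≡.sym (ℕP.+-suc (length f) (length g)))) l))))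
  ... | no c≢0 | no d≢0 | inj₁ g≤f = euclid-longer n c f d g
          (ℕP.≤-trans (ℕP.≤-reflexive (≡.sym (ℕP.+-suc (length f) (length g)))) l) d≢0 g≤f
  ... | no c≢0 | no d≢0 | inj₂ f≤g = swap (euclid-longer n d g c f
          (ℕP.≤-trans (ℕP.≤-reflexive (≡.trans (≡.cong suc (ℕP.+-comm (length g) (length f))) (≡.sym (ℕP.+-suc (length f) (length g))))) l) c≢0 f≤g)

  euclid-longer n c f d g l d≢0 g≤f with ℕP.m≤n⇒∃[o]m+o≡n g≤f
  ... | k , h = pseudo-step d (int c * q ^ k) d≢0 eliminate (euclid n (combine d c f g) (d ∷ g)
          (ℕP.≤-trans (ℕP.≤-reflexive (≡.trans (≡.cong (ℕ._+ suc (length g)) (length-combine d c f g)) (ℕP.+-suc (length f) (length g)))) l))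
    where
    h′ : length f ≡ k ℕ.+ length g
    h′ = ≡.trans (≡.sym h) (ℕP.+-comm (length g) k)
    eliminate : valueᴮ (combine d c f g) ≈ int d * valueᴮ (c ∷ f) - int c * q ^ k * valueᴮ (d ∷ g)
    eliminate = begin
      valueᴮ (combine d c f g)
        ≈⟨ valueᴮ-combine d c f g k h′ ⟩
      int d * valueᴮ f - int c * q ^ k * valueᴮ g
        ≈⟨ solve 6 (λ d F c u v G → d :* F :- c :* u :* G := d :* (c :* (u :* v) :+ F) :- c :* u :* (d :* v :+ G)) refl _ _ _ _ (q ^ length g) _ ⟩
      int d * (int c * (q ^ k * q ^ length g) + valueᴮ f) - int c * q ^ k * (int d * q ^ length g + valueᴮ g)
        ≈⟨ +-congʳ (*-congˡ (+-congʳ (*-congˡ (trans (reflexive (≡.cong (q ^_) h′)) (^-+ q k (length g)))))) ⟨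
      int d * valueᴮ (c ∷ f) - int c * q ^ k * valueᴮ (d ∷ g) ∎

  int-∣∣ : ∀ {g y} x → g ∣ int x * y → g ∣ int (+ ∣ x ∣) * y
  int-∣∣ (+ n) d = d
  int-∣∣ -[1+ n ] d = ∣-respʳ (solve 2 (λ x y → :- (:- x :* y) := x :* y) refl _ _) (∣-neg d)

  value-cons-at-0 : ∀ c l → Vq.⟦ value (c ∷ l) ⟧ ≈ int c
  value-cons-at-0 c l = begin
    Vq.⟦ int c + q * value l ⟧ ≈⟨ ⟦+⟧₂ (Endo.⟦int⟧ Vq.endo c) (⟦*⟧₂ Vq.⟦x⟧ refl) ⟩
    int c + 0# * Vq.⟦ value l ⟧ ≈⟨ solve 2 (λ x y → x :+ :0 :* y := x) refl _ _ ⟩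
    int c ∎
    where open Naturality R Vq.endo

  int-bezout : ∀ x y m n → 1 ℕ.+ y ℕ.* n ≡ x ℕ.* m → 1# + int (+ y) * int (+ n) ≈ int (+ x) * int (+ m)
  int-bezout x y m n eq = begin
    1# + int (+ y) * int (+ n) ≈⟨ +-congˡ (int-* (+ y) (+ n)) ⟨
    1# + int (+ y ℤ.* + n) ≈⟨ int-+ 1ℤ (+ y ℤ.* + n) ⟨
    int (1ℤ ℤ.+ + y ℤ.* + n) ≡⟨ ≡.cong (λ z → int (1ℤ ℤ.+ z)) (ℤP.pos-* y n) ⟨
    int (+ (1 ℕ.+ y ℕ.* n)) ≡⟨ ≡.cong (λ z → int (+ z)) eq ⟩
    int (+ (x ℕ.* m)) ≡⟨ ≡.cong int (ℤP.pos-* x m) ⟩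
    int (+ x ℤ.* + m) ≈⟨ int-* (+ x) (+ m) ⟩
    int (+ x) * int (+ m) ∎

  -- Bézout's identity provides an inverse of `n` modulo `p`, in one of two sign patterns.
  coprime⇒reg : ∀ {p n} → Coprime p n → Reg (int (+ p)) (int (+ n))
  coprime⇒reg {p} {n} c with coprime-Bézout c
  ... | Bézout.+- x y eq = reg-mod (- int (+ y)) (divides (- int (+ x)) (begin
      int (+ p) * - int (+ x) ≈⟨ solve 2 (λ p x → p :* (:- x) := :- (x :* p)) refl _ _ ⟩
      - (int (+ x) * int (+ p)) ≈⟨ -‿cong (int-bezout x y p n eq) ⟨
      - (1# + int (+ y) * int (+ n)) ≈⟨ solve 2 (λ y n → :- (:1 :+ y :* n) := n :* (:- y) :- :1) refl _ _ ⟩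
      int (+ n) * - int (+ y) - 1# ∎)) reg-1
  ... | Bézout.-+ x y eq = reg-mod (int (+ y)) (divides (int (+ x)) (begin
      int (+ p) * int (+ x) ≈⟨ solve 2 (λ p x → p :* x := :1 :+ x :* p :- :1) refl _ _ ⟩
      1# + int (+ x) * int (+ p) - 1# ≈⟨ +-congʳ (int-bezout y x n p eq) ⟩
      int (+ y) * int (+ n) - 1# ≈⟨ +-congʳ (*-comm _ _) ⟩
      int (+ n) * int (+ y) - 1# ∎)) reg-1

  prime-∤⇒coprime : ∀ {p n} → Prime p → ¬ (p ℕD.∣ n) → Coprime p n
  prime-∤⇒coprime pr p∤n {d} (d∣p , d∣n) with prime⇒irreducible pr d∣p
  ... | inj₁ d≡1 = d≡1
  ... | inj₂ ≡.refl = contradiction d∣n p∤n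

  reg-int : ∀ {p} c → Prime p → ¬ (p ℕD.∣ ∣ c ∣) → Reg (int (+ p)) (int c)
  reg-int (+ n) pr h = coprime⇒reg (prime-∤⇒coprime pr h)
  reg-int -[1+ n ] pr h = reg-neg (coprime⇒reg (prime-∤⇒coprime pr h))

  -- Gauss's lemma
  prime-dichotomy : ∀ {p} → Prime p → ∀ l →
    (∃ λ l′ → value l ≈ int (+ p) * value l′) ⊎ Reg (int (+ p)) (value l)
  prime-dichotomy pr [] = inj₁ ([] , sym (zeroʳ _))
  prime-dichotomy {p} pr (c ∷ l) with p ℕD.∣? ∣ c ∣
  ... | no p∤c = inj₂ (Vq.reg-lowest (Endo.⟦int⟧ Vq.endo (+ p))
          (reg-resp (sym (value-cons-at-0 c l)) (reg-int c pr p∤c)))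
  ... | yes p∣c with ℤD.∣ᵤ⇒∣ {+ p} {c} p∣c
  ... | ℤD.divides c′ eq with prime-dichotomy pr l
  ...   | inj₁ (l′ , e) = inj₁ (c′ ∷ l′ , (begin
            int c + q * value l ≈⟨ +-cong intc (*-congˡ e) ⟩
            int c′ * int (+ p) + q * (int (+ p) * value l′) ≈⟨ solve 4 (λ c p q l → c :* p :+ q :* (p :* l) := p :* (c :+ q :* l)) refl _ _ _ _ ⟩
            int (+ p) * (int c′ + q * value l′) ∎))
    where
    intc : int c ≈ int c′ * int (+ p)
    intc = trans (reflexive (≡.cong int eq)) (int-* c′ (+ p))
  -- As `p` divides the constant coefficient, the polynomial is q times its remaining part modulo
  -- `p`, and both of these factors are regular.
  ...   | inj₂ r = inj₂ (reg-mod 1# (divides (int c′) (begin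
            int (+ p) * int c′ ≈⟨ *-comm _ _ ⟩
            int c′ * int (+ p) ≈⟨ intc ⟨
            int c ≈⟨ solve 2 (λ c x → c := (c :+ x) :* :1 :- x) refl _ _ ⟩
            (int c + q * value l) * 1# - q * value l ∎))
          (reg-* (Vq.reg-x (Endo.⟦int⟧ Vq.endo (+ p))) r))
    where
    intc : int c ≈ int c′ * int (+ p)
    intc = trans (reflexive (≡.cong int eq)) (int-* c′ (+ p))

  prime-cancellable : ∀ {p} → Prime p → Cancellable (int (+ p))
  prime-cancellable {suc p} pr = int-cancellable {+ suc p} λ ()
  prime-cancellable {zero} pr with () ← ℕ.NonZero.nonZero (prime⇒nonZero pr)

  prime≢0 : ∀ {p} → Prime p → + p ≢ 0ℤ
  prime≢0 {suc p} pr ()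
  prime≢0 {zero} pr _ with () ← ℕ.NonZero.nonZero (prime⇒nonZero pr)

  -- Compared with `RationalGcd` the integer has changed sides: `h` divides `F` and `G` exactly, and
  -- only its multiple by `k` is claimed to lie in the ideal.
  record IntegralGcd (F G : A) : Set where
    field
      h u v N D : A
      k : ℤ
      k≢0 : k ≢ 0ℤ
      F≈ : h * N ≈ F
      G≈ : h * D ≈ G
      combination : int k * h ≈ u * F + v * G

  int-product : ∀ p m y → int (+ (p ℕ.* m)) * y ≈ int (+ p) * (int (+ m) * y)
  int-product p m y = trans (*-congʳ (trans (reflexive (≡.cong int (ℤP.pos-* p m))) (int-* (+ p) (+ m)))) (*-assoc _ _ _)

  clear-primes : ∀ {F G} ps → All Prime ps → ∀ l {u v} k → k ≢ 0ℤ → int k * value l ≈ u * F + v * G →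
    value l ∣ int (+ ℕL.product ps) * F → value l ∣ int (+ ℕL.product ps) * G → IntegralGcd F G
  clear-primes [] [] l k k≢0 comb dF dG = record
    { h = value l ; k = k ; k≢0 = k≢0 ; combination = comb
    ; F≈ = trans (_∣_.equality dF) (*-identityˡ _) ; G≈ = trans (_∣_.equality dG) (*-identityˡ _) }
  clear-primes {F} {G} (p ∷ ps) (pr ∷ prs) l {u} {v} k k≢0 comb dF dG with prime-dichotomy pr l
  ... | inj₁ (l′ , e) = clear-primes ps prs l′ {u} {v} (k ℤ.* + p) (ℤ-*≢0 k≢0 (prime≢0 pr))
          (begin
            int (k ℤ.* + p) * value l′ ≈⟨ *-congʳ (int-* k (+ p)) ⟩
            int k * int (+ p) * value l′ ≈⟨ *-assoc _ _ _ ⟩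
            int k * (int (+ p) * value l′) ≈⟨ *-congˡ e ⟨
            int k * value l ≈⟨ comb ⟩
            u * F + v * G ∎)
          (clear F dF) (clear G dG)
    where
    clear : ∀ Y → value l ∣ int (+ (p ℕ.* ℕL.product ps)) * Y → value l′ ∣ int (+ ℕL.product ps) * Y
    clear Y d = cancel-∣ (prime-cancellable pr) (∣-respˡ e (∣-respʳ (int-product p (ℕL.product ps) Y) d))
  ... | inj₂ r = clear-primes ps prs l {u} {v} k k≢0 comb (clear F dF) (clear G dG)
    where
    clear : ∀ Y → value l ∣ int (+ (p ℕ.* ℕL.product ps)) * Y → value l ∣ int (+ ℕL.product ps) * Y
    clear Y d = drop-factor _ (prime-cancellable pr) r ∣-refl (∣-respʳ (int-product p (ℕL.product ps) Y) d)

  prime-factors : ∀ m → m ≢ 0ℤ → PrimeFactorisation ∣ m ∣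
  prime-factors (+ zero) h = contradiction ≡.refl h
  prime-factors (+ suc n) h = factorise (suc n)
  prime-factors -[1+ n ] h = factorise (suc n)

  integral : ∀ {F G} → RationalGcd F G → IntegralGcd F G
  integral {F} {G} r = clear-primes factors factorsPrime h {u} {v} 1ℤ (λ ()) (trans (*-identityˡ _) combination)
      (rewrite-product h∣F) (rewrite-product h∣G)
    where
    open RationalGcd r
    open PrimeFactorisation (prime-factors m m≢0)
    rewrite-product : ∀ {Y} → value h ∣ int m * Y → value h ∣ int (+ ℕL.product factors) * Y
    rewrite-product {Y} d = ≡.subst (λ n → value h ∣ int (+ n) * Y) isFactorisation (int-∣∣ m d)

  record Reduced (F G : A) : Set where
    field
      h N D : A
      F≈ : h * N ≈ F
      G≈ : h * D ≈ G
      coprime : ∀ g → g ∣ N → g ∣ D → g ∣ 1#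

  reduced : ∀ f g → Cancellable (value g) → (∀ {p} → Prime p → Reg (int (+ p)) (value g)) → Reduced (value f) (value g)
  reduced f g g-cancellable g-primitive = record { h = h ; N = N ; D = D ; F≈ = F≈ ; G≈ = G≈ ; coprime = coprime }
    where
    rational : RationalGcd (value f) (value g)
    rational = transport (valueᴮ-reverse f) (swap (transport (valueᴮ-reverse g) (swap (euclid _ (reverse f) (reverse g) ℕP.≤-refl))))
    open IntegralGcd (integral rational)
    open PrimeFactorisation (prime-factors k k≢0)
    h-cancellable : Cancellable h
    h-cancellable = reg-factor (divides D G≈) g-cancellable
    k≈ : int k ≈ u * N + v * D
    k≈ = cancel h-cancellable (begin
      h * int k ≈⟨ *-comm _ _ ⟩
      int k * h ≈⟨ combination ⟩
      u * value f + v * value g ≈⟨ +-cong (*-congˡ F≈) (*-congˡ G≈) ⟨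
      u * (h * N) + v * (h * D) ≈⟨ solve 5 (λ u h N v D → u :* (h :* N) :+ v :* (h :* D) := h :* (u :* N :+ v :* D)) refl _ _ _ _ _ ⟩
      h * (u * N + v * D) ∎)
    coprime : ∀ g → g ∣ N → g ∣ D → g ∣ 1#
    coprime g′ g∣N g∣D = go factors factorsPrime
      (≡.subst (λ n → g′ ∣ int (+ n) * 1#) isFactorisation
        (int-∣∣ k (∣-respʳ (trans (sym k≈) (sym (*-identityʳ _))) (∣+ (∣*ˡ u g∣N) (∣*ˡ v g∣D)))))
      where
      go : ∀ ps → All Prime ps → g′ ∣ int (+ ℕL.product ps) * 1# → g′ ∣ 1#
      go [] [] d = ∣-respʳ (*-identityˡ 1#) d
      go (p ∷ ps) (pr ∷ prs) d = go ps prs (drop-factor _ (prime-cancellable pr)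
        (reg-factor (divides h (trans (*-comm _ _) G≈)) (g-primitive pr)) g∣D
        (∣-respʳ (int-product p (ℕL.product ps) 1#) d))

-- Cyclotomic polynomials

uadd-[] : ∀ p → uadd p [] ≡ p
uadd-[] [] = ≡.refl
uadd-[] (x ∷ p) = ≡.refl

uadd-∷ʳ : ∀ p r c → length p ℕ.≤ length r → uadd p (r ∷ʳ c) ≡ uadd p r ∷ʳ c
uadd-∷ʳ [] r c _ = ≡.refl
uadd-∷ʳ (x ∷ p) (y ∷ r) c (ℕ.s≤s h) = ≡.cong (x ℤ.+ y ∷_) (uadd-∷ʳ p r c h)

length-uadd : ∀ p r → length p ℕ.≤ length r → length (uadd p r) ≡ length r
length-uadd [] r _ = ≡.refl
length-uadd (x ∷ p) (y ∷ r) (ℕ.s≤s h) = ≡.cong suc (length-uadd p r h)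

-- A property of the list, not of its value: `udiv` takes the last entry for the leading
-- coefficient, so trailing zeros must be excluded.
record Monic (n : ℕ) (l : UPoly) : Set where
  constructor monic
  field
    lower : UPoly
    length-lower : length lower ≡ n
    shape : l ≡ lower ∷ʳ 1ℤ

  reversed : reverse l ≡ 1ℤ ∷ reverse lower
  reversed = ≡.trans (≡.cong reverse shape) (ListP.reverse-++ lower (1ℤ ∷ []))

umul-1 : ∀ j → umul (1ℤ ∷ []) (j ∷ʳ 1ℤ) ≡ j ∷ʳ 1ℤ
umul-1 [] = ≡.refl
umul-1 (x ∷ j) = ≡.cong₂ _∷_ (≡.trans (ℤP.+-identityʳ _) (ℤP.*-identityˡ x))
  (≡.trans (uadd-[] _) (≡.trans (ListP.map-cong ℤP.*-identityˡ (j ∷ʳ 1ℤ)) (ListP.map-id _)))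

monic-umul : ∀ {m n p r} → Monic m p → Monic n r → Monic (m ℕ.+ n) (umul p r)
monic-umul {n = n} {r = r} (monic i ≡.refl ≡.refl) (monic j lj ≡.refl) =
  let w , e , h = go i in monic w h e
  where
  s : UPoly
  s = j ∷ʳ 1ℤ
  length-s : length s ≡ suc n
  length-s = ≡.trans (ListP.length-++ j) (≡.trans (ℕP.+-comm (length j) 1) (≡.cong suc lj))
  go : ∀ i → ∃ λ w → umul (i ∷ʳ 1ℤ) s ≡ w ∷ʳ 1ℤ × length w ≡ length i ℕ.+ n
  go [] = j , umul-1 j , lj
  go (x ∷ i) with go i
  ... | w , e , h = uadd (map (x ℤ.*_) s) (0ℤ ∷ w)
      , ≡.trans (≡.cong (λ v → uadd (map (x ℤ.*_) s) (0ℤ ∷ v)) e) (uadd-∷ʳ (map (x ℤ.*_) s) (0ℤ ∷ w) 1ℤ short)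
      , ≡.trans (length-uadd (map (x ℤ.*_) s) (0ℤ ∷ w) short) (≡.cong suc h)
    where
    short : length (map (x ℤ.*_) s) ℕ.≤ suc (length w)
    short = ℕP.≤-trans (ℕP.≤-reflexive (≡.trans (ListP.length-map (x ℤ.*_) s) length-s))
      (ℕ.s≤s (ℕP.≤-trans (ℕP.m≤n+m n (length i)) (ℕP.≤-reflexive (≡.sym h))))

monic-xn1 : ∀ n → Monic (suc n) (xn1 (suc n))
monic-xn1 n = monic (ℤ.- 1ℤ ∷ replicate n 0ℤ) (≡.cong suc (ListP.length-replicate n)) ≡.refl

-- Correctness of long division by monic polynomials

module Division (X : PolynomialRing) where
  open PolynomialRing X
  open Values
  open Reduction X
  open Relation.Binary.Reasoning.Setoid setoid
  private
    module Vq = Variable var-q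

  int≈0⇒≡0 : ∀ {x} → int x ≈ 0# → x ≡ 0ℤ
  int≈0⇒≡0 {x} h with x ℤP.≟ 0ℤ
  ... | yes e = e
  ... | no ne = contradiction (cancel (int-cancellable ne) (trans (*-congʳ h) (trans (zeroˡ _) (sym (zeroʳ _))))) 1≉0

  value-map : ∀ x r → value (map (x ℤ.*_) r) ≈ int x * value r
  value-map x [] = sym (zeroʳ _)
  value-map x (y ∷ r) = trans (+-cong (int-* x y) (*-congˡ (value-map x r)))
    (solve 4 (λ x y q r → x :* y :+ q :* (x :* r) := x :* (y :+ q :* r)) refl _ _ _ _)

  value-umul : ∀ p r → value (umul p r) ≈ value p * value r
  value-umul [] r = sym (zeroˡ _)
  value-umul (x ∷ p) r = begin
    value (uadd (map (x ℤ.*_) r) (0ℤ ∷ umul p r)) ≈⟨ value-uadd (map (x ℤ.*_) r) (0ℤ ∷ umul p r) ⟩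
    value (map (x ℤ.*_) r) + (0# + q * value (umul p r)) ≈⟨ +-cong (value-map x r) (+-congˡ (*-congˡ (value-umul p r))) ⟩
    int x * value r + (0# + q * (value p * value r)) ≈⟨ solve 4 (λ x r q p → x :* r :+ (:0 :+ q :* (p :* r)) := (x :+ q :* p) :* r) refl _ _ _ _ ⟩
    (int x + q * value p) * value r ∎

  value-xn1 : ∀ n → value (xn1 (suc n)) ≈ q ^ suc n - 1#
  value-xn1 n = trans (+-congˡ (*-congˡ (value-monomial n 1ℤ)))
    (solve 2 (λ q x → :- :1 :+ q :* (:1 :* x) := q :* x :- :1) refl q (q ^ n))

  -- Setting q to 0 shows that the first entry vanishes; q can then be cancelled, until the last
  -- entry is reached.
  value-∷ʳ≈0 : ∀ w c → value (w ∷ʳ c) ≈ 0# → c ≡ 0ℤ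
  value-∷ʳ≈0 [] c h = int≈0⇒≡0 (trans (solve 2 (λ c q → c := c :+ q :* :0) refl (int c) q) h)
  value-∷ʳ≈0 (x ∷ w) c h = value-∷ʳ≈0 w c (cancel Vq.cancellable-x (begin
    q * value (w ∷ʳ c) ≈⟨ +-identityˡ _ ⟨
    0# + q * value (w ∷ʳ c) ≈⟨ +-congʳ x≈0 ⟨
    int x + q * value (w ∷ʳ c) ≈⟨ h ⟩
    0# ≈⟨ zeroʳ q ⟨
    q * 0# ∎))
    where
    x≈0 : int x ≈ 0#
    x≈0 = trans (sym (value-cons-at-0 x (w ∷ʳ c))) (trans (Vq.⟦⟧-cong h) Vq.⟦0⟧)

  leading-zero : ∀ c l r → length r ℕ.≤ length l → valueᴮ (c ∷ l) ≈ valueᴮ r → c ≡ 0ℤ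
  leading-zero c l r short h = value-∷ʳ≈0 (uadd s (reverse l)) c (begin
    value (uadd s (reverse l) ∷ʳ c) ≡⟨ ≡.cong value (uadd-∷ʳ s (reverse l) c short′) ⟨
    value (uadd s (reverse l ∷ʳ c)) ≈⟨ value-uadd s (reverse l ∷ʳ c) ⟩
    value s + value (reverse l ∷ʳ c) ≈⟨ +-cong (value-map (ℤ.- 1ℤ) (reverse r)) (reflexive (≡.cong value (≡.sym (ListP.unfold-reverse c l)))) ⟩
    - 1# * value (reverse r) + value (reverse (c ∷ l)) ≈⟨ +-cong (*-congˡ (value-reverse r)) (trans (value-reverse (c ∷ l)) h) ⟩
    - 1# * valueᴮ r + valueᴮ r ≈⟨ solve 1 (λ x → (:- :1) :* x :+ x := :0) refl _ ⟩
    0# ∎)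
    where
    s : List ℤ
    s = map (ℤ.- 1ℤ ℤ.*_) (reverse r)
    short′ : length s ℕ.≤ length (reverse l)
    short′ = ≡.subst₂ ℕ._≤_ (≡.sym (≡.trans (ListP.length-map _ (reverse r)) (ListP.length-reverse r))) (≡.sym (ListP.length-reverse l)) short

  length-subFront : ∀ xs ys → length ys ℕ.≤ length xs → length (subFront xs ys) ≡ length xs
  length-subFront xs [] h = ≡.refl
  length-subFront (x ∷ xs) (y ∷ ys) (ℕ.s≤s h) = ≡.cong suc (length-subFront xs ys h)

  valueᴮ-subFront : ∀ xs ys j → length xs ≡ j ℕ.+ length ys →
    valueᴮ (subFront xs ys) ≈ valueᴮ xs - q ^ j * valueᴮ ys
  valueᴮ-subFront xs [] j h = solve 2 (λ x y → x := x :- y :* :0) refl _ _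
  valueᴮ-subFront [] (y ∷ ys) j h with () ← ≡.trans h (ℕP.+-suc j (length ys))
  valueᴮ-subFront (x ∷ xs) (y ∷ ys) j h = begin
    int (x ℤ.- y) * q ^ length (subFront xs ys) + valueᴮ (subFront xs ys)
      ≈⟨ +-cong (*-cong (trans (int-+ x (ℤ.- y)) (+-congˡ (int-neg y))) (reflexive (≡.cong (q ^_) (length-subFront xs ys short)))) (valueᴮ-subFront xs ys j h′) ⟩
    (int x - int y) * q ^ length xs + (valueᴮ xs - q ^ j * valueᴮ ys)
      ≈⟨ +-congʳ (*-congˡ power-split) ⟩
    (int x - int y) * (q ^ j * q ^ length ys) + (valueᴮ xs - q ^ j * valueᴮ ys)
      ≈⟨ solve 6 (λ x y u v X Y → (x :- y) :* (u :* v) :+ (X :- u :* Y) := x :* (u :* v) :+ X :- u :* (y :* v :+ Y)) refl _ _ _ _ _ _ ⟩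
    int x * (q ^ j * q ^ length ys) + valueᴮ xs - q ^ j * (int y * q ^ length ys + valueᴮ ys)
      ≈⟨ +-congʳ (+-congʳ (*-congˡ power-split)) ⟨
    int x * q ^ length xs + valueᴮ xs - q ^ j * (int y * q ^ length ys + valueᴮ ys) ∎
    where
    h′ : length xs ≡ j ℕ.+ length ys
    h′ = ℕP.suc-injective (≡.trans h (ℕP.+-suc j (length ys)))
    short : length ys ℕ.≤ length xs
    short = ℕP.≤-trans (ℕP.m≤n+m (length ys) j) (ℕP.≤-reflexive (≡.sym h′))
    power-split : q ^ length xs ≈ q ^ j * q ^ length ys
    power-split = trans (reflexive (≡.cong (q ^_) h′)) (^-+ q j (length ys))

  module _ (gt : List ℤ) where
    private
      G : A
      G = valueᴮ (1ℤ ∷ gt)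

      -- Multiplication by `1 ∷ gt`, arranged so that the first entry of the result is visibly the
      -- first entry of the argument. The entries are negated because `subFront` subtracts.
      product : List ℤ → List ℤ
      product [] = replicate (length gt) 0ℤ
      product (c ∷ l) = c ∷ subFront (product l) (map ((ℤ.- c) ℤ.*_) gt)

      length-negated : ∀ c → length (map ((ℤ.- c) ℤ.*_) gt) ≡ length gt
      length-negated c = ListP.length-map _ gt

      length-product : ∀ l → length (product l) ≡ length l ℕ.+ length gt
      length-product [] = ListP.length-replicate (length gt)
      length-product (c ∷ l) = ≡.cong suc (≡.trans (length-subFront (product l) (map ((ℤ.- c) ℤ.*_) gt) (≡.subst₂ ℕ._≤_ (≡.sym (length-negated c)) (≡.sym (length-product l)) (ℕP.m≤n+m (length gt) (length l)))) (length-product l))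

      valueᴮ-product : ∀ l → valueᴮ (product l) ≈ G * valueᴮ l
      valueᴮ-product [] = trans (zeros (length gt)) (sym (zeroʳ _))
        where
        zeros : ∀ n → valueᴮ (replicate n 0ℤ) ≈ 0#
        zeros zero = refl
        zeros (suc n) = trans (+-cong (zeroˡ _) (zeros n)) (+-identityˡ _)
      valueᴮ-product (c ∷ l) = begin
        int c * q ^ length (subFront (product l) cgt) + valueᴮ (subFront (product l) cgt)
          ≈⟨ +-cong (*-congˡ (trans (reflexive (≡.cong (q ^_) (ℕP.suc-injective (length-product (c ∷ l))))) (^-+ q (length l) (length gt))))
               (valueᴮ-subFront (product l) cgt (length l) (≡.trans (length-product l) (≡.cong (length l ℕ.+_) (≡.sym (length-negated c))))) ⟩
        int c * (q ^ length l * q ^ length gt) + (valueᴮ (product l) - q ^ length l * valueᴮ cgt)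
          ≈⟨ +-congˡ (+-cong (valueᴮ-product l) (-‿cong (*-congˡ (trans (valueᴮ-map (ℤ.- c) gt) (*-congʳ (int-neg c)))))) ⟩
        int c * (q ^ length l * q ^ length gt) + (G * valueᴮ l - q ^ length l * (- int c * valueᴮ gt))
          ≈⟨ solve 5 (λ c u v l g → c :* (u :* v) :+ ((:1 :* v :+ g) :* l :- u :* ((:- c) :* g)) := (:1 :* v :+ g) :* (c :* u :+ l)) refl
               (int c) (q ^ length l) (q ^ length gt) (valueᴮ l) (valueᴮ gt) ⟩
        G * valueᴮ (c ∷ l) ∎
        where
        cgt : List ℤ
        cgt = map ((ℤ.- c) ℤ.*_) gt

    -- The first entry of the quotient would be the leading coefficient of a list longer than `rem`,
    -- so it is zero; this repeats until the quotient is exhausted.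
    small-multiple : ∀ rem → length rem ℕ.≤ length gt → ∀ l → valueᴮ rem ≈ G * valueᴮ l → valueᴮ rem ≈ 0#
    small-multiple rem short [] h = trans h (zeroʳ _)
    small-multiple rem short (c ∷ l) h
      with leading-zero c (subFront (product l) (map ((ℤ.- c) ℤ.*_) gt)) rem
             (ℕP.≤-trans short (ℕP.≤-trans (ℕP.m≤n+m (length gt) (length l)) (ℕP.≤-reflexive (≡.sym (ℕP.suc-injective (length-product (c ∷ l)))))))
             (trans (valueᴮ-product (c ∷ l)) (sym h))
    ... | ≡.refl = small-multiple rem short l (trans h (*-congˡ (solve 2 (λ x y → :0 :* x :+ y := y) refl _ _)))

    -- The cofactor is a polynomial in all four variables. Setting a = b = c = 1 fixes both lists
    -- and makes the cofactor a list in q as well.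
    small-∣⇒≈0 : ∀ rem → length rem ℕ.≤ length gt → G ∣ valueᴮ rem → valueᴮ rem ≈ 0#
    small-∣⇒≈0 rem short (divides s e) =
      let l , πs = univariate s in
      small-multiple rem short (reverse l) (begin
        valueᴮ rem ≈⟨ fixed rem ⟨
        π.⟦ valueᴮ rem ⟧ ≈⟨ π.⟦⟧-cong e ⟨
        π.⟦ G * s ⟧ ≈⟨ ⟦*⟧₂ (fixed (1ℤ ∷ gt)) πs ⟩
        G * value l ≈⟨ *-congˡ (valueᴮ-reverse l) ⟨
        G * valueᴮ (reverse l) ∎)
      where
      module π = Endo (substitute q 1# 1# 1#)
      open Naturality R (substitute q 1# 1# 1#)
      fixed : ∀ l → π.⟦ valueᴮ l ⟧ ≈ valueᴮ l
      fixed [] = π.⟦0⟧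
      fixed (c ∷ l) = ⟦+⟧₂ (⟦*⟧₂ (Endo.⟦int⟧ (substitute q 1# 1# 1#) c)
        (⟦^⟧₂ (length l) (at-q (substitute-values q 1# 1# 1#)))) (fixed l)

    record DivisionWithRemainder (f quot : List ℤ) : Set where
      field
        rem : List ℤ
        rem-short : length rem ℕ.≤ length gt
        length-quot : length f ≡ length quot ℕ.+ length gt
        equation : valueᴮ f ≈ G * valueᴮ quot + valueᴮ rem

    divBE-[] : ∀ k → divBE k gt [] ≡ []
    divBE-[] zero = ≡.refl
    divBE-[] (suc k) = ≡.refl

    divBE-spec : ∀ k f → length f ℕ.≤ k → length gt ℕ.≤ length f → DivisionWithRemainder f (divBE k gt f)
    divBE-spec k [] _ h rewrite divBE-[] k = record
      { rem = [] ; rem-short = ℕ.z≤n ; length-quot = ≡.sym (ℕP.n≤0⇒n≡0 h)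
      ; equation = solve 1 (λ x → :0 := x :* :0 :+ :0) refl _ }
    divBE-spec (suc k) (c ∷ rest) (ℕ.s≤s hk) h with length rest <ᵇ length gt in eq
    -- Here the dividend has exactly as many entries as `gt`, one fewer than the divisor, so it is
    -- its own remainder.
    ... | true = record { rem = c ∷ rest ; rem-short = short ; length-quot = ℕP.≤-antisym short h
        ; equation = solve 2 (λ x y → x := y :* :0 :+ x) refl _ _ }
      where
      short : suc (length rest) ℕ.≤ length gt
      short = ℕP.<ᵇ⇒< (length rest) (length gt) (≡.subst Bool.T (≡.sym eq) _)
    ... | false = record
        { rem = rem ; rem-short = rem-short
        ; length-quot = ≡.cong suc (≡.trans (≡.sym same) length-quot)
        ; equation = begin
            int c * q ^ length rest + valueᴮ rest
              ≈⟨ solve 4 (λ x R u g → x :+ R := x :+ u :* g :+ (R :- u :* g)) refl _ _ (q ^ length quot) (int c * valueᴮ gt) ⟩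
            int c * q ^ length rest + q ^ length quot * (int c * valueᴮ gt) + (valueᴮ rest - q ^ length quot * (int c * valueᴮ gt))
              ≈⟨ +-congˡ (+-congˡ (-‿cong (*-congˡ (valueᴮ-map c gt)))) ⟨
            int c * q ^ length rest + q ^ length quot * (int c * valueᴮ gt) + (valueᴮ rest - q ^ length quot * valueᴮ cgt)
              ≈⟨ +-congˡ (trans (sym (valueᴮ-subFront rest cgt (length quot) (≡.trans rest≡ (≡.cong (length quot ℕ.+_) (≡.sym (ListP.length-map _ gt)))))) equation) ⟩
            int c * q ^ length rest + q ^ length quot * (int c * valueᴮ gt) + (G * valueᴮ quot + valueᴮ rem)
              ≈⟨ +-congʳ (+-congʳ (*-congˡ (trans (reflexive (≡.cong (q ^_) rest≡)) (^-+ q (length quot) (length gt))))) ⟩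
            int c * (q ^ length quot * q ^ length gt) + q ^ length quot * (int c * valueᴮ gt) + (G * valueᴮ quot + valueᴮ rem)
              ≈⟨ solve 6 (λ c u v g Q r → c :* (u :* v) :+ u :* (c :* g) :+ ((:1 :* v :+ g) :* Q :+ r) := (:1 :* v :+ g) :* (c :* u :+ Q) :+ r) refl
                   (int c) (q ^ length quot) (q ^ length gt) (valueᴮ gt) (valueᴮ quot) (valueᴮ rem) ⟩
            G * (int c * q ^ length quot + valueᴮ quot) + valueᴮ rem ∎ }
      where
      cgt : List ℤ
      cgt = map (c ℤ.*_) gt
      gt≤rest : length gt ℕ.≤ length rest
      gt≤rest = ℕP.≮⇒≥ λ lt → ≡.subst Bool.T eq (ℕP.<⇒<ᵇ lt)
      same : length (subFront rest cgt) ≡ length rest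
      same = length-subFront rest cgt (ℕP.≤-trans (ℕP.≤-reflexive (ListP.length-map _ gt)) gt≤rest)
      quot : List ℤ
      quot = divBE k gt (subFront rest cgt)
      open DivisionWithRemainder (divBE-spec k (subFront rest cgt)
        (ℕP.≤-trans (ℕP.≤-reflexive same) hk) (ℕP.≤-trans gt≤rest (ℕP.≤-reflexive (≡.sym same))))
      rest≡ : length rest ≡ length quot ℕ.+ length gt
      rest≡ = ≡.trans (≡.sym same) length-quot

  monic-∣⇒≤ : ∀ {m n f g} → Monic m f → Monic n g → value g ∣ value f → n ℕ.≤ m
  monic-∣⇒≤ {m} {n} {f} {g} F@(monic i li ≡.refl) G@(monic j lj ≡.refl) d = ℕP.≮⇒≥ impossible
    where
    impossible : ¬ m ℕ.< n
    -- Being shorter than its divisor, `f` would be zero, although its last entry is 1.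
    impossible m<n with () ← value-∷ʳ≈0 i 1ℤ (trans (sym (valueᴮ-reverse f)) (small-∣⇒≈0 (reverse j) (reverse f)
      (≡.subst₂ ℕ._≤_ (≡.sym (≡.trans (ListP.length-reverse f) (≡.trans (ListP.length-++ i) (≡.trans (ℕP.+-comm (length i) 1) (≡.cong suc li)))))
        (≡.sym (≡.trans (ListP.length-reverse j) lj)) m<n)
      (∣-respˡ (trans (sym (valueᴮ-reverse g)) (reflexive (≡.cong valueᴮ (Monic.reversed G)))) (∣-respʳ (sym (valueᴮ-reverse f)) d))))

  udiv-exact : ∀ {m n f g} → Monic m f → Monic n g → value g ∣ value f → value (udiv f g) * value g ≈ value f
  udiv-exact {m} {n} {f} {g} F@(monic i li ≡.refl) G@(monic j lj ≡.refl) d = begin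
    value (udiv f g) * value g
      ≈⟨ *-cong (value-reverse quot) (sym (valueᴮ-reverse g)) ⟩
    valueᴮ quot * valueᴮ (reverse g)
      ≈⟨ *-cong (reflexive (≡.cong valueᴮ quot≡)) (reflexive (≡.cong valueᴮ (Monic.reversed G))) ⟩
    valueᴮ quot′ * valueᴮ (1ℤ ∷ gt)
      ≈⟨ solve 2 (λ x y → x :* y := y :* x :+ :0) refl _ _ ⟩
    valueᴮ (1ℤ ∷ gt) * valueᴮ quot′ + 0#
      ≈⟨ +-congˡ rem≈0 ⟨
    valueᴮ (1ℤ ∷ gt) * valueᴮ quot′ + valueᴮ rem
      ≈⟨ equation ⟨
    valueᴮ (reverse f)
      ≈⟨ valueᴮ-reverse f ⟩
    value f ∎
    where
    gt quot quot′ : List ℤ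
    gt = reverse j
    quot = divBE (length f) (dropLead (reverse g)) (reverse f)
    quot′ = divBE (length f) gt (reverse f)
    quot≡ : quot ≡ quot′
    quot≡ = ≡.cong (λ l → divBE (length f) (dropLead l) (reverse f)) (Monic.reversed G)
    length-f : length (reverse f) ≡ suc m
    length-f = ≡.trans (ListP.length-reverse f) (≡.trans (ListP.length-++ i) (≡.trans (ℕP.+-comm (length i) 1) (≡.cong suc li)))
    length-gt : length gt ≡ n
    length-gt = ≡.trans (ListP.length-reverse j) lj
    G∣f : valueᴮ (1ℤ ∷ gt) ∣ valueᴮ (reverse f)
    G∣f = ∣-respˡ (trans (sym (valueᴮ-reverse g)) (reflexive (≡.cong valueᴮ (Monic.reversed G)))) (∣-respʳ (sym (valueᴮ-reverse f)) d)
    open DivisionWithRemainder (divBE-spec gt (length f) (reverse f) (ℕP.≤-reflexive (ListP.length-reverse f))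
      (≡.subst₂ ℕ._≤_ (≡.sym length-gt) (≡.sym length-f) (ℕP.m≤n⇒m≤1+n (monic-∣⇒≤ F G d))))
    rem≈0 : valueᴮ rem ≈ 0#
    rem≈0 = small-∣⇒≈0 gt rem rem-short (∣-respʳ
      (trans (+-congʳ equation) (solve 2 (λ x y → x :+ y :- x := y) refl _ _))
      (∣- G∣f (∣*ʳ (valueᴮ quot′) ∣-refl)))

  divBE-leading : ∀ k c rest gt → length gt ℕ.≤ length rest →
    divBE (suc k) gt (c ∷ rest) ≡ c ∷ divBE k gt (subFront rest (map (c ℤ.*_) gt))
  divBE-leading k c rest gt h with length rest <ᵇ length gt in eq
  ... | true = contradiction (ℕP.<ᵇ⇒< (length rest) (length gt) (≡.subst Bool.T (≡.sym eq) _)) (ℕP.≤⇒≯ h)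
  ... | false = ≡.refl

  monic-udiv : ∀ {m n f g} → Monic m f → Monic n g → value g ∣ value f → Monic (m ℕ.∸ n) (udiv f g)
  monic-udiv {m} {n} {f} {g} F@(monic i li ≡.refl) G@(monic j lj ≡.refl) d = monic (reverse Q)
    (≡.trans (ListP.length-reverse Q) length-Q)
    (≡.trans (≡.cong reverse quot≡) (ListP.unfold-reverse 1ℤ Q))
    where
    gt Q : List ℤ
    gt = reverse j
    Q = divBE m gt (subFront (reverse i) (map (1ℤ ℤ.*_) gt))
    length-f : length f ≡ suc m
    length-f = ≡.trans (ListP.length-++ i) (≡.trans (ℕP.+-comm (length i) 1) (≡.cong suc li))
    length-i : length (reverse i) ≡ m
    length-i = ≡.trans (ListP.length-reverse i) li
    length-gt : length gt ≡ n
    length-gt = ≡.trans (ListP.length-reverse j) lj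
    gt≤i : length gt ℕ.≤ length (reverse i)
    gt≤i = ≡.subst₂ ℕ._≤_ (≡.sym length-gt) (≡.sym length-i) (monic-∣⇒≤ F G d)
    quot≡ : divBE (length f) (dropLead (reverse g)) (reverse f) ≡ 1ℤ ∷ Q
    quot≡ = ≡.trans (≡.cong (λ l → divBE (length f) (dropLead l) (reverse f)) (Monic.reversed G))
      (≡.trans (≡.cong₂ (λ k l → divBE k gt l) length-f (Monic.reversed F)) (divBE-leading m 1ℤ (reverse i) gt gt≤i))
    length-Q : length Q ≡ m ℕ.∸ n
    length-Q = ≡.sym (≡.trans (≡.cong (ℕ._∸ n) (ℕP.suc-injective (≡.trans (≡.cong suc (≡.sym length-i))
      (≡.trans length-quot (≡.cong₂ (λ l k → length l ℕ.+ k) (divBE-leading m 1ℤ (reverse i) gt gt≤i) length-gt)))))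
      (ℕP.m+n∸n≡m (length Q) n))
      where
      open DivisionWithRemainder (divBE-spec gt (suc m) (1ℤ ∷ reverse i) (ℕP.≤-reflexive (≡.cong suc length-i)) (ℕP.m≤n⇒m≤1+n gt≤i))

-- Regularity modulo Φₙ(q) and Φₙ(-q)

module Cyclotomic (X : PolynomialRing) where
  open PolynomialRing X
  open Values
  open Reduction X
  open Division X
  open Relation.Binary.Reasoning.Setoid setoid
  private
    module Vq = Variable var-q

  φ : ℕ → A
  φ n = value (cycU n)

  -- The product of the Φ_d with d dividing m and d ≤ n.
  Π : ℕ → ℕ → A
  Π m n = value (prodDiv m (cycTable n))

  private
    one : value (1ℤ ∷ []) ≈ 1#
    one = solve 1 (λ q → :1 :+ q :* :0 := :1) refl q

    prodDiv-∣ : ∀ {m d} t ψ → d ℕD.∣ m → value (prodDiv m (t ++ (d , ψ) ∷ [])) ≈ value (prodDiv m t) * value ψ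
    prodDiv-∣ {m} {d} [] ψ h with d ℕD.∣? m
    ... | yes _ = trans (value-umul ψ (1ℤ ∷ [])) (*-comm _ _)
    ... | no n = contradiction h n
    prodDiv-∣ {m} {d} ((e , χ) ∷ t) ψ h with e ℕD.∣? m
    ... | yes _ = trans (value-umul χ _) (trans (*-congˡ (prodDiv-∣ t ψ h)) (trans (sym (*-assoc _ _ _)) (*-congʳ (sym (value-umul χ _)))))
    ... | no _ = prodDiv-∣ t ψ h

    prodDiv-∤ : ∀ {m d} t ψ → ¬ d ℕD.∣ m → value (prodDiv m (t ++ (d , ψ) ∷ [])) ≈ value (prodDiv m t)
    prodDiv-∤ {m} {d} [] ψ h with d ℕD.∣? m
    ... | yes y = contradiction y h
    ... | no n = refl
    prodDiv-∤ {m} {d} ((e , χ) ∷ t) ψ h with e ℕD.∣? m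
    ... | yes _ = trans (value-umul χ _) (trans (*-congˡ (prodDiv-∤ t ψ h)) (sym (value-umul χ _)))
    ... | no _ = prodDiv-∤ t ψ h

    monic-prodDiv : ∀ m t → All (λ (_ , ψ) → ∃ λ k → Monic k ψ) t → ∃ λ k → Monic k (prodDiv m t)
    monic-prodDiv m [] [] = 0 , monic [] ≡.refl ≡.refl
    monic-prodDiv m ((e , χ) ∷ t) ((k , h) ∷ hs) with e ℕD.∣? m
    ... | yes _ = let l , h′ = monic-prodDiv m t hs in k ℕ.+ l , monic-umul h h′
    ... | no _ = monic-prodDiv m t hs

    Π-∣ : ∀ {m} n → suc n ℕD.∣ m → Π m (suc n) ≈ Π m n * φ (suc n)
    Π-∣ n h = prodDiv-∣ (cycTable n) (cycU (suc n)) h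

    Π-∤ : ∀ {m} n → ¬ suc n ℕD.∣ m → Π m (suc n) ≈ Π m n
    Π-∤ n h = prodDiv-∤ (cycTable n) (cycU (suc n)) h

    Π-extend : ∀ {m} n k → Π m n ∣ Π m (k ℕ.+ n)
    Π-extend n zero = ∣-refl
    Π-extend {m} n (suc k) with suc (k ℕ.+ n) ℕD.∣? m
    ... | yes h = ∣-trans (Π-extend n k) (∣-respʳ (sym (Π-∣ (k ℕ.+ n) h)) (∣*ʳ _ ∣-refl))
    ... | no h = ∣-trans (Π-extend n k) (∣-respʳ (sym (Π-∤ (k ℕ.+ n) h)) ∣-refl)

    Π-multiple : ∀ {m m′} n → m ℕD.∣ m′ → Π m n ∣ Π m′ n
    Π-multiple zero h = ∣-refl
    Π-multiple {m} {m′} (suc n) h with suc n ℕD.∣? m | suc n ℕD.∣? m′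
    ... | yes d | yes d′ = ∣-respˡ (sym (Π-∣ n d)) (∣-respʳ (sym (Π-∣ n d′)) (∣-mono (Π-multiple n h) ∣-refl))
    ... | yes d | no d′ = contradiction (ℕD.∣-trans d h) d′
    ... | no d | yes d′ = ∣-respˡ (sym (Π-∤ n d)) (∣-respʳ (sym (Π-∣ n d′)) (∣*ʳ _ (Π-multiple n h)))
    ... | no d | no d′ = ∣-respˡ (sym (Π-∤ n d)) (∣-respʳ (sym (Π-∤ n d′)) (Π-multiple n h))

  geometric : A → ℕ → A
  geometric x zero = 0#
  geometric x (suc k) = 1# + x * geometric x k

  geometric-equality : ∀ x k → (x - 1#) * geometric x k ≈ x ^ k - 1#
  geometric-equality x zero = solve 1 (λ x → (x :- :1) :* :0 := :1 :- :1) refl x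
  geometric-equality x (suc k) = begin
    (x - 1#) * (1# + x * geometric x k) ≈⟨ solve 2 (λ x s → (x :- :1) :* (:1 :+ x :* s) := x :- :1 :+ x :* ((x :- :1) :* s)) refl x _ ⟩
    x - 1# + x * ((x - 1#) * geometric x k) ≈⟨ +-congˡ (*-congˡ (geometric-equality x k)) ⟩
    x - 1# + x * (x ^ k - 1#) ≈⟨ solve 2 (λ x y → x :- :1 :+ x :* (y :- :1) := x :* y :- :1) refl x _ ⟩
    x * x ^ k - 1# ∎

  geometric-at-1 : ∀ x k → x - 1# ∣ geometric x k - int (+ k)
  geometric-at-1 x zero = ∣-respʳ (solve 0 (:0 := :0 :- :0) refl) ∣0
  geometric-at-1 x (suc k) = ∣-respʳ (begin
    x * (geometric x k - int (+ k)) + (x - 1#) * int (+ k) ≈⟨ solve 3 (λ x s k → x :* (s :- k) :+ (x :- :1) :* k := :1 :+ x :* s :- (:1 :+ k)) refl x _ _ ⟩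
    1# + x * geometric x k - (1# + int (+ k)) ≈⟨ +-congˡ (-‿cong (int-+ 1ℤ (+ k))) ⟨
    1# + x * geometric x k - int (+ suc k) ∎)
    (∣+ (∣*ˡ x (geometric-at-1 x k)) (∣*ʳ _ ∣-refl))

  q^-1∣ : ∀ {d m} → d ℕD.∣ m → q ^ d - 1# ∣ q ^ m - 1#
  q^-1∣ {d} (ℕD.divides k ≡.refl) = divides (geometric (q ^ d) k) (trans (geometric-equality (q ^ d) k)
    (+-congʳ (trans (sym (^-* q d k)) (reflexive (≡.cong (q ^_) (ℕP.*-comm d k))))))

  q^-1-lowest : ∀ n {u} → Vq.⟦ u ⟧ ≈ u → Reg u (q ^ suc n - 1#)
  q^-1-lowest n fix = Vq.reg-lowest fix (reg-resp (sym (begin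
    Vq.⟦ q ^ suc n - 1# ⟧ ≈⟨ ⟦-⟧₂ (⟦*⟧₂ Vq.⟦x⟧ refl) Vq.⟦1⟧ ⟩
    0# * Vq.⟦ q ^ n ⟧ - 1# ≈⟨ solve 1 (λ x → :0 :* x :- :1 := :- :1) refl _ ⟩
    - 1# ∎)) (reg-neg reg-1))
    where open Naturality R Vq.endo

  -- The index is shifted: `IsCyclotomic n` concerns Φ with index n + 1. The content of `equality`
  -- is that the division defining `cycU (suc n)` leaves no remainder.
  record IsCyclotomic (n : ℕ) : Set where
    field
      degree : ℕ
      isMonic : Monic degree (cycU (suc n))
      equality : φ (suc n) * Π (suc n) n ≈ q ^ suc n - 1#

    φ∣ : φ (suc n) ∣ q ^ suc n - 1#
    φ∣ = divides (Π (suc n) n) equality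

    Π≈ : Π (suc n) (suc n) ≈ q ^ suc n - 1#
    Π≈ = trans (Π-∣ n ℕD.∣-refl) (trans (*-comm _ _) equality)

    φ-cancellable : Cancellable (φ (suc n))
    φ-cancellable = reg-factor φ∣ (q^-1-lowest n Vq.⟦0⟧)

  module _ (n : ℕ) (below : ∀ d → d ℕ.≤ n → IsCyclotomic d) where
    private
      N : ℕ
      N = suc n
      open IsCyclotomic (below n ℕP.≤-refl)

      -- Φ_N divides q^N - 1, whose constant term is -1, and so it is regular modulo every integer;
      -- `reg-swap` exchanges the two for a non-zero integer.
      reg-integer : ∀ k → Reg (φ N) (int (+ suc k))
      reg-integer k = reg-swap (int-cancellable {+ suc k} λ ()) (reg-factor φ∣ (q^-1-lowest n (Vq.⟦int⟧ (+ suc k))))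

      -- (q^N - 1)/(q^d - 1) is a multiple of Φ_N congruent to N/d modulo q^d - 1.
      reg-divisor : ∀ d → d ℕ.< n → suc d ℕD.∣ N → Reg (φ N) (q ^ suc d - 1#)
      reg-divisor d d<n (ℕD.divides zero ())
      reg-divisor d d<n h@(ℕD.divides (suc k) N≡) =
        let divides s es = proper
            φs≈S = cancel (q^-1-lowest d Vq.⟦0⟧) (begin
              (x - 1#) * (φ N * s) ≈⟨ solve 3 (λ f φ s → f :* (φ :* s) := φ :* (f :* s)) refl _ _ _ ⟩
              φ N * ((x - 1#) * s) ≈⟨ *-congˡ es ⟩
              φ N * Π N n ≈⟨ equality ⟩
              q ^ N - 1# ≈⟨ +-congʳ (reflexive (≡.cong (q ^_) (≡.trans N≡ (ℕP.*-comm (suc k) (suc d))))) ⟩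
              q ^ (suc d ℕ.* suc k) - 1# ≈⟨ +-congʳ (^-* q (suc d) (suc k)) ⟩
              x ^ suc k - 1# ≈⟨ geometric-equality x (suc k) ⟨
              (x - 1#) * S ∎)
            divides w ew = geometric-at-1 x (suc k)
        in reg-mod (- w) (divides (- s) (begin
              φ N * - s ≈⟨ solve 2 (λ φ s → φ :* (:- s) := :- (φ :* s)) refl _ _ ⟩
              - (φ N * s) ≈⟨ -‿cong φs≈S ⟩
              - S ≈⟨ solve 2 (λ S k → :- S := :- (S :- k) :- k) refl _ _ ⟩
              - (S - int (+ suc k)) - int (+ suc k) ≈⟨ +-congʳ (-‿cong ew) ⟨
              - ((x - 1#) * w) - int (+ suc k) ≈⟨ +-congʳ (-‿distribʳ-* _ _) ⟩
              (x - 1#) * - w - int (+ suc k) ∎)) (reg-integer k)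
        where
        x S : A
        x = q ^ suc d
        S = geometric x (suc k)
        -- q^d - 1, for the divisor d in question, is the product of the Φ_e with e dividing d, and
        -- each such e is a proper divisor of N.
        proper : x - 1# ∣ Π N n
        proper with ℕP.m≤n⇒∃[o]m+o≡n d<n
        ... | o , e = ∣-respˡ (IsCyclotomic.Π≈ (below d (ℕP.<⇒≤ d<n)))
              (∣-trans (Π-multiple (suc d) h) (≡.subst (λ j → Π N (suc d) ∣ Π N j) (≡.trans (ℕP.+-comm o (suc d)) e) (Π-extend (suc d) o)))

      reg-divisor′ : ∀ g → g ℕD.∣ N → g ≢ N → Reg (φ N) (q ^ g - 1#)
      reg-divisor′ zero h g≢N with () ← ℕD.0∣⇒≡0 h
      reg-divisor′ (suc d) h g≢N = reg-divisor d (ℕ.s≤s⁻¹ (ℕP.≤∧≢⇒< (ℕD.∣⇒≤ h) g≢N)) h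

    -- Bézout's identity is applied to exponents: Φ_N divides every q^(yN) - 1, so from Φ_N dividing
    -- (q^m - 1)t it divides (q^g - 1)t with g = gcd(m, N). As N does not divide m, g is a proper
    -- divisor of N, and `reg-divisor′` applies.
    reg-q^-1 : ∀ m → ¬ N ℕD.∣ m → Reg (φ N) (q ^ m - 1#)
    reg-q^-1 m N∤m = reg λ t d → cancel∣ (reg-divisor′ g (gcd[m,n]∣n m N) g≢N) t (to-gcd t d (Bézout.identity (gcd-GCD m N)))
      where
      g : ℕ
      g = gcd m N
      g≢N : g ≢ N
      g≢N e = N∤m (≡.subst (ℕD._∣ m) e (gcd[m,n]∣m m N))
      difference : ∀ {x y} t → g ℕ.+ x ≡ y → φ N ∣ (q ^ x - 1#) * t → φ N ∣ (q ^ y - 1#) * t → φ N ∣ (q ^ g - 1#) * t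
      difference {x} {y} t e dx dy = ∣-respʳ (begin
        (q ^ y - 1#) * t - q ^ g * ((q ^ x - 1#) * t) ≈⟨ +-congʳ (*-congʳ (+-congʳ (trans (reflexive (≡.cong (q ^_) (≡.sym e))) (^-+ q g x)))) ⟩
        (q ^ g * q ^ x - 1#) * t - q ^ g * ((q ^ x - 1#) * t) ≈⟨ solve 3 (λ G X t → (G :* X :- :1) :* t :- G :* ((X :- :1) :* t) := (G :- :1) :* t) refl _ _ _ ⟩
        (q ^ g - 1#) * t ∎) (∣- dy (∣*ˡ _ dx))
      from-m : ∀ x t → φ N ∣ (q ^ m - 1#) * t → φ N ∣ (q ^ (x ℕ.* m) - 1#) * t
      from-m x t d = ∣-trans d (∣-mono (q^-1∣ (ℕD.n∣m*n x)) ∣-refl)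
      from-N : ∀ y t → φ N ∣ (q ^ (y ℕ.* N) - 1#) * t
      from-N y t = ∣*ʳ t (∣-trans φ∣ (q^-1∣ (ℕD.n∣m*n y)))
      to-gcd : ∀ t → φ N ∣ (q ^ m - 1#) * t → Bézout.Identity g m N → φ N ∣ (q ^ g - 1#) * t
      to-gcd t d (Bézout.+- x y e) = difference t e (from-N y t) (from-m x t d)
      to-gcd t d (Bézout.-+ x y e) = difference t e (from-m x t d) (from-N y t)

  private
    -- Exactness of the division needs the product of the Φ_d over proper divisors d of N to divide
    -- q^N - 1. Each Φ_d does, and they combine by `*-∣`: the smaller ones divide some q^e - 1 with
    -- e < d, which is regular modulo Φ_d. So exactness and regularity are proved in one induction.
    cyclotomic-step : ∀ n → (∀ d → d ℕ.< n → IsCyclotomic d) → IsCyclotomic n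
    cyclotomic-step n below = record
      { degree = _
      ; isMonic = monic-udiv (monic-xn1 n) (proj₂ monic-Π) Π∣xn1
      ; equality = trans (udiv-exact (monic-xn1 n) (proj₂ monic-Π) Π∣xn1) (value-xn1 n)
      }
      where
      N : ℕ
      N = suc n
      table : ∀ k → k ℕ.≤ n → All (λ (_ , ψ) → ∃ λ k → Monic k ψ) (cycTable k)
      table zero h = []
      table (suc k) h = AllP.++⁺ (table k (ℕP.<⇒≤ h)) ((_ , IsCyclotomic.isMonic (below k h)) ∷ [])
      monic-Π : ∃ λ k → Monic k (prodDiv N (cycTable n))
      monic-Π = monic-prodDiv N (cycTable n) (table n ℕP.≤-refl)
      regular : ∀ k → k ℕ.< n → ∀ j → j ℕ.≤ k → Reg (φ (suc k)) (Π N j)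
      regular k k<n zero h = reg-resp (sym one) reg-1
      regular k k<n (suc j) h with suc j ℕD.∣? N
      ... | no ∤N = reg-resp (sym (Π-∤ j ∤N)) (regular k k<n j (ℕP.<⇒≤ h))
      ... | yes ∣N = reg-resp (sym (Π-∣ j ∣N)) (reg-* (regular k k<n j (ℕP.<⇒≤ h))
              (reg-factor (IsCyclotomic.φ∣ (below j (ℕP.<-trans h k<n)))
                (reg-q^-1 k (λ d d≤k → below d (ℕP.≤-<-trans d≤k k<n)) (suc j) (ℕD.>⇒∤ (ℕ.s≤s h)))))
      Π∣ : ∀ k → k ℕ.≤ n → Π N k ∣ q ^ N - 1#
      Π∣ zero h = ∣-respˡ (sym one) 1∣
      Π∣ (suc k) h with suc k ℕD.∣? N
      ... | no ∤N = ∣-respˡ (sym (Π-∤ k ∤N)) (Π∣ k (ℕP.<⇒≤ h))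
      ... | yes ∣N = ∣-respˡ (sym (Π-∣ k ∣N)) (*-∣ (regular k h k ℕP.≤-refl) (Π∣ k (ℕP.<⇒≤ h))
              (∣-trans (IsCyclotomic.φ∣ (below k h)) (q^-1∣ ∣N)))
      Π∣xn1 : Π N n ∣ value (xn1 N)
      Π∣xn1 = ∣-respʳ (sym (value-xn1 n)) (Π∣ n ℕP.≤-refl)

    cyclotomic-below : ∀ n d → d ℕ.< n → IsCyclotomic d
    cyclotomic-below (suc n) d (ℕ.s≤s d≤n) = cyclotomic-step d (λ e e<d → cyclotomic-below n e (ℕP.<-≤-trans e<d d≤n))

  cyclotomic : ∀ n → IsCyclotomic n
  cyclotomic n = cyclotomic-below (suc n) n ℕP.≤-refl

  φ-regular : ∀ n m → ¬ suc n ℕD.∣ m → Reg (φ (suc n)) (q ^ m - 1#)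
  φ-regular n = reg-q^-1 n (λ d _ → cyclotomic d)

  φ⁻ : ℕ → A
  φ⁻ n = value (negAlt (cycU n))

  private
    τ : Endo
    τ = substitute (- q) a b c
    module τ = Endo τ
    open Naturality R τ

    τ-values : Values τ (- q) a b c
    τ-values = substitute-values (- q) a b c

    τ-value : ∀ l → τ.⟦ value l ⟧ ≈ value (negAlt l)
    τ-value [] = τ.⟦0⟧
    τ-value (x ∷ []) = trans (⟦+⟧₂ (τ.⟦int⟧ x) (trans (τ.⟦⟧-cong (zeroʳ q)) τ.⟦0⟧)) (+-congˡ (sym (zeroʳ q)))
    τ-value (x ∷ y ∷ l) = begin
      τ.⟦ int x + q * (int y + q * value l) ⟧
        ≈⟨ ⟦+⟧₂ (τ.⟦int⟧ x) (⟦*⟧₂ (at-q τ-values) (⟦+⟧₂ (τ.⟦int⟧ y) (⟦*⟧₂ (at-q τ-values) (τ-value l)))) ⟩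
      int x + - q * (int y + - q * value (negAlt l))
        ≈⟨ solve 4 (λ x q y l → x :+ (:- q) :* (y :+ (:- q) :* l) := x :+ q :* (:- y :+ q :* l)) refl _ _ _ _ ⟩
      int x + q * (- int y + q * value (negAlt l))
        ≈⟨ +-congˡ (*-congˡ (+-congʳ (int-neg y))) ⟨
      int x + q * (int (ℤ.- y) + q * value (negAlt l)) ∎

    τ-involutive : ∀ p → τ.⟦ τ.⟦ p ⟧ ⟧ ≈ p
    τ-involutive = unique (τ ∘ᴱ τ) (record
      { at-q = trans (τ.⟦⟧-cong (at-q τ-values)) (trans (τ.⟦-⟧ q) (trans (-‿cong (at-q τ-values)) (-‿involutive q)))
      ; at-a = trans (τ.⟦⟧-cong (at-a τ-values)) (at-a τ-values)
      ; at-b = trans (τ.⟦⟧-cong (at-b τ-values)) (at-b τ-values)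
      ; at-c = trans (τ.⟦⟧-cong (at-c τ-values)) (at-c τ-values)
      })

  -- The involution `τ`, which replaces q by -q, exchanges Φₙ(q) and Φₙ(-q) and fixes `x`; the
  -- divisibility is carried over by `τ`, used there, and carried back.
  φ⁻-regular : ∀ n {x} → τ.⟦ x ⟧ ≈ x → Reg (φ n) x → Reg (φ⁻ n) x
  φ⁻-regular n {x} fix r = reg λ t d → ∣-respˡ (τ-value (cycU n)) (∣-respʳ (τ-involutive t) (τ.⟦⟧-∣
    (cancel∣ r τ.⟦ t ⟧ (∣-respʳ (⟦*⟧₂ fix refl) (∣-respˡ (trans (τ.⟦⟧-cong (sym (τ-value (cycU n)))) (τ-involutive (φ n))) (τ.⟦⟧-∣ d))))))

  private
    negative-odd-power : ∀ x r → (- x) ^ suc (r ℕ.* 4) ≈ - (x ^ suc (r ℕ.* 4))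
    negative-odd-power x zero = solve 1 (λ x → (:- x) :* :1 := :- (x :* :1)) refl x
    negative-odd-power x (suc r) = begin
      - x * (- x * (- x * (- x * (- x) ^ suc (r ℕ.* 4)))) ≈⟨ *-congˡ (*-congˡ (*-congˡ (*-congˡ (negative-odd-power x r)))) ⟩
      - x * (- x * (- x * (- x * - (x ^ suc (r ℕ.* 4))))) ≈⟨ solve 2 (λ x y → (:- x) :* ((:- x) :* ((:- x) :* ((:- x) :* (:- y)))) := :- (x :* (x :* (x :* (x :* y))))) refl x _ ⟩
      - (x * (x * (x * (x * x ^ suc (r ℕ.* 4))))) ∎

  module _ (r : ℕ) where
    private
      n w : ℕ
      n = suc (r ℕ.* 4)
      w = suc (r ℕ.* 8 ℕ.+ 1)

      q^w : q ^ n * q ^ n ≈ q ^ w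
      q^w = trans (sym (^-+ q n n)) (reflexive (≡.cong (q ^_) (lemma r)))
        where
        lemma : ∀ r → suc (r ℕ.* 4) ℕ.+ suc (r ℕ.* 4) ≡ suc (r ℕ.* 8 ℕ.+ 1)
        lemma = ℕSolver.solve-∀

    open IsCyclotomic (cyclotomic (r ℕ.* 4)) using (φ∣; φ-cancellable)

    -- As n is odd, replacing q by -q turns the divisibility of qⁿ - 1 by Φₙ(q) into that of qⁿ + 1
    -- by Φₙ(-q); the two multiples have product q²ⁿ - 1.
    φφ⁻∣ : φ n * φ⁻ n ∣ 1# - q ^ w
    φφ⁻∣ = ∣-respʳ (begin
      - ((q ^ n - 1#) * - (- (q ^ n) - 1#)) ≈⟨ solve 1 (λ x → :- ((x :- :1) :* (:- (:- x :- :1))) := :1 :- x :* x) refl (q ^ n) ⟩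
      1# - q ^ n * q ^ n ≈⟨ +-congˡ (-‿cong q^w) ⟩
      1# - q ^ w ∎)
      (∣-neg (∣-mono φ∣ (∣-neg (∣-respˡ (τ-value (cycU n)) (∣-respʳ
        (⟦-⟧₂ (trans (⟦^⟧₂ n (at-q τ-values)) (negative-odd-power q r)) τ.⟦1⟧) (τ.⟦⟧-∣ φ∣))))))

    φφ⁻-regular-q : Reg (φ n * φ⁻ n) q
    φφ⁻-regular-q = reg-mod (q ^ (r ℕ.* 8 ℕ.+ 1)) (∣-respʳ
      (solve 1 (λ x → :- (:1 :- x) := x :- :1) refl _) (∣-neg φφ⁻∣)) reg-1

    φφ⁻-regular : ∀ i → ¬ n ℕD.∣ 4 ℕ.* i → Reg (φ n * φ⁻ n) (1# - (q ^ 4) ^ i)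
    φφ⁻-regular i n∤4i = reg-product φ-cancellable regular (φ⁻-regular n fixed regular)
      where
      fixed : τ.⟦ 1# - (q ^ 4) ^ i ⟧ ≈ 1# - (q ^ 4) ^ i
      fixed = ⟦-⟧₂ τ.⟦1⟧ (trans (⟦^⟧₂ i (⟦^⟧₂ 4 (at-q τ-values)))
        (^-cong i (solve 1 (λ q → (:- q) :* ((:- q) :* ((:- q) :* ((:- q) :* :1))) := q :* (q :* (q :* (q :* :1)))) refl q)))
      regular : Reg (φ n) (1# - (q ^ 4) ^ i)
      regular = reg-resp (trans (solve 1 (λ x → :- (x :- :1) := :1 :- x) refl _) (+-congˡ (-‿cong (^-* q 4 i))))
        (reg-neg (φ-regular (r ℕ.* 4) (4 ℕ.* i) n∤4i))

-- The specialisation a = b = c = 1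

module Specialised (X : PolynomialRing) where
  open PolynomialRing X
  open Values
  open ReducedSum X
  open Shapes X
  open Reduction X
  open Cyclotomic X
  open Relation.Binary.Reasoning.Setoid setoid
  private
    module Vq = Variable var-q
    π : Endo
    π = substitute q 1# 1# 1#
    module π = Endo π
    π-values : Values π q 1# 1# 1#
    π-values = substitute-values q 1# 1# 1#
    open Naturality R π

    module Nq = Naturality R Vq.endo

    factor-lowest : ∀ i x {u} → x ≈ 1# → Vq.⟦ u ⟧ ≈ u → Reg u (1# - x * p^ suc i)
    factor-lowest i x {u} ex fix = Vq.reg-lowest fix (reg-resp (sym (begin
      Vq.⟦ 1# - x * p^ suc i ⟧ ≈⟨ Vq.⟦⟧-cong (+-congˡ (-‿cong (trans (*-congʳ ex) (*-identityˡ _)))) ⟩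
      Vq.⟦ 1# - p^ suc i ⟧ ≈⟨ Nq.⟦-⟧₂ Vq.⟦1⟧ (Nq.⟦*⟧₂ (Nq.⟦^⟧₂ 4 Vq.⟦x⟧) refl) ⟩
      1# - 0# ^ 4 * Vq.⟦ p^ i ⟧ ≈⟨ solve 1 (λ x → :1 :- :0 :* (:0 :* (:0 :* (:0 :* :1))) :* x := :1) refl _ ⟩
      1# ∎)) reg-1)

    1-1·1·x : ∀ x → 1# - x ≈ 1# - 1# * 1# * x
    1-1·1·x x = solve 1 (λ x → :1 :- x := :1 :- :1 :* :1 :* x) refl x

    step-regular : ∀ {u} i → Reg u (1# - p^ i) → Reg u (S₁.step i)
    step-regular i r = reg-* (reg-resp (1-1·1·x _) r) (reg-* (reg-resp (1-1·1·x _) r) r)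

    denominator-regular : ∀ n {u} → (∀ i → i ℕ.< n → Reg u (1# - p^ suc i)) → Reg u (S₁.denominator n)
    denominator-regular zero h = reg-1
    denominator-regular (suc n) h = reg-* (denominator-regular n λ i i<n → h i (ℕP.m<n⇒m<1+n i<n))
      (step-regular (suc n) (h n ℕP.≤-refl))

    denominator-lowest : ∀ n {u} → Vq.⟦ u ⟧ ≈ u → Reg u (S₁.denominator n)
    denominator-lowest n fix = denominator-regular n λ i _ →
      reg-resp (+-congˡ (-‿cong (*-identityˡ _))) (factor-lowest i 1# refl fix)

  q+1-lowest : ∀ {u} → Vq.⟦ u ⟧ ≈ u → Reg u (q + 1#)
  q+1-lowest fix = Vq.reg-lowest fix (reg-resp (sym (trans (Nq.⟦+⟧₂ Vq.⟦x⟧ Vq.⟦1⟧) (+-identityˡ 1#))) reg-1)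

  specialised-denominator-cancellable : ∀ n → Cancellable (q * (q + 1#) * S₁.denominator n)
  specialised-denominator-cancellable n = reg-* (reg-* q-cancellable (q+1-lowest Vq.⟦0⟧)) (denominator-lowest n Vq.⟦0⟧)

  specialised : ℕ → A
  specialised n = π.⟦ reducedSum n ⟧

  specialised-equality : ∀ n → (q + 1#) * specialised n ≈ S₁.partialSum n
  specialised-equality n = begin
    (q + 1#) * π.⟦ reducedSum n ⟧ ≈⟨ ⟦*⟧₂ (⟦+⟧₂ (at-q π-values) (at-a π-values)) refl ⟨
    π.⟦ (q + a) * reducedSum n ⟧ ≈⟨ π.⟦⟧-cong (reducedSum-equality n) ⟩
    π.⟦ partialSum n ⟧ ≈⟨ partialSum-natural (at-q π-values) (at-a π-values) (at-b π-values) (at-c π-values) n ⟩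
    S₁.partialSum n ∎

  -- The factors 1 - pⁱ have constant term 1 and q is a variable, so the denominator is regular
  -- modulo every prime, as `reduced` demands. Setting a = b = c = 1 supplies the coefficient lists
  -- on which the gcd is computed.
  specialised-reduced : ∀ n → Reduced (specialised n) (q * S₁.denominator n)
  specialised-reduced n =
    let f , ef = univariate (reducedSum n)
        g , eg = univariate (q * denominator n)
        eg′ = trans (sym (⟦*⟧₂ (at-q π-values) (denominator-natural (at-q π-values) (at-a π-values) (at-b π-values) (at-c π-values) n))) eg
        open Reduced (reduced f g
          (reg-resp eg′ (reg-* q-cancellable (denominator-lowest n Vq.⟦0⟧)))
          (λ {p} _ → reg-resp eg′ (reg-* (Vq.reg-x (Vq.⟦int⟧ (+ p))) (denominator-lowest n (Vq.⟦int⟧ (+ p))))))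
    in record { h = h ; N = N ; D = D ; F≈ = trans F≈ (sym ef) ; G≈ = trans G≈ (sym eg′) ; coprime = coprime }

  module _ (r : ℕ) where
    private
      n N w : ℕ
      n = suc (r ℕ.* 4)
      N = suc (r ℕ.+ r)
      w = suc (r ℕ.* 8 ℕ.+ 1)

    φφ⁻∣specialised : φ n * φ⁻ n ∣ specialised N
    φφ⁻∣specialised = ∣-trans (φφ⁻∣ r) (∣-respˡ
      (trans (⟦-⟧₂ π.⟦1⟧ (⟦*⟧₂ (⟦^⟧₂ w (at-q π-values)) (⟦*⟧₂ (at-a π-values) (at-a π-values))))
        (solve 1 (λ x → :1 :- x :* (:1 :* :1) := :1 :- x) refl _))
      (π.⟦⟧-∣ (modulus∣reducedSum r)))

    -- The factors are 1 - q⁴ⁱ with 1 ≤ i ≤ N. As n = 4r + 1 is prime to 4, n dividing 4i would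
    -- force n to divide i, but i ≤ N = 2r + 1 < n for r > 0.
    denominator-regular-φφ⁻ : 0 ℕ.< r → Reg (φ n * φ⁻ n) (q * S₁.denominator N)
    denominator-regular-φφ⁻ r>0 = reg-* (φφ⁻-regular-q r) (denominator-regular N λ i i<N → φφ⁻-regular r (suc i) (indivisible i i<N))
      where
      coprime : Coprime n 4
      coprime {d} (d∣n , d∣4) = ℕD.∣1⇒≡1 (ℕD.∣m+n∣m⇒∣n
        (≡.subst (d ℕD.∣_) (ℕP.+-comm 1 (r ℕ.* 4)) d∣n) (ℕD.∣n⇒∣m*n r d∣4))
      indivisible : ∀ i → i ℕ.< N → ¬ n ℕD.∣ 4 ℕ.* suc i
      indivisible i i<N d = ℕP.<⇒≱ N<n (ℕP.≤-trans (ℕD.∣⇒≤ (coprime-divisor coprime d)) i<N)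
        where
        N<n : N ℕ.< n
        N<n = ℕ.s≤s (ℕP.<-≤-trans (ℕP.m<m+n (r ℕ.+ r) (ℕP.≤-trans r>0 (ℕP.m≤m+n r r)))
          (ℕP.≤-reflexive (lemma r)))
          where
          lemma : ∀ r → r ℕ.+ r ℕ.+ (r ℕ.+ r) ≡ r ℕ.* 4
          lemma = ℕSolver.solve-∀

    φφ⁻∣reduced : 0 ℕ.< r → φ n * φ⁻ n ∣ Reduced.N (specialised-reduced N)
    φφ⁻∣reduced r>0 = cancel∣ (reg-factor (divides D G≈) (denominator-regular-φφ⁻ r>0)) _
      (∣-respʳ (sym F≈) φφ⁻∣specialised)
      where open Reduced (specialised-reduced N) renaming (N to N′)

-- Reduced forms of the two sums and the theorem

open import Data.Nat using (_+_; _*_; _<_)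
open import Data.Nat.DivMod using (_/_; _%_)
open Sums using (sum₁~; sum₂~)

private
  module R = Divisibility polyRing
  module C = Cyclotomic polynomials
  module Sp = Specialised polynomials
  module F = Fractions polyRing
  module Sum = ReducedSum polynomials
  module Sh = Shapes polynomials
  open PolynomialRing polynomials using (q; a; 1≉0)

  to∣P : ∀ {x y} → x R.∣ y → x ∣P y
  to∣P (R.divides s e) = s , ≋⇒≈P e

  from∣P : ∀ {x y} → x ∣P y → x R.∣ y
  from∣P (s , e) = R.divides s (≈P⇒≋ e)

  congZero : ∀ {f P N D} → R.Cancellable D → (∀ g → g R.∣ N → g R.∣ D → g R.∣ R.1#) →
             f F.~ (N , D) → P R.∣ N → CongZero f P
  congZero {f} {P} {N} {D} D-cancellable coprime (F.cross e) d = N , D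
    , (λ D≈0 → 1≉0 (R.cancel {D} {R.1#} {R.0#} D-cancellable
        (R.trans (R.*-congʳ {R.1#} {D} {R.0#} (≈P⇒≋ D≈0)) (R.sym (R.zeroʳ D)))))
    , (λ g g∣N g∣D → to∣P (coprime g (from∣P g∣N) (from∣P g∣D)))
    , ≋⇒≈P e
    , to∣P d

  first : ∀ r → CongZero (sumF (suc (r + r)) summand₁) (1P -P monomial 1ℤ (suc (r * 8 + 1)) 2 0 0)
  first r = congZero {sumF N summand₁} {_} {Sum.reducedSum N} {Sum.denominator N}
    (Sum.denominator-cancellable N)
    (λ g g∣N → Sum.reducedSum-coprime N g∣N N)
    (F.reduce {z = q R.+ a} Sum.q+a-cancellable (F.reshape (R.sym (Sum.reducedSum-equality N)) R.refl (sum₁~ N)))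
    (R.∣-respˡ modulus≋ (Sum.modulus∣reducedSum r))
    where
    N w : ℕ
    N = suc (r + r)
    w = suc (r * 8 + 1)
    modulus≋ : Sum.modulus r ≋ (1P -P monomial 1ℤ w 2 0 0)
    modulus≋ = R.+-congˡ {1P} (R.-‿cong (R.sym (R.trans (monomial≋ w 2 0 0)
      (R.solve 2 (λ x a → x R.:* (a R.:* (a R.:* R.:1)) R.:* R.:1 R.:* R.:1 R.:= x R.:* (a R.:* a)) R.refl (q R.^ w) a))))

  second : ∀ r → 0 < r → CongZero (sumF (suc (r + r)) summand₂) (Φ (suc (r * 4)) *P Φ⁻ (suc (r * 4)))
  second r r>0 = congZero {sumF N summand₂} {_} {N′} {D}
    (R.reg-factor (R.divides h (R.trans (R.*-comm D h) G≈)) D₂-cancellable)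
    coprime
    (F.reduce {z = h} (R.reg-factor (R.divides D G≈) D₂-cancellable)
      (F.reshape (R.sym F≈) (R.sym G≈)
        (F.reduce {z = q R.+ R.1#} (Sp.q+1-lowest (R.Variable.⟦0⟧ (PolynomialRing.var-q polynomials)))
          (F.reshape (R.sym (Sp.specialised-equality N))
            (R.solve 3 (λ q x d → q R.:* x R.:* d R.:= x R.:* (q R.:* d)) R.refl q (q R.+ R.1#) (Sh.S₁.denominator N))
            (sum₂~ Sp.specialised-denominator-cancellable N)))))
    (R.∣-respˡ (R.*-cong {C.φ n} {Φ n} {C.φ⁻ n} {Φ⁻ n} (R.sym (toPolyFrom≋ (cycU n))) (R.sym (toPolyFrom≋ (negAlt (cycU n)))))
      (Sp.φφ⁻∣reduced r r>0))
    where
    N n : ℕ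
    N = suc (r + r)
    n = suc (r * 4)
    module Red = Reduction polynomials
    open Red.Reduced (Sp.specialised-reduced N) renaming (N to N′)
    D₂-cancellable : R.Cancellable (q R.* Sh.S₁.denominator N)
    D₂-cancellable = R.reg-factor {g = q R.* (q R.+ R.1#) R.* Sh.S₁.denominator N} (R.divides (q R.+ R.1#)
      (R.solve 3 (λ q x d → q R.:* d R.:* x R.:= q R.:* x R.:* d) R.refl q (q R.+ R.1#) (Sh.S₁.denominator N)))
      (Sp.specialised-denominator-cancellable N)

theorem10p1 : (n : ℕ) → n % 4 ≡ 1 →
    CongZero (sumF ((n + 1) / 2) summand₁) (1P -P monomial 1ℤ (2 * n) 2 0 0)
    × (1 < n → CongZero (sumF ((n + 1) / 2) summand₂) (Φ n *P Φ⁻ n))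
theorem10p1 n h =
    ≡.subst₂ (λ N w → CongZero (sumF N summand₁) (1P -P monomial 1ℤ w 2 0 0)) (≡.sym half) (≡.sym double) (first r)
  , (λ n>1 → ≡.subst₂ (λ N n → CongZero (sumF N summand₂) (Φ n *P Φ⁻ n)) (≡.sym half) (≡.sym n≡) (second r (positive n>1)))
  where
  r : ℕ
  r = n / 4
  n≡ : n ≡ suc (r * 4)
  n≡ = ≡.trans (ℕDM.m≡m%n+[m/n]*n n 4) (≡.cong (_+ r * 4) h)
  lemma₁ : ∀ r → suc (r * 4) + 1 ≡ suc (r + r) * 2
  lemma₁ = ℕSolver.solve-∀
  lemma₂ : ∀ r → 2 * suc (r * 4) ≡ suc (r * 8 + 1)
  lemma₂ = ℕSolver.solve-∀
  half : (n + 1) / 2 ≡ suc (r + r)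
  half = ≡.trans (≡.cong (λ n → (n + 1) / 2) n≡) (≡.trans (≡.cong (_/ 2) (lemma₁ r)) (ℕDM.m*n/n≡m (suc (r + r)) 2))
  double : 2 * n ≡ suc (r * 8 + 1)
  double = ≡.trans (≡.cong (2 *_) n≡) (lemma₂ r)
  positive : 1 < n → 0 < r
  positive n>1 with r in eq
  ... | zero = contradiction (≡.subst (1 <_) (≡.trans n≡ (≡.cong (λ r → suc (r * 4)) eq)) n>1) (ℕP.<-irrefl ≡.refl)
  ... | suc _ = ℕ.s≤s ℕ.z≤n
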